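{- Let $K$ be a field with algebraic closure $\overline{K}$ and with a non-archimedean absolute value $|\cdot|_v$ on $\overline{K}$. Let $\phi\in K(z)$ be a rational function of degree $d\geq 2$. Let $x_1,\ldots,x_{d+1}\in\mathbb{P}^1(\overline{K})$ be the fixed points of $\phi$, repeated according to multiplicity. If any $x_i$ is repelling, then $\phi$ does not have potentially good reduction. Otherwise (no $x_i$ is repelling), define $h\in\mathrm{PGL}(2,\overline{K})$ as follows. (1) If $x_i$ is indifferent for some $i$, then it is possible to choose $y_1\in\phi^{ -1}(x_i)\smallsetminus\{x_i\}$ and $y_2\in\phi^{ -1}(y_1)$ (preimages taken in $\mathbb{P}^1(\overline{K})$). For any such $i$ and any such choice, the three points $x_i,y_1,y_2\in\mathbb{P}^1(\overline{K})$ are necessarily distinct, and so there is a unique $h\in\mathrm{PGL}(2,\overline{K})$ such that $h(x_i)=0$, $h(y_1)=1$, and $h(y_2)=\infty$. (2) Otherwise, all the fixed points are attracting, and $x_1$, $x_2$, $x_3$ are necessarily distinct. Thus there is a unique $h\in\mathrm{PGL}(2,\overline{K})$ such that $h(x_1)=0$, $h(x_2)=1$, and $h(x_3)=\infty$. Let $\psi=h\circ\phi\circ h^{ -1}\in\overline{K}(z)$. Then $\phi$ has potentially good reduction if and only if $\psi$ has good reduction; in that case, $h$ provides the desired coordinate change (i.e., $h\circ\phi\circ h^{ -1}$ has good reduction).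
   Context: Rational functions act on $\mathbb{P}^1(\overline{K})=\overline{K}\cup\{\infty\}$, and $\mathrm{PGL}(2,\overline{K})$ acts by linear fractional transformations. The degree of $\phi=f/g$, with $f,g$ polynomials having no common factors, is $\deg\phi:=\max\{\deg f,\deg g\}$. Fixed points and multipliers: a rational function $\phi$ of degree $d\ge 2$ has exactly $d+1$ fixed points in $\mathbb{P}^1(\overline{K})$ counted with multiplicity (the multiplicity of a fixed point $x\in\overline{K}$ is the order of vanishing of $\phi(z)-z$ at $z=x$; the multiplicity of a fixed point at $\infty$ is the multiplicity of $0$ as a fixed point of $1/\phi(1/z)$). The multiplier of a fixed point $x$ is $\lambda:=\phi'(x)$ if $x\in\overline{K}$, and $\lambda:=\psi'(0)$ with $\psi(z)=1/\phi(1/z)$ if $x=\infty$. The fixed point $x$ is repelling if $|\lambda|_v>1$, indifferent if $|\lambda|_v=1$, and attracting if $|\lambda|_v<1$. Reduction: let $L$ be $K$ or $\overline{K}$, let $\mathcal{O}_L=\{x\in L:|x|_v\le 1\}$ be its ring of integers, and let $\mathcal{M}_L=\{x\in L:|x|_v<1\}$ be its maximal ideal. For $f\in\mathcal{O}_L[z]$, let $\overline{f}$ denote the polynomial over the residue field obtained by reducing all coefficients modulo $\mathcal{M}_L$. Given $\phi\in L(z)$ of degree at least $1$, write $\phi=f/g$ with $f,g\in\mathcal{O}_L[z]$ having no common factors in $L[z]$ and with at least one coefficient of $f$ or $g$ having absolute value $1$; set $\overline{\phi}:=\overline{f}/\overline{g}$ (whose degree is computed after cancelling common factors of $\overline f$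 and $\overline g$; if $\overline g=0$ then $\overline\phi$ is the constant $\infty$, of degree $0$). Then $\phi$ has good reduction if $\deg\overline{\phi}=\deg\phi$; this does not depend on the choice of $f,g$. The map $\phi$ has potentially good reduction if there is some $h\in\mathrm{PGL}(2,\overline{K})$ such that $h\circ\phi\circ h^{ -1}\in\overline{K}(z)$ has good reduction. -}

module Defs where

open import Level using (Level; Lift; _⊔_) renaming (suc to lsuc)
open import Algebra.Bundles using (RawRing; CommutativeRing)
open import Algebra.Morphism.Structures using (module RingMorphisms)
import Algebra.Definitions.RawSemiring as SemiringDefinitions
import Algebra.Construct.NaturalChoice.Max as Max
import Algebra.Properties.Ring as RingProperties
open import Data.Empty using (⊥)
open import Data.Fin.Subset using (Subset; _∈_; ∣_∣)
open import Data.List.Base using (List; []; _∷_; map; length)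
open import Data.List.Relation.Unary.Any using (Any)
open import Data.Nat.Base as ℕ using (ℕ; zero; suc; _∸_)
open import Data.Product.Base using (Σ; ∃; _×_; _,_; proj₁; proj₂)
open import Data.Sum.Base using (_⊎_; inj₁; inj₂)
open import Data.Unit.Polymorphic.Base using (⊤)
open import Data.Vec.Functional using (Vector)
open import Function.Bundles using (_⇔_; module Equivalence)
open import Relation.Binary.Bundles using (TotalOrder)
open import Relation.Binary.Core using (Rel)
open import Relation.Binary.PropositionalEquality.Core using (_≡_)
open import Relation.Binary.Structures using (IsTotalOrder)
open import Relation.Nullary.Negation using (¬_)
import Relation.Binary.Construct.NonStrictToStrict as Strict
import Relation.Binary.Reasoning.Setoid as SetoidReasoning

-- The standard library's HeytingField also carries an apartness relation,
-- which is redundant when excluded middle is assumed.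
record Field c ℓ : Set (lsuc (c ⊔ ℓ)) where
  field
    commutativeRing : CommutativeRing c ℓ
  open CommutativeRing commutativeRing public
  field
    1≉0        : 1# ≉ 0#
    invertible : ∀ {x} → x ≉ 0# → ∃ λ y → x * y ≈ 1#

-- In the presence of excluded middle these axioms determine the real numbers
-- up to a unique isomorphism.
record CompleteOrderedField c ℓ₁ ℓ₂ : Set (lsuc (c ⊔ ℓ₁ ⊔ ℓ₂)) where
  infix 4 _≤_ _<_
  field
    underlyingField : Field c ℓ₁
  open Field underlyingField public
  field
    _≤_          : Rel Carrier ℓ₂
    isTotalOrder : IsTotalOrder _≈_ _≤_
    +-monoˡ-≤    : ∀ z {x y} → x ≤ y → x + z ≤ y + z
    *-nonneg     : ∀ {x y} → 0# ≤ x → 0# ≤ y → 0# ≤ x * y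

  IsUpperBound : (Carrier → Set (c ⊔ ℓ₁ ⊔ ℓ₂)) → Carrier → Set (c ⊔ ℓ₁ ⊔ ℓ₂)
  IsUpperBound P b = ∀ x → P x → x ≤ b

  field
    supremum : (P : Carrier → Set (c ⊔ ℓ₁ ⊔ ℓ₂)) → ∃ P → ∃ (IsUpperBound P) →
               ∃ λ s → IsUpperBound P s × (∀ b → IsUpperBound P b → s ≤ b)

  totalOrder : TotalOrder c ℓ₁ ℓ₂
  totalOrder = record { isTotalOrder = isTotalOrder }

  open IsTotalOrder isTotalOrder public
    using (total; antisym; ≤-respˡ-≈; ≤-respʳ-≈)
    renaming (trans to ≤-trans; reflexive to ≤-reflexive)

  _<_ : Rel Carrier (ℓ₁ ⊔ ℓ₂)
  _<_ = Strict._<_ _≈_ _≤_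

  open Max totalOrder public using (⊔-lub) renaming (_⊔_ to max)

-- A polynomial is the list of its coefficients, constant term first; trailing
-- zeros are allowed, and equality compares all coefficients.
module Polynomials {c ℓ} (R : RawRing c ℓ) where
  open RawRing R

  Poly : Set c
  Poly = List Carrier

  coeff : Poly → ℕ → Carrier
  coeff []      _       = 0#
  coeff (a ∷ p) zero    = a
  coeff (a ∷ p) (suc n) = coeff p n

  infix  4 _≈ₚ_
  infixl 6 _+ₚ_ _-ₚ_
  infixl 7 _*ₚ_ _·ₚ_

  _≈ₚ_ : Rel Poly ℓ
  p ≈ₚ q = ∀ n → coeff p n ≈ coeff q n

  _+ₚ_ : Poly → Poly → Poly
  []      +ₚ q       = q
  (a ∷ p) +ₚ []      = a ∷ p
  (a ∷ p) +ₚ (b ∷ q) = (a + b) ∷ (p +ₚ q)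

  -ₚ_ : Poly → Poly
  -ₚ_ = map (-_)

  _-ₚ_ : Poly → Poly → Poly
  p -ₚ q = p +ₚ (-ₚ q)

  _·ₚ_ : Carrier → Poly → Poly
  a ·ₚ p = map (a *_) p

  _*ₚ_ : Poly → Poly → Poly
  []      *ₚ q = []
  (a ∷ p) *ₚ q = (a ·ₚ q) +ₚ (0# ∷ (p *ₚ q))

  0ₚ 1ₚ X : Poly
  0ₚ = []
  1ₚ = 1# ∷ []
  X  = 0# ∷ 1# ∷ []

  polyRawRing : RawRing c ℓ
  polyRawRing = record
    { Carrier = Poly ; _≈_ = _≈ₚ_ ; _+_ = _+ₚ_ ; _*_ = _*ₚ_
    ; -_ = -ₚ_ ; 0# = 0ₚ ; 1# = 1ₚ }

  open SemiringDefinitions (RawRing.rawSemiring polyRawRing) public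
    using (Coprime) renaming (_^_ to _^ₚ_)

  eval : Poly → Carrier → Carrier
  eval []      x = 0#
  eval (a ∷ p) x = a + x * eval p x

  -- (a + z p)′ = p + z p′
  derivative : Poly → Poly
  derivative []      = []
  derivative (a ∷ p) = p +ₚ (0# ∷ derivative p)

  DegreeAtMost : Poly → ℕ → Set ℓ
  DegreeAtMost p n = ∀ m → n ℕ.< m → coeff p m ≈ 0#

  MaxDegree : Poly → Poly → ℕ → Set ℓ
  MaxDegree f g d =
    DegreeAtMost f d × DegreeAtMost g d × (coeff f d ≉ 0# ⊎ coeff g d ≉ 0#)

  -- Σᵢ pᵢ uⁱ vⁿ⁻ⁱ, for n at least the formal degree of p
  homogenise : Poly → ℕ → Poly → Poly → Poly
  homogenise []      n u v = 0ₚ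
  homogenise (a ∷ p) n u v = a ·ₚ (v ^ₚ n) +ₚ u *ₚ homogenise p (n ∸ 1) u v

module RationalFunctions {r ℓ} (R : RawRing r ℓ) where
  open RawRing R
  open Polynomials R public

  infix 5 _/_
  record Fraction : Set r where
    constructor _/_
    field num den : Poly
  open Fraction public

  -- f / g is an element of R(z) when g ≉ 0; when g ≈ 0 and f ≉ 0 it is the
  -- constant ∞; only 0 / 0 is meaningless.
  IsRationalFunction : Fraction → Set ℓ
  IsRationalFunction φ = ¬ (den φ ≈ₚ 0ₚ)

  Determinate : Fraction → Set ℓ
  Determinate φ = ¬ (num φ ≈ₚ 0ₚ × den φ ≈ₚ 0ₚ)

  infix 4 _≐_
  _≐_ : Rel Fraction ℓ
  φ ≐ ψ = Determinate φ × Determinate ψ × num φ *ₚ den ψ ≈ₚ num ψ *ₚ den φ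

  HasDegree : Fraction → ℕ → Set (r ⊔ ℓ)
  HasDegree φ d = ∃ λ f → ∃ λ g → φ ≐ f / g × Coprime f g × MaxDegree f g d

  infixr 9 _∘_
  _∘_ : Fraction → Fraction → Fraction
  (f / g) ∘ (u / v) = homogenise f n u v / homogenise g n u v
    where n = (length f ℕ.⊔ length g) ∸ 1

  reciprocal : Fraction → Fraction
  reciprocal (f / g) = g / f

  _-id : Fraction → Fraction
  (f / g) -id = (f -ₚ X *ₚ g) / g

  _′ : Fraction → Fraction
  (f / g) ′ = (derivative f *ₚ g -ₚ f *ₚ derivative g) / (g *ₚ g)

  -- z ↦ 1 / φ(1/z)
  atInfinity : Fraction → Fraction
  atInfinity φ = reciprocal (φ ∘ (1ₚ / X))

  data P¹ : Set r where
    fin : Carrier → P¹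
    ∞   : P¹

  infix 4 _≈ᴾ_ _≉ᴾ_
  _≈ᴾ_ : Rel P¹ ℓ
  fin x ≈ᴾ fin y = x ≈ y
  ∞     ≈ᴾ ∞     = ⊤
  _     ≈ᴾ _     = Lift ℓ ⊥

  _≉ᴾ_ : Rel P¹ ℓ
  x ≉ᴾ y = ¬ (x ≈ᴾ y)

  infix 4 [_∶_]≈_
  [_∶_]≈_ : Carrier → Carrier → P¹ → Set ℓ
  [ s ∶ t ]≈ fin y = t ≉ 0# × s ≈ y * t
  [ s ∶ t ]≈ ∞     = s ≉ 0# × t ≈ 0#

  -- φ(x) ≈ y: some fraction f / g representing φ gives homogeneous
  -- coordinates, not both zero, of y at x.  At ∞ these are the coefficients
  -- of f and g at a common degree bound.
  _⟨_⟩≈_ : Fraction → P¹ → P¹ → Set (r ⊔ ℓ)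
  φ ⟨ fin x ⟩≈ y = ∃ λ f → ∃ λ g → φ ≐ f / g × [ eval f x ∶ eval g x ]≈ y
  φ ⟨ ∞ ⟩≈ y     = ∃ λ f → ∃ λ g → ∃ λ n → φ ≐ f / g ×
    DegreeAtMost f n × DegreeAtMost g n × [ coeff f n ∶ coeff g n ]≈ y

  -- φ = (z − a)ᵐ f / g with f and g nonvanishing at a
  VanishesToOrder : Fraction → Carrier → ℕ → Set (r ⊔ ℓ)
  VanishesToOrder φ a m = ∃ λ f → ∃ λ g →
    φ ≐ (((- a) ∷ 1# ∷ []) ^ₚ m *ₚ f) / g × eval f a ≉ 0# × eval g a ≉ 0#

  FixedPoint : Fraction → P¹ → Set (r ⊔ ℓ)
  FixedPoint φ x = φ ⟨ x ⟩≈ x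

  FixedPointMultiplicity : Fraction → P¹ → ℕ → Set (r ⊔ ℓ)
  FixedPointMultiplicity φ (fin x) m = VanishesToOrder (φ -id) x m
  FixedPointMultiplicity φ ∞       m = VanishesToOrder (atInfinity φ -id) 0# m

  FixedPointMultiplier : Fraction → P¹ → Carrier → Set (r ⊔ ℓ)
  FixedPointMultiplier φ (fin x) λ₀ = (φ ′) ⟨ fin x ⟩≈ fin λ₀
  FixedPointMultiplier φ ∞       λ₀ = (atInfinity φ ′) ⟨ fin 0# ⟩≈ fin λ₀

  -- xs lists the fixed points of φ, each as often as its multiplicity.
  record FixedPoints (φ : Fraction) {n : ℕ} (xs : Vector P¹ n) : Set (r ⊔ ℓ) where
    field
      fixed       : ∀ i → FixedPoint φ (xs i)
      occurrences : ∀ x m → FixedPoint φ x → FixedPointMultiplicity φ x m →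
                    Σ (Subset n) λ S → ∣ S ∣ ≡ m × (∀ i → i ∈ S ⇔ xs i ≈ᴾ x)

  Distinct₃ : P¹ → P¹ → P¹ → Set ℓ
  Distinct₃ x y z = x ≉ᴾ y × x ≉ᴾ z × y ≉ᴾ z

  -- Elements of PGL(2) are represented by invertible matrices
  -- with rows (a b) and (c d), equal up to scaling.
  record PGL₂ : Set (r ⊔ ℓ) where
    field
      a b c d : Carrier
      det≉0   : (a * d) + (- (b * c)) ≉ 0#

  _≈ᴳ_ : Rel PGL₂ (r ⊔ ℓ)
  h ≈ᴳ k = ∃ λ s → K.a ≈ s * H.a × K.b ≈ s * H.b × K.c ≈ s * H.c × K.d ≈ s * H.d
    where module H = PGL₂ h
          module K = PGL₂ k

  infix 4 _•_≈_
  _•_≈_ : PGL₂ → P¹ → P¹ → Set ℓ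
  h • fin x ≈ y = [ a * x + b ∶ c * x + d ]≈ y  where open PGL₂ h
  h • ∞     ≈ y = [ a ∶ c ]≈ y                  where open PGL₂ h

  -- h ∘ φ ∘ h⁻¹, with h⁻¹ represented by the adjugate matrix
  conjugate : PGL₂ → Fraction → Fraction
  conjugate h φ = ((b ∷ a ∷ []) / (d ∷ c ∷ [])) ∘ φ ∘
                  (((- b) ∷ d ∷ []) / (a ∷ (- c) ∷ []))
    where open PGL₂ h

  NormalisesTo01∞ : P¹ → P¹ → P¹ → PGL₂ → Set ℓ
  NormalisesTo01∞ x y z h = h • x ≈ fin 0# × h • y ≈ fin 1# × h • z ≈ ∞

record IsAlgebraicClosure {k ℓk l ℓl} (K : Field k ℓk) (L : Field l ℓl)
         (ι : Field.Carrier K → Field.Carrier L) : Set (k ⊔ ℓk ⊔ l ⊔ ℓl) where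
  private
    module K  = Field K
    module K[z] = Polynomials K.rawRing
    module L  = Field L
    module L[z] = Polynomials L.rawRing
  field
    isRingHomomorphism  : RingMorphisms.IsRingHomomorphism K.rawRing L.rawRing ι
    algebraicallyClosed : ∀ p {n} → 1 ℕ.≤ n → L[z].coeff p n L.≉ L.0# →
                          ∃ λ x → L[z].eval p x L.≈ L.0#
    algebraic           : ∀ x → ∃ λ p → ¬ (p K[z].≈ₚ K[z].0ₚ) ×
                          L[z].eval (map ι p) x L.≈ L.0#

baseChange : ∀ {k ℓk l ℓl} {R : RawRing k ℓk} {S : RawRing l ℓl} →
             (RawRing.Carrier R → RawRing.Carrier S) →
             RationalFunctions.Fraction R → RationalFunctions.Fraction S
baseChange {S = S} ι φ = map ι (num φ) S./ map ι (den φ)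
  where open RationalFunctions.Fraction
        module S = RationalFunctions S

record NonArchimedeanAbsoluteValue {r ℓr₁ ℓr₂ l ℓl}
         (ℝ : CompleteOrderedField r ℓr₁ ℓr₂) (L : Field l ℓl)
         : Set (r ⊔ ℓr₁ ⊔ ℓr₂ ⊔ l ⊔ ℓl) where
  private
    module ℝ = CompleteOrderedField ℝ
    module L = Field L
  field
    ∣_∣ᵥ          : L.Carrier → ℝ.Carrier
    ∣∣-cong       : ∀ {x y} → x L.≈ y → ∣ x ∣ᵥ ℝ.≈ ∣ y ∣ᵥ
    ∣∣-nonneg     : ∀ x → ℝ.0# ℝ.≤ ∣ x ∣ᵥ
    ∣x∣≈0⇔x≈0     : ∀ x → ∣ x ∣ᵥ ℝ.≈ ℝ.0# ⇔ x L.≈ L.0#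
    ∣∣-*          : ∀ x y → ∣ x L.* y ∣ᵥ ℝ.≈ ∣ x ∣ᵥ ℝ.* ∣ y ∣ᵥ
    ultrametric   : ∀ x y → ∣ x L.+ y ∣ᵥ ℝ.≤ ℝ.max ∣ x ∣ᵥ ∣ y ∣ᵥ

module Dynamics {r ℓr₁ ℓr₂ l ℓl} (ℝ : CompleteOrderedField r ℓr₁ ℓr₂)
                (L : Field l ℓl) (v : NonArchimedeanAbsoluteValue ℝ L) where
  private
    module ℝ = CompleteOrderedField ℝ
    module L = Field L
  open NonArchimedeanAbsoluteValue v
  open RationalFunctions L.rawRing

  Repelling Indifferent Attracting : Fraction → P¹ → Set (l ⊔ ℓl ⊔ ℓr₁ ⊔ ℓr₂)
  Repelling   φ x = ∃ λ μ → FixedPointMultiplier φ x μ × ℝ.1# ℝ.< ∣ μ ∣ᵥ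
  Indifferent φ x = ∃ λ μ → FixedPointMultiplier φ x μ ×
                            Lift ℓr₂ (∣ μ ∣ᵥ ℝ.≈ ℝ.1#)
  Attracting  φ x = ∃ λ μ → FixedPointMultiplier φ x μ × ∣ μ ∣ᵥ ℝ.< ℝ.1#

  𝒪 : Set (l ⊔ ℓr₂)
  𝒪 = Σ L.Carrier λ x → ∣ x ∣ᵥ ℝ.≤ ℝ.1#

  private
    module ℝP = RingProperties ℝ.ring
    module LP = RingProperties L.ring

    ∣1∣≈1 : ∣ L.1# ∣ᵥ ℝ.≈ ℝ.1#
    ∣1∣≈1 with ℝ.invertible {∣ L.1# ∣ᵥ}
                 (λ e → L.1≉0 (Equivalence.to (∣x∣≈0⇔x≈0 L.1#) e))
    ... | u , 1u≈1 = begin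
      ∣ L.1# ∣ᵥ                             ≈⟨ ℝ.*-identityʳ _ ⟨
      ∣ L.1# ∣ᵥ ℝ.* ℝ.1#                    ≈⟨ ℝ.*-congˡ 1u≈1 ⟨
      ∣ L.1# ∣ᵥ ℝ.* (∣ L.1# ∣ᵥ ℝ.* u)       ≈⟨ ℝ.*-assoc _ _ _ ⟨
      (∣ L.1# ∣ᵥ ℝ.* ∣ L.1# ∣ᵥ) ℝ.* u       ≈⟨ ℝ.*-congʳ (∣∣-* _ _) ⟨
      ∣ L.1# L.* L.1# ∣ᵥ ℝ.* u              ≈⟨ ℝ.*-congʳ (∣∣-cong (L.*-identityʳ _)) ⟩
      ∣ L.1# ∣ᵥ ℝ.* u                       ≈⟨ 1u≈1 ⟩
      ℝ.1#                                  ∎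
      where open SetoidReasoning ℝ.setoid

    ≤⇒0≤- : ∀ {x y} → x ℝ.≤ y → ℝ.0# ℝ.≤ y ℝ.- x
    ≤⇒0≤- {x} x≤y = ℝ.≤-respˡ-≈ (ℝ.-‿inverseʳ x) (ℝ.+-monoˡ-≤ (ℝ.- x) x≤y)

    0≤-⇒≤ : ∀ {x y} → ℝ.0# ℝ.≤ y ℝ.- x → x ℝ.≤ y
    0≤-⇒≤ {x} {y} p = ℝ.≤-respˡ-≈ (ℝ.+-identityˡ x)
      (ℝ.≤-respʳ-≈
        (ℝ.trans (ℝ.+-assoc y (ℝ.- x) x)
          (ℝ.trans (ℝ.+-congˡ (ℝ.-‿inverseˡ x)) (ℝ.+-identityʳ y)))
        (ℝ.+-monoˡ-≤ x p))

    *-monoˡ : ∀ {x y z} → ℝ.0# ℝ.≤ z → x ℝ.≤ y → z ℝ.* x ℝ.≤ z ℝ.* y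
    *-monoˡ {x} {y} {z} 0≤z x≤y = 0≤-⇒≤
      (ℝ.≤-respʳ-≈ (ℝP.x[y-z]≈xy-xz z y x) (ℝ.*-nonneg 0≤z (≤⇒0≤- x≤y)))

    ∣-1∣≤1 : ∣ L.- L.1# ∣ᵥ ℝ.≤ ℝ.1#
    ∣-1∣≤1 with ℝ.total ∣ L.- L.1# ∣ᵥ ℝ.1#
    ... | inj₁ t≤1 = t≤1
    ... | inj₂ 1≤t = ℝ.≤-respˡ-≈ (ℝ.*-identityʳ _) (ℝ.≤-respʳ-≈
      (ℝ.trans (ℝ.sym (∣∣-* _ _))
        (ℝ.trans (∣∣-cong (L.trans (LP.-1*x≈-x _) (LP.-‿involutive _))) ∣1∣≈1))
      (*-monoˡ (∣∣-nonneg _) 1≤t))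

    ∣xy∣≤1 : ∀ {x y} → ∣ x ∣ᵥ ℝ.≤ ℝ.1# → ∣ y ∣ᵥ ℝ.≤ ℝ.1# → ∣ x L.* y ∣ᵥ ℝ.≤ ℝ.1#
    ∣xy∣≤1 {x} {y} p q = ℝ.≤-respˡ-≈ (ℝ.sym (∣∣-* x y))
      (ℝ.≤-trans (*-monoˡ (∣∣-nonneg x) q)
        (ℝ.≤-respˡ-≈ (ℝ.sym (ℝ.*-identityʳ _)) p))

    ∣0∣≤1 : ∣ L.0# ∣ᵥ ℝ.≤ ℝ.1#
    ∣0∣≤1 = ℝ.≤-trans
      (ℝ.≤-reflexive (Equivalence.from (∣x∣≈0⇔x≈0 L.0#) L.refl))
      (ℝ.≤-respʳ-≈ ∣1∣≈1 (∣∣-nonneg L.1#))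

  -- The residue field 𝒪/ℳ: elements are integral representatives, and two
  -- are equal when their difference lies in ℳ.  Hence reduction of
  -- coefficients does not change the underlying list.
  residueField : RawRing (l ⊔ ℓr₂) (ℓr₁ ⊔ ℓr₂)
  residueField = record
    { Carrier = 𝒪
    ; _≈_     = λ x y → ∣ proj₁ x L.- proj₁ y ∣ᵥ ℝ.< ℝ.1#
    ; _+_     = λ (x , p) (y , q) →
                  x L.+ y , ℝ.≤-trans (ultrametric x y) (ℝ.⊔-lub p q)
    ; _*_     = λ (x , p) (y , q) → x L.* y , ∣xy∣≤1 p q
    ; -_      = λ (x , p) → L.- x ,
                  ℝ.≤-respˡ-≈ (∣∣-cong (LP.-1*x≈-x x)) (∣xy∣≤1 ∣-1∣≤1 p)
    ; 0#      = L.0# , ∣0∣≤1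
    ; 1#      = L.1# , ℝ.≤-reflexive ∣1∣≈1
    }

  private module Residue = RationalFunctions residueField

  record GoodReduction (φ : Fraction) : Set (l ⊔ ℓl ⊔ ℓr₁ ⊔ ℓr₂) where
    field
      f g        : List 𝒪
      represents : φ ≐ map proj₁ f / map proj₁ g
      coprime    : Coprime (map proj₁ f) (map proj₁ g)
      unitCoeff  : Any (λ x → ∣ proj₁ x ∣ᵥ ℝ.≈ ℝ.1#) f ⊎
                   Any (λ x → ∣ proj₁ x ∣ᵥ ℝ.≈ ℝ.1#) g
      degree     : ℕ
      deg-φ      : HasDegree φ degree
      deg-φ̄      : Residue.HasDegree (f Residue./ g) degree

  PotentiallyGoodReduction : Fraction → Set (l ⊔ ℓl ⊔ ℓr₁ ⊔ ℓr₂)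
  PotentiallyGoodReduction φ = ∃ λ h → GoodReduction (conjugate h φ)

  -- ψ = h ∘ φ ∘ h⁻¹ lies in L(z), and it decides potential good reduction.
  DetectsPotentiallyGoodReduction : Fraction → PGL₂ → Set (l ⊔ ℓl ⊔ ℓr₁ ⊔ ℓr₂)
  DetectsPotentiallyGoodReduction φ h =
    IsRationalFunction (conjugate h φ) ×
    (PotentiallyGoodReduction φ ⇔ GoodReduction (conjugate h φ))

{-# OPTIONS --safe #-}
module Submission where

-- Write φ as a pair Φ of binary forms of degree d without common zeros.  For
-- the norm ‖w‖ = max(|s|, |t|) on L², φ has good reduction iff
-- ‖Φ(w)‖ = |r| ‖w‖ᵈ for some r ≠ 0 and all w, and h ∘ φ ∘ h⁻¹ has good
-- reduction iff this holds for ‖h_‖ in place of ‖_‖.  Suppose it holds for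
-- ‖k_‖.  If P is a fixed point, Φ(P) = μ P, then P ∧ Φ(w) = (P ∧ w) K(w) for a
-- form K of degree d − 1 with integral coefficients up to r, and K(P) = λ μ
-- with λ the multiplier of P; hence |λ| ≤ 1.  Modulo the maximal ideal, K(w)
-- vanishes iff K(P) does whenever w ≡ P.  So an indifferent P is not congruent
-- to its other preimages, where K vanishes, and an attracting P is not
-- congruent to any other fixed point, where K is the eigenvalue; moreover
-- points with incongruent images are incongruent.  The three points sent to 0,
-- 1, ∞ by h are therefore pairwise incongruent with respect to k, and this
-- makes ‖h_‖ proportional to ‖k_‖.

open import Level using (Level; _⊔_; lift)
open import Axiom.ExcludedMiddle using (ExcludedMiddle)
open import Algebra.Bundles using (RawRing; CommutativeRing)
import Algebra.Definitions.RawMagma as RawMagma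
import Algebra.Morphism.Construct.Identity as Identity
open import Algebra.Morphism.Structures using (module RingMorphisms)
import Algebra.Properties.AbelianGroup
import Algebra.Properties.CommutativeSemiring.Exp
import Algebra.Properties.Ring
import Algebra.Properties.Semiring.Exp
import Algebra.Properties.Semiring.Mult.TCOptimised
import Algebra.Solver.Ring
open import Algebra.Solver.Ring.AlmostCommutativeRing using (fromCommutativeRing; _-Raw-AlmostCommutative⟶_)
open import Data.Empty using (⊥; ⊥-elim)
open import Data.Fin.Base using (Fin; zero; suc; inject≤)
open import Data.Fin.Subset as Subset using (Subset; _∈_; ∣_∣)
open import Data.Fin.Subset.Properties using (x∈p∧x≢y⇒x∈p-y; x∈p⇒∣p-x∣<∣p∣)
open import Data.Integer.Base as ℤ using (ℤ; +_; -[1+_]; _⊖_)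
import Data.Integer.Properties as ℤ
open import Data.List.Base using (List; []; _∷_; map; length; take)
open import Data.List.Properties using (map-id)
open import Data.List.Relation.Unary.Any using (Any; here; there)
open import Data.Maybe.Base using (Maybe; just; nothing)
open import Data.Nat.Base as ℕ using (ℕ; zero; suc; _∸_; _≤_; z≤n; s≤s)
open import Data.Nat.Induction using (<-rec)
import Data.Nat.Properties as ℕ
open import Data.Product using (∃; ∃!; _×_; _,_; proj₁; proj₂)
open import Data.Sum.Base using (_⊎_; inj₁; inj₂; [_,_]′)
open import Data.Unit.Polymorphic.Base using (tt)
open import Data.Vec.Functional using (Vector)
open import Function.Bundles using (mk⇔; module Equivalence)
open import Relation.Binary.PropositionalEquality as ≡ using (_≡_)
open import Relation.Nullary using (¬_; Dec; yes; no)
open import Relation.Nullary.Decidable using (decidable-stable)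
open import Relation.Nullary.Negation using (contradiction)
open import Defs

-- Fractions need not be in lowest terms, and composition homogenises at a formal degree, so h ∘ φ ∘
-- h⁻¹ may acquire common factors. The arguments therefore use an equivalent pair of forms whose
-- only common zero is the origin; over an algebraically closed field this expresses coprimality and
-- exact degree at once, and it survives linear changes of coordinates. A Bézout identity carries
-- coprimality from the base field to its closure. The form K is a quotient by P ∧ w, and dividing
-- gives no useful estimate where P ∧ w is small. Its coefficients are bounded through a variant of
-- Gauss's lemma in which the zeros of a given nonzero reduced polynomial may be avoided. This takes
-- enough points over the residue field, which is algebraically closed because a polynomial with
-- integral coefficients and unit leading coefficient has only integral roots. The inequality λ ≠ 0
-- provides a preimage of an indifferent point other than itself, and λ ≠ 1 makes an attracting
-- fixed point simple, so that it occurs only once in the list.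

module IntegerRingSolver {c ℓ} (R : CommutativeRing c ℓ) where
  open CommutativeRing R
  open Algebra.Properties.Ring ring
  open Algebra.Properties.AbelianGroup +-abelianGroup using (⁻¹-∙-comm)
  open Algebra.Properties.Semiring.Mult.TCOptimised semiring using (1+×; ×-homo-+) renaming (_×_ to _·_)
  open import Relation.Binary.Reasoning.Setoid setoid

  -- Integer coefficients have computable equality, so the solver can normalise constants in any
  -- commutative ring.
  fromℤ : ℤ → Carrier
  fromℤ (+ n)    = n · 1#
  fromℤ -[1+ n ] = - (suc n · 1#)

  private
    cancelˡ : ∀ a x y → (a + x) - (a + y) ≈ x - y
    cancelˡ a x y = begin
      (a + x) - (a + y)       ≈⟨ +-cong (+-comm x a) (⁻¹-∙-comm a y) ⟨
      (x + a) + (- a - y)     ≈⟨ +-assoc x a _ ⟩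
      x + (a + (- a - y))     ≈⟨ +-congˡ (+-assoc a (- a) _) ⟨
      x + (a - a - y)         ≈⟨ +-congˡ (+-congʳ (-‿inverseʳ a)) ⟩
      x + (0# - y)            ≈⟨ +-congˡ (+-identityˡ _) ⟩
      x - y                   ∎

    fromℤ-⊖ : ∀ m n → fromℤ (m ⊖ n) ≈ (m · 1#) - (n · 1#)
    fromℤ-⊖ zero    zero    = sym (-‿inverseʳ 0#)
    fromℤ-⊖ zero    (suc n) = sym (+-identityˡ _)
    fromℤ-⊖ (suc m) zero    = sym (trans (+-congˡ -0#≈0#) (+-identityʳ _))
    fromℤ-⊖ (suc m) (suc n) = begin
      fromℤ (suc m ⊖ suc n)             ≡⟨ ≡.cong fromℤ (ℤ.[1+m]⊖[1+n]≡m⊖n m n) ⟩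
      fromℤ (m ⊖ n)                     ≈⟨ fromℤ-⊖ m n ⟩
      (m · 1#) - (n · 1#)               ≈⟨ cancelˡ 1# _ _ ⟨
      (1# + m · 1#) - (1# + n · 1#)     ≈⟨ +-cong (1+× m 1#) (-‿cong (1+× n 1#)) ⟨
      (suc m · 1#) - (suc n · 1#)       ∎

    fromℤ-+ : ∀ i j → fromℤ (i ℤ.+ j) ≈ fromℤ i + fromℤ j
    fromℤ-+ (+ m)    (+ n)    = ×-homo-+ 1# m n
    fromℤ-+ (+ m)    -[1+ n ] = fromℤ-⊖ m (suc n)
    fromℤ-+ -[1+ m ] (+ n)    = trans (fromℤ-⊖ n (suc m)) (+-comm _ _)
    fromℤ-+ -[1+ m ] -[1+ n ] = begin
      - (suc (suc (m ℕ.+ n)) · 1#)      ≡⟨ ≡.cong (λ k → - (suc k · 1#)) (≡.sym (ℕ.+-suc m n)) ⟩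
      - ((suc m ℕ.+ suc n) · 1#)        ≈⟨ -‿cong (×-homo-+ 1# (suc m) (suc n)) ⟩
      - (suc m · 1# + suc n · 1#)       ≈⟨ ⁻¹-∙-comm _ _ ⟨
      - (suc m · 1#) - (suc n · 1#)     ∎

    fromℤ-neg : ∀ i → fromℤ (ℤ.- i) ≈ - fromℤ i
    fromℤ-neg (+ zero)   = sym -0#≈0#
    fromℤ-neg (+ suc n)  = refl
    fromℤ-neg -[1+ n ]   = sym (-‿involutive _)

    fromℤ-*-+ : ∀ m j → fromℤ (+ m ℤ.* j) ≈ (m · 1#) * fromℤ j
    fromℤ-*-+ zero    j = trans (reflexive (≡.cong fromℤ (ℤ.*-zeroˡ j))) (sym (zeroˡ _))
    fromℤ-*-+ (suc m) j = begin
      fromℤ (+ suc m ℤ.* j)                 ≡⟨ ≡.cong fromℤ (ℤ.suc-* (+ m) j) ⟩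
      fromℤ (j ℤ.+ + m ℤ.* j)               ≈⟨ fromℤ-+ j (+ m ℤ.* j) ⟩
      fromℤ j + fromℤ (+ m ℤ.* j)           ≈⟨ +-cong (sym (*-identityˡ _)) (fromℤ-*-+ m j) ⟩
      1# * fromℤ j + (m · 1#) * fromℤ j     ≈⟨ distribʳ _ _ _ ⟨
      (1# + m · 1#) * fromℤ j               ≈⟨ *-congʳ (1+× m 1#) ⟨
      (suc m · 1#) * fromℤ j                ∎

    fromℤ-* : ∀ i j → fromℤ (i ℤ.* j) ≈ fromℤ i * fromℤ j
    fromℤ-* (+ m)    j = fromℤ-*-+ m j
    fromℤ-* -[1+ m ] j = begin
      fromℤ (ℤ.- (+ suc m) ℤ.* j)     ≡⟨ ≡.cong fromℤ (≡.sym (ℤ.neg-distribˡ-* (+ suc m) j)) ⟩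
      fromℤ (ℤ.- (+ suc m ℤ.* j))     ≈⟨ fromℤ-neg (+ suc m ℤ.* j) ⟩
      - fromℤ (+ suc m ℤ.* j)         ≈⟨ -‿cong (fromℤ-*-+ (suc m) j) ⟩
      - ((suc m · 1#) * fromℤ j)      ≈⟨ -‿distribˡ-* _ _ ⟩
      - (suc m · 1#) * fromℤ j        ∎

    morphism : ℤ.+-*-rawRing -Raw-AlmostCommutative⟶ fromCommutativeRing R
    morphism = record
      { ⟦_⟧    = fromℤ
      ; +-homo = fromℤ-+
      ; *-homo = fromℤ-*
      ; -‿homo = fromℤ-neg
      ; 0-homo = refl
      ; 1-homo = refl
      }

    _≟_ : ∀ i j → Maybe (fromℤ i ≈ fromℤ j)
    i ≟ j with i ℤ.≟ j
    ... | yes i≡j = just (reflexive (≡.cong fromℤ i≡j))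
    ... | no  _   = nothing

  open Algebra.Solver.Ring ℤ.+-*-rawRing (fromCommutativeRing R) morphism _≟_ public
    using (solve; _:=_; _:+_; _:*_; _:-_; :-_; con)

-- Polynomials given by coefficient lists

module PolynomialProperties {c ℓ} (R : CommutativeRing c ℓ) where
  open CommutativeRing R hiding (zero)
  open Algebra.Properties.Ring ring using (-0#≈0#)
  open IntegerRingSolver R
  open Polynomials rawRing
  open Algebra.Properties.Semiring.Exp semiring public using (_^_; ^-congˡ)
  open Algebra.Properties.CommutativeSemiring.Exp commutativeSemiring public using (^-distrib-*)
  open import Relation.Binary.Reasoning.Setoid setoid

  coeff-+ : ∀ p q n → coeff (p +ₚ q) n ≈ coeff p n + coeff q n
  coeff-+ []      q       n       = sym (+-identityˡ _)
  coeff-+ (a ∷ p) []      n       = sym (+-identityʳ _)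
  coeff-+ (a ∷ p) (b ∷ q) zero    = refl
  coeff-+ (a ∷ p) (b ∷ q) (suc n) = coeff-+ p q n

  coeff-map : ∀ {f : Carrier → Carrier} → f 0# ≈ 0# → ∀ p n → coeff (map f p) n ≈ f (coeff p n)
  coeff-map f0 []      n       = sym f0
  coeff-map f0 (a ∷ p) zero    = refl
  coeff-map f0 (a ∷ p) (suc n) = coeff-map f0 p n

  coeff-· : ∀ a p n → coeff (a ·ₚ p) n ≈ a * coeff p n
  coeff-· a = coeff-map (zeroʳ a)

  coeff-neg : ∀ p n → coeff (-ₚ p) n ≈ - coeff p n
  coeff-neg = coeff-map -0#≈0#

  degree-length : ∀ p → DegreeAtMost p (length p ∸ 1)
  degree-length []          m       _         = refl
  degree-length (a ∷ [])    (suc m) _         = refl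
  degree-length (a ∷ b ∷ p) (suc m) (s≤s l<m) = degree-length (b ∷ p) m l<m

  degree-weaken : ∀ p {m n} → m ℕ.≤ n → DegreeAtMost p m → DegreeAtMost p n
  degree-weaken p m≤n dp k n<k = dp k (ℕ.≤-<-trans m≤n n<k)

  degree-+ : ∀ p q n → DegreeAtMost p n → DegreeAtMost q n → DegreeAtMost (p +ₚ q) n
  degree-+ p q n dp dq m n<m =
    trans (coeff-+ p q m) (trans (+-cong (dp m n<m) (dq m n<m)) (+-identityˡ 0#))

  degree-· : ∀ a p n → DegreeAtMost p n → DegreeAtMost (a ·ₚ p) n
  degree-· a p n dp m n<m = trans (coeff-· a p m) (trans (*-congˡ (dp m n<m)) (zeroʳ a))

  private
    coeff-∷* : ∀ a p q n →
               coeff ((a ∷ p) *ₚ q) (suc n) ≈ a * coeff q (suc n) + coeff (p *ₚ q) n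
    coeff-∷* a p q n = trans (coeff-+ (a ·ₚ q) (0# ∷ (p *ₚ q)) (suc n)) (+-congʳ (coeff-· a q (suc n)))

  *-zeroˡ : ∀ p q → p ≈ₚ 0ₚ → p *ₚ q ≈ₚ 0ₚ
  *-zeroˡ []      q p≈0 n       = refl
  *-zeroˡ (a ∷ p) q p≈0 zero    = begin
    coeff ((a ∷ p) *ₚ q) 0  ≈⟨ coeff-+ (a ·ₚ q) (0# ∷ (p *ₚ q)) 0 ⟩
    coeff (a ·ₚ q) 0 + 0#   ≈⟨ +-congʳ (coeff-· a q 0) ⟩
    a * coeff q 0 + 0#      ≈⟨ +-congʳ (*-congʳ (p≈0 0)) ⟩
    0# * coeff q 0 + 0#     ≈⟨ solve 1 (λ x → con (+ 0) :* x :+ con (+ 0) := con (+ 0)) refl _ ⟩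
    0#                      ∎
  *-zeroˡ (a ∷ p) q p≈0 (suc n) = begin
    coeff ((a ∷ p) *ₚ q) (suc n)               ≈⟨ coeff-∷* a p q n ⟩
    a * coeff q (suc n) + coeff (p *ₚ q) n
        ≈⟨ +-cong (*-congʳ (p≈0 0)) (*-zeroˡ p q (λ m → p≈0 (suc m)) n) ⟩
    0# * coeff q (suc n) + 0#
        ≈⟨ solve 1 (λ x → con (+ 0) :* x :+ con (+ 0) := con (+ 0)) refl _ ⟩
    0#                                         ∎

  -- Every other term of the convolution at m + n involves a coefficient beyond one of the two
  -- bounds.
  coeff-*-top : ∀ p q m n → DegreeAtMost p m → DegreeAtMost q n →
                coeff (p *ₚ q) (m ℕ.+ n) ≈ coeff p m * coeff q n
  coeff-*-top []      q m       n dp dq = sym (zeroˡ _)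
  coeff-*-top (a ∷ p) q zero    n dp dq = begin
    coeff ((a ·ₚ q) +ₚ (0# ∷ (p *ₚ q))) n          ≈⟨ coeff-+ (a ·ₚ q) _ n ⟩
    coeff (a ·ₚ q) n + coeff (0# ∷ (p *ₚ q)) n     ≈⟨ +-cong (coeff-· a q n) (shifted n) ⟩
    a * coeff q n + 0#                             ≈⟨ +-identityʳ _ ⟩
    a * coeff q n                                  ∎
    where
    shifted : ∀ n → coeff (0# ∷ (p *ₚ q)) n ≈ 0#
    shifted zero    = refl
    shifted (suc n) = *-zeroˡ p q (λ m → dp (suc m) (s≤s z≤n)) n
  coeff-*-top (a ∷ p) q (suc m) n dp dq = begin
    coeff ((a ∷ p) *ₚ q) (suc (m ℕ.+ n))                       ≈⟨ coeff-∷* a p q (m ℕ.+ n) ⟩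
    a * coeff q (suc (m ℕ.+ n)) + coeff (p *ₚ q) (m ℕ.+ n)
      ≈⟨ +-cong (*-congˡ (dq _ (s≤s (ℕ.m≤n+m n m))))
                (coeff-*-top p q m n (λ k m<k → dp (suc k) (s≤s m<k)) dq) ⟩
    a * 0# + coeff p m * coeff q n
      ≈⟨ solve 2 (λ a x → a :* con (+ 0) :+ x := x) refl a _ ⟩
    coeff p m * coeff q n                                      ∎

  degree-* : ∀ p q m n → DegreeAtMost p m → DegreeAtMost q n → DegreeAtMost (p *ₚ q) (m ℕ.+ n)
  -- Since k exceeds n, it also bounds the degree of q, so the coefficient of the product at k is a
  -- product of top coefficients.
  degree-* p q zero    n dp dq k n<k = trans
    (coeff-*-top p q zero k dp (degree-weaken q (ℕ.<⇒≤ n<k) dq))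
    (trans (*-congˡ (dq k n<k)) (zeroʳ _))
  degree-* []      q (suc m) n dp dq k       l<k       = refl
  degree-* (a ∷ p) q (suc m) n dp dq (suc k) (s≤s l<k) = begin
    coeff ((a ∷ p) *ₚ q) (suc k)               ≈⟨ coeff-∷* a p q k ⟩
    a * coeff q (suc k) + coeff (p *ₚ q) k
      ≈⟨ +-cong (*-congˡ (dq _ (s≤s (ℕ.≤-trans (ℕ.m≤n+m n m) (ℕ.<⇒≤ l<k)))))
                (degree-* p q m n (λ k m<k → dp (suc k) (s≤s m<k)) dq k l<k) ⟩
    a * 0# + 0#
        ≈⟨ solve 1 (λ a → a :* con (+ 0) :+ con (+ 0) := con (+ 0)) refl a ⟩
    0#                                         ∎

  eval-zero : ∀ p x → p ≈ₚ 0ₚ → eval p x ≈ 0#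
  eval-zero []      x p≈0 = refl
  eval-zero (a ∷ p) x p≈0 = begin
    a + x * eval p x ≈⟨ +-cong (p≈0 0) (*-congˡ (eval-zero p x (λ n → p≈0 (suc n)))) ⟩
    0# + x * 0#      ≈⟨ solve 1 (λ x → con (+ 0) :+ x :* con (+ 0) := con (+ 0)) refl x ⟩
    0#               ∎

  eval-cong : ∀ p q x → p ≈ₚ q → eval p x ≈ eval q x
  eval-cong []      q       x p≈q = sym (eval-zero q x (λ n → sym (p≈q n)))
  eval-cong (a ∷ p) []      x p≈q = eval-zero (a ∷ p) x p≈q
  eval-cong (a ∷ p) (b ∷ q) x p≈q =
    +-cong (p≈q 0) (*-congˡ (eval-cong p q x (λ n → p≈q (suc n))))

-- The map `e` is known only by its two recursion equations, so that one proof serves both `eval`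
-- itself and evaluation after `ι` has been applied to the coefficients.
module Specialisation {a b ℓa ℓb} (R : CommutativeRing a ℓa) (S : CommutativeRing b ℓb)
  (ι : CommutativeRing.Carrier R → CommutativeRing.Carrier S)
  (isHom : RingMorphisms.IsRingHomomorphism (CommutativeRing.rawRing R) (CommutativeRing.rawRing S) ι)
  (x : CommutativeRing.Carrier S)
  (e : Polynomials.Poly (CommutativeRing.rawRing R) → CommutativeRing.Carrier S)
  (e-[] : CommutativeRing._≈_ S (e []) (CommutativeRing.0# S))
  (e-∷ : ∀ c p → CommutativeRing._≈_ S (e (c ∷ p))
                   (CommutativeRing._+_ S (ι c) (CommutativeRing._*_ S x (e p))))
  where
  private module R = CommutativeRing R
  open CommutativeRing S hiding (zero)
  open RingMorphisms.IsRingHomomorphism isHom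
  open IntegerRingSolver S
  open Polynomials R.rawRing
  open import Relation.Binary.Reasoning.Setoid setoid

  e-+ : ∀ p q → e (p +ₚ q) ≈ e p + e q
  e-+ []      q       = sym (trans (+-congʳ e-[]) (+-identityˡ _))
  e-+ (c ∷ p) []      = sym (trans (+-congˡ e-[]) (+-identityʳ _))
  e-+ (c ∷ p) (d ∷ q) = begin
    e ((c R.+ d) ∷ (p +ₚ q))                 ≈⟨ e-∷ _ _ ⟩
    ι (c R.+ d) + x * e (p +ₚ q)             ≈⟨ +-cong (+-homo c d) (*-congˡ (e-+ p q)) ⟩
    (ι c + ι d) + x * (e p + e q)
      ≈⟨ solve 5 (λ c d x p q → (c :+ d) :+ x :* (p :+ q) := (c :+ x :* p) :+ (d :+ x :* q))
               refl (ι c) (ι d) x (e p) (e q) ⟩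
    (ι c + x * e p) + (ι d + x * e q)        ≈⟨ +-cong (e-∷ c p) (e-∷ d q) ⟨
    e (c ∷ p) + e (d ∷ q)                    ∎

  e-· : ∀ s p → e (s ·ₚ p) ≈ ι s * e p
  e-· s []      = trans e-[] (sym (trans (*-congˡ e-[]) (zeroʳ _)))
  e-· s (c ∷ p) = begin
    e (s R.* c ∷ s ·ₚ p)               ≈⟨ e-∷ _ _ ⟩
    ι (s R.* c) + x * e (s ·ₚ p)       ≈⟨ +-cong (*-homo s c) (*-congˡ (e-· s p)) ⟩
    ι s * ι c + x * (ι s * e p)
      ≈⟨ solve 4 (λ s c x p → s :* c :+ x :* (s :* p) := s :* (c :+ x :* p)) refl (ι s) (ι c) x (e p) ⟩
    ι s * (ι c + x * e p)              ≈⟨ *-congˡ (e-∷ c p) ⟨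
    ι s * e (c ∷ p)                    ∎

  e-neg : ∀ p → e (-ₚ p) ≈ - e p
  e-neg []      = trans e-[] (trans (solve 0 (con (+ 0) := :- con (+ 0)) refl) (-‿cong (sym e-[])))
  e-neg (c ∷ p) = begin
    e (R.- c ∷ -ₚ p)               ≈⟨ e-∷ _ _ ⟩
    ι (R.- c) + x * e (-ₚ p)       ≈⟨ +-cong (-‿homo c) (*-congˡ (e-neg p)) ⟩
    - ι c + x * - e p
        ≈⟨ solve 3 (λ c x p → :- c :+ x :* :- p := :- (c :+ x :* p)) refl (ι c) x (e p) ⟩
    - (ι c + x * e p)              ≈⟨ -‿cong (e-∷ c p) ⟨
    - e (c ∷ p)                    ∎

  e-minus : ∀ p q → e (p -ₚ q) ≈ e p - e q
  e-minus p q = trans (e-+ p (-ₚ q)) (+-congˡ (e-neg q))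

  e-* : ∀ p q → e (p *ₚ q) ≈ e p * e q
  e-* []      q = trans e-[] (sym (trans (*-congʳ e-[]) (zeroˡ _)))
  e-* (c ∷ p) q = begin
    e ((c ·ₚ q) +ₚ (R.0# ∷ (p *ₚ q)))            ≈⟨ e-+ (c ·ₚ q) _ ⟩
    e (c ·ₚ q) + e (R.0# ∷ (p *ₚ q))             ≈⟨ +-cong (e-· c q) (e-∷ _ _) ⟩
    ι c * e q + (ι R.0# + x * e (p *ₚ q))        ≈⟨ +-congˡ (+-cong 0#-homo (*-congˡ (e-* p q))) ⟩
    ι c * e q + (0# + x * (e p * e q))
      ≈⟨ solve 4 (λ c x p q → c :* q :+ (con (+ 0) :+ x :* (p :* q)) := (c :+ x :* p) :* q)
               refl (ι c) x (e p) (e q) ⟩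
    (ι c + x * e p) * e q                        ≈⟨ *-congʳ (e-∷ c p) ⟨
    e (c ∷ p) * e q                              ∎

  private
    e-zero : ∀ p → p ≈ₚ 0ₚ → e p ≈ 0#
    e-zero []      p≈0 = e-[]
    e-zero (c ∷ p) p≈0 = begin
      e (c ∷ p)         ≈⟨ e-∷ c p ⟩
      ι c + x * e p     ≈⟨ +-cong (trans (⟦⟧-cong (p≈0 0)) 0#-homo)
          (*-congˡ (e-zero p (λ n → p≈0 (suc n)))) ⟩
      0# + x * 0#       ≈⟨ solve 1 (λ x → con (+ 0) :+ x :* con (+ 0) := con (+ 0)) refl x ⟩
      0#                ∎

  e-cong : ∀ p q → p ≈ₚ q → e p ≈ e q
  e-cong []      q       p≈q = trans e-[] (sym (e-zero q (λ n → R.sym (p≈q n))))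
  e-cong (c ∷ p) []      p≈q = trans (e-zero (c ∷ p) p≈q) (sym e-[])
  e-cong (c ∷ p) (d ∷ q) p≈q = begin
    e (c ∷ p)         ≈⟨ e-∷ c p ⟩
    ι c + x * e p     ≈⟨ +-cong (⟦⟧-cong (p≈q 0)) (*-congˡ (e-cong p q (λ n → p≈q (suc n)))) ⟩
    ι d + x * e q     ≈⟨ e-∷ d q ⟨
    e (d ∷ q)         ∎

-- Values of polynomials and of binary forms

module Evaluation {c ℓ} (R : CommutativeRing c ℓ) where
  open CommutativeRing R hiding (zero)
  open IntegerRingSolver R
  open Polynomials rawRing
  open PolynomialProperties R
  private
    module At (x : Carrier) = Specialisation R R (λ y → y)
      (Identity.isRingHomomorphism rawRing refl) x (λ p → eval p x) refl (λ _ _ → refl)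
  open import Relation.Binary.Reasoning.Setoid setoid

  eval-+ : ∀ p q x → eval (p +ₚ q) x ≈ eval p x + eval q x
  eval-+ p q x = At.e-+ x p q

  eval-· : ∀ a p x → eval (a ·ₚ p) x ≈ a * eval p x
  eval-· a p x = At.e-· x a p

  eval-minus : ∀ p q x → eval (p -ₚ q) x ≈ eval p x - eval q x
  eval-minus p q x = At.e-minus x p q

  eval-* : ∀ p q x → eval (p *ₚ q) x ≈ eval p x * eval q x
  eval-* p q x = At.e-* x p q

  eval-1 : ∀ x → eval 1ₚ x ≈ 1#
  eval-1 x = solve 1 (λ x → con (+ 1) :+ x :* con (+ 0) := con (+ 1)) refl x

  eval-X : ∀ x → eval X x ≈ x
  eval-X x = solve 1 (λ x → con (+ 0) :+ x :* (con (+ 1) :+ x :* con (+ 0)) := x) refl x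

  eval-^ : ∀ p n x → eval (p ^ₚ n) x ≈ eval p x ^ n
  eval-^ p zero    x = eval-1 x
  eval-^ p (suc n) x = trans (eval-* p (p ^ₚ n) x) (*-congˡ (eval-^ p n x))

  -- The value at (s , t) of the form Σᵢ pᵢ Sⁱ Tⁿ⁻ⁱ; meaningful only for
  -- DegreeAtMost p n.
  form : Poly → ℕ → Carrier → Carrier → Carrier
  form []      n s t = 0#
  form (a ∷ p) n s t = a * t ^ n + s * form p (n ∸ 1) s t

  -- No degree bound enters, because both sides truncate the exponent in the same way.
  eval-homogenise : ∀ p n u v x → eval (homogenise p n u v) x ≈ form p n (eval u x) (eval v x)
  eval-homogenise []      n u v x = refl
  eval-homogenise (a ∷ p) n u v x = begin
    eval (a ·ₚ (v ^ₚ n) +ₚ u *ₚ homogenise p (n ∸ 1) u v) x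
      ≈⟨ eval-+ (a ·ₚ (v ^ₚ n)) _ x ⟩
    eval (a ·ₚ (v ^ₚ n)) x + eval (u *ₚ homogenise p (n ∸ 1) u v) x
      ≈⟨ +-cong (trans (eval-· a (v ^ₚ n) x) (*-congˡ (eval-^ v n x)))
                (trans (eval-* u _ x) (*-congˡ (eval-homogenise p (n ∸ 1) u v x))) ⟩
    form (a ∷ p) n (eval u x) (eval v x) ∎

  form-cong : ∀ p n {s s′ t t′} → s ≈ s′ → t ≈ t′ → form p n s t ≈ form p n s′ t′
  form-cong []      n s≈ t≈ = refl
  form-cong (a ∷ p) n s≈ t≈ =
    +-cong (*-congˡ (^-congˡ n t≈)) (*-cong s≈ (form-cong p (n ∸ 1) s≈ t≈))

  form-zero : ∀ p n s t → p ≈ₚ 0ₚ → form p n s t ≈ 0#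
  form-zero []      n s t p≈0 = refl
  form-zero (a ∷ p) n s t p≈0 = begin
    a * t ^ n + s * form p (n ∸ 1) s t
      ≈⟨ +-cong (*-congʳ (p≈0 0)) (*-congˡ (form-zero p (n ∸ 1) s t (λ m → p≈0 (suc m)))) ⟩
    0# * t ^ n + s * 0#
      ≈⟨ solve 2 (λ s t → con (+ 0) :* t :+ s :* con (+ 0) := con (+ 0)) refl s (t ^ n) ⟩
    0# ∎

  form-congˡ : ∀ p q n s t → p ≈ₚ q → form p n s t ≈ form q n s t
  form-congˡ []      q       n s t p≈q = sym (form-zero q n s t (λ m → sym (p≈q m)))
  form-congˡ (a ∷ p) []      n s t p≈q = form-zero (a ∷ p) n s t p≈q
  form-congˡ (a ∷ p) (b ∷ q) n s t p≈q =
    +-cong (*-congʳ (p≈q 0)) (*-congˡ (form-congˡ p q (n ∸ 1) s t (λ m → p≈q (suc m))))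

  form-+ : ∀ p q n s t → form (p +ₚ q) n s t ≈ form p n s t + form q n s t
  form-+ []      q       n s t = sym (+-identityˡ _)
  form-+ (a ∷ p) []      n s t = sym (+-identityʳ _)
  form-+ (a ∷ p) (b ∷ q) n s t = trans (+-congˡ (*-congˡ (form-+ p q (n ∸ 1) s t)))
    (solve 6 (λ a b t s p q → (a :+ b) :* t :+ s :* (p :+ q) := (a :* t :+ s :* p) :+ (b :* t :+ s :* q))
       refl a b (t ^ n) s _ _)

  form-· : ∀ c p n s t → form (c ·ₚ p) n s t ≈ c * form p n s t
  form-· c []      n s t = sym (zeroʳ c)
  form-· c (a ∷ p) n s t = trans (+-congˡ (*-congˡ (form-· c p (n ∸ 1) s t)))
    (solve 5 (λ c a t s p → (c :* a) :* t :+ s :* (c :* p) := c :* (a :* t :+ s :* p)) refl c a (t ^ n) s _)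

  1^n≈1 : ∀ n → 1# ^ n ≈ 1#
  1^n≈1 zero    = refl
  1^n≈1 (suc n) = trans (*-identityˡ _) (1^n≈1 n)

  form-[x,1] : ∀ p n x → form p n x 1# ≈ eval p x
  form-[x,1] []      n x = refl
  form-[x,1] (a ∷ p) n x = +-cong (trans (*-congˡ (1^n≈1 n)) (*-identityʳ a))
      (*-congˡ (form-[x,1] p (n ∸ 1) x))

  private
    tail-zero : ∀ a p → DegreeAtMost (a ∷ p) 0 → p ≈ₚ 0ₚ
    tail-zero a p dp m = dp (suc m) (s≤s z≤n)

    tail-degree : ∀ a p n → DegreeAtMost (a ∷ p) (suc n) → DegreeAtMost p n
    tail-degree a p n dp m n<m = dp (suc m) (s≤s n<m)

  form-constant : ∀ p s t → DegreeAtMost p 0 → form p 0 s t ≈ coeff p 0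
  form-constant []      s t dp = refl
  form-constant (a ∷ p) s t dp = trans (+-congˡ (*-congˡ (form-zero p 0 s t (tail-zero a p dp))))
    (solve 2 (λ a s → a :* con (+ 1) :+ s :* con (+ 0) := a) refl a s)

  form-[1,0] : ∀ p n → DegreeAtMost p n → form p n 1# 0# ≈ coeff p n
  form-[1,0] p       zero    dp = form-constant p 1# 0# dp
  form-[1,0] []      (suc n) dp = refl
  form-[1,0] (a ∷ p) (suc n) dp = trans (+-congˡ (*-congˡ (form-[1,0] p n (tail-degree a p n dp))))
    (solve 3 (λ a z x → a :* (con (+ 0) :* z) :+ con (+ 1) :* x := x) refl a _ _)

  form-scale : ∀ p n c s t → DegreeAtMost p n → form p n (c * s) (c * t) ≈ c ^ n * form p n s t
  form-scale p       zero    c s t dp = trans (form-constant p _ _ dp)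
    (trans (sym (form-constant p s t dp)) (sym (*-identityˡ _)))
  form-scale []      (suc n) c s t dp = sym (zeroʳ _)
  form-scale (a ∷ p) (suc n) c s t dp = trans
    (+-cong (*-congˡ (^-distrib-* c t (suc n))) (*-congˡ (form-scale p n c s t (tail-degree a p n dp))))
    (solve 6 (λ a c s t cⁿ f → a :* ((c :* cⁿ) :* t) :+ (c :* s) :* (cⁿ :* f)
                := (c :* cⁿ) :* (a :* t :+ s :* f)) refl a c s (t ^ suc n) (c ^ n) _)

  -- Synthetic division by z − x.
  quotient : Poly → Carrier → Poly
  quotient []      x = []
  quotient (a ∷ p) x = eval p x ∷ quotient p x

  eval-quotient : ∀ p x z → eval p z ≈ (z - x) * eval (quotient p x) z + eval p x
  eval-quotient []      x z = solve 2 (λ x z → con (+ 0) := (z :- x) :* con (+ 0) :+ con (+ 0)) refl x z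
  eval-quotient (a ∷ p) x z = trans (+-congˡ (*-congˡ (eval-quotient p x z)))
    (solve 5 (λ a x z q e → a :+ z :* ((z :- x) :* q :+ e)
                := (z :- x) :* (e :+ z :* q) :+ (a :+ x :* e)) refl a x z _ _)

  -- The polynomial `quotient p x` is the difference quotient (p(z) - p(x)) / (z - x), so its value
  -- at z = x is the derivative.
  eval-quotient-self : ∀ p x → eval (quotient p x) x ≈ eval (derivative p) x
  eval-quotient-self []      x = refl
  eval-quotient-self (a ∷ p) x = trans (+-congˡ (*-congˡ (eval-quotient-self p x)))
    (trans (+-congˡ (sym (+-identityˡ _))) (sym (eval-+ p (0# ∷ derivative p) x)))

  private
    quotient-zero : ∀ p x → p ≈ₚ 0ₚ → quotient p x ≈ₚ 0ₚ
    quotient-zero []      x p≈0 n       = refl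
    quotient-zero (a ∷ p) x p≈0 zero    = eval-zero p x (λ n → p≈0 (suc n))
    quotient-zero (a ∷ p) x p≈0 (suc n) = quotient-zero p x (λ n → p≈0 (suc n)) n

  degree-quotient : ∀ p x n → DegreeAtMost p (suc n) → DegreeAtMost (quotient p x) n
  degree-quotient []      x n       dp m       n<m       = refl
  degree-quotient (a ∷ p) x zero    dp (suc m) n<m       =
    quotient-degree₀ p (tail-degree a p 0 dp) m
    where
    quotient-degree₀ : ∀ p → DegreeAtMost p 0 → quotient p x ≈ₚ 0ₚ
    quotient-degree₀ []      dp m       = refl
    quotient-degree₀ (a ∷ p) dp zero    = eval-zero p x (tail-zero a p dp)
    quotient-degree₀ (a ∷ p) dp (suc m) = quotient-zero p x (tail-zero a p dp) m
  degree-quotient (a ∷ p) x (suc n) dp (suc m) (s≤s n<m) =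
    degree-quotient p x n (tail-degree a p (suc n) dp) m n<m

  form-quotient : ∀ p n x s t → DegreeAtMost p (suc n) →
    form p (suc n) s t ≈ (s - x * t) * form (quotient p x) n s t + eval p x * t ^ suc n
  form-quotient []      n x s t dp =
    solve 4 (λ x s t z → con (+ 0) := (s :- x :* t) :* con (+ 0) :+ con (+ 0) :* z) refl x s t _
  -- Here a + z p has degree at most 1, so p is constant and its own quotient vanishes.
  form-quotient (a ∷ p) zero x s t dp = begin
    a * t ^ 1 + s * form p 0 s t
      ≈⟨ +-congˡ (*-congˡ (trans (form-constant p s t dp′) (sym constant))) ⟩
    a * t ^ 1 + s * eval p x
      ≈⟨ solve 5 (λ a x s t e → a :* (t :* con (+ 1)) :+ s :* e
            := (s :- x :* t) :* (e :* con (+ 1) :+ s :* con (+ 0)) :+ (a :+ x :* e) :* (t :* con (+ 1)))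
            refl a x s t (eval p x) ⟩
    (s - x * t) * (eval p x * 1# + s * 0#) + (a + x * eval p x) * t ^ 1
      ≈⟨ +-congʳ (*-congˡ (+-congˡ (*-congˡ (form-zero (quotient p x) 0 s t q≈0)))) ⟨
    (s - x * t) * form (eval p x ∷ quotient p x) 0 s t + (a + x * eval p x) * t ^ 1 ∎
    where
    dp′ : DegreeAtMost p 0
    dp′ = tail-degree a p 0 dp

    q≈0 : quotient p x ≈ₚ 0ₚ
    q≈0 m = degree-quotient (a ∷ p) x 0 dp (suc m) (s≤s z≤n)

    constant : eval p x ≈ coeff p 0
    constant = trans (sym (form-[x,1] p 0 x)) (form-constant p x 1# dp′)
  form-quotient (a ∷ p) (suc n) x s t dp = begin
    a * t ^ suc (suc n) + s * form p (suc n) s t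
      ≈⟨ +-congˡ (*-congˡ (form-quotient p n x s t (tail-degree a p (suc n) dp))) ⟩
    a * t ^ suc (suc n) + s * ((s - x * t) * form (quotient p x) n s t + eval p x * t ^ suc n)
      ≈⟨ solve 7 (λ a x s t e z q → a :* (t :* z) :+ s :* ((s :- x :* t) :* q :+ e :* z)
            := (s :- x :* t) :* (e :* z :+ s :* q) :+ (a :+ x :* e) :* (t :* z))
            refl a x s t (eval p x) (t ^ suc n) _ ⟩
    (s - x * t) * (eval p x * t ^ suc n + s * form (quotient p x) n s t) +
        (a + x * eval p x) * t ^ suc (suc n) ∎

-- Linear algebra and polynomials over a field

module FieldProperties (em : ∀ {a} → ExcludedMiddle a) {c ℓ} (F : Field c ℓ) where
  open Field F hiding (zero)
  open Algebra.Properties.Ring ring using (x∙y⁻¹≈ε⇒x≈y)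
  open IntegerRingSolver commutativeRing
  open Polynomials rawRing
  open PolynomialProperties commutativeRing
  open import Relation.Binary.Reasoning.Setoid setoid

  infix 4 _≈?_
  _≈?_ : ∀ x y → Dec (x ≈ y)
  x ≈? y = em

  ≉-cong : ∀ {x y} → x ≈ y → x ≉ 0# → y ≉ 0#
  ≉-cong x≈y x≉0 y≈0 = x≉0 (trans x≈y y≈0)

  x-y≈0⇒x≈y : ∀ {x y} → x - y ≈ 0# → x ≈ y
  x-y≈0⇒x≈y = x∙y⁻¹≈ε⇒x≈y _ _

  x≈y⇒x-y≈0 : ∀ {x y} → x ≈ y → x - y ≈ 0#
  x≈y⇒x-y≈0 x≈y = trans (+-congʳ x≈y) (-‿inverseʳ _)

  *-cancel-≈0 : ∀ {x y} → x ≉ 0# → x * y ≈ 0# → y ≈ 0#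
  *-cancel-≈0 {x} {y} x≉0 xy≈0 with invertible x≉0
  ... | x⁻¹ , xx⁻¹≈1 = begin
    y                 ≈⟨ *-identityˡ y ⟨
    1# * y            ≈⟨ *-congʳ xx⁻¹≈1 ⟨
    (x * x⁻¹) * y     ≈⟨ solve 3 (λ x i y → (x :* i) :* y := i :* (x :* y)) refl x x⁻¹ y ⟩
    x⁻¹ * (x * y)     ≈⟨ *-congˡ xy≈0 ⟩
    x⁻¹ * 0#          ≈⟨ zeroʳ x⁻¹ ⟩
    0#                ∎

  *-≉0 : ∀ {x y} → x ≉ 0# → y ≉ 0# → x * y ≉ 0#
  *-≉0 x≉0 y≉0 xy≈0 = y≉0 (*-cancel-≈0 x≉0 xy≈0)

  ^-≉0 : ∀ {x} n → x ≉ 0# → x ^ n ≉ 0#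
  ^-≉0 zero    x≉0 = 1≉0
  ^-≉0 (suc n) x≉0 = *-≉0 x≉0 (^-≉0 n x≉0)

  *-cancelˡ-≈ : ∀ {x y z} → x ≉ 0# → x * y ≈ x * z → y ≈ z
  *-cancelˡ-≈ {x} {y} {z} x≉0 xy≈xz = x-y≈0⇒x≈y (*-cancel-≈0 x≉0
    (trans (solve 3 (λ x y z → x :* (y :- z) := x :* y :- x :* z) refl x y z) (x≈y⇒x-y≈0 xy≈xz)))

  parallel : ∀ {p q s t} → ¬ (p ≈ 0# × q ≈ 0#) → p * t ≈ q * s →
             ∃ λ k → s ≈ k * p × t ≈ k * q
  parallel {p} {q} {s} {t} pq≉0 pt≈qs with p ≈? 0#
  ... | no p≉0 with invertible p≉0
  ...   | p⁻¹ , pp⁻¹≈1 =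
      s * p⁻¹ , sym (trans (*-assoc s p⁻¹ p) (trans (*-congˡ (trans (*-comm _ _) pp⁻¹≈1)) (*-identityʳ s)))
                       , sym (begin
      (s * p⁻¹) * q   ≈⟨ solve 3 (λ s i q → (s :* i) :* q := i :* (q :* s)) refl s p⁻¹ q ⟩
      p⁻¹ * (q * s)   ≈⟨ *-congˡ pt≈qs ⟨
      p⁻¹ * (p * t)   ≈⟨ solve 3 (λ i p t → i :* (p :* t) := (p :* i) :* t) refl p⁻¹ p t ⟩
      (p * p⁻¹) * t   ≈⟨ *-congʳ pp⁻¹≈1 ⟩
      1# * t          ≈⟨ *-identityˡ t ⟩
      t               ∎)
  parallel {p} {q} {s} {t} pq≉0 pt≈qs | yes p≈0 with invertible (λ q≈0 → pq≉0 (p≈0 , q≈0))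
  ... | q⁻¹ , qq⁻¹≈1 = t * q⁻¹
    , trans (*-cancel-≈0 (λ q≈0 → pq≉0 (p≈0 , q≈0)) (trans (sym pt≈qs) (trans (*-congʳ p≈0) (zeroˡ t))))
            (sym (trans (*-congˡ p≈0) (zeroʳ _)))
    , sym (trans (*-assoc t q⁻¹ q) (trans (*-congˡ (trans (*-comm _ _) qq⁻¹≈1)) (*-identityʳ t)))

  ≉ₚ0⇒coeff : ∀ p → ¬ (p ≈ₚ 0ₚ) → ∃ λ n → coeff p n ≉ 0#
  ≉ₚ0⇒coeff p p≉0 with em {P = ∃ λ n → coeff p n ≉ 0#}
  ... | yes n = n
  ... | no ∄n = ⊥-elim (p≉0 (λ n → decidable-stable (_ ≈? _) (λ pₙ≉0 → ∄n (n , pₙ≉0))))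

  -- Trailing zeros hide the degree; it is found by deciding whether the tail vanishes.
  leading : ∀ p → ¬ (p ≈ₚ 0ₚ) → ∃ λ n → coeff p n ≉ 0# × DegreeAtMost p n
  leading []      p≉0 = ⊥-elim (p≉0 (λ _ → refl))
  leading (a ∷ p) p≉0 with em {P = p ≈ₚ 0ₚ}
  ... | yes p≈0 = 0 , (λ a≈0 → p≉0 λ { zero → a≈0 ; (suc n) → p≈0 n }) , λ { (suc m) _ → p≈0 m }
  ... | no p≉0′ with leading p p≉0′
  ...   | n , pₙ≉0 , dp = suc n , pₙ≉0 , λ { (suc m) (s≤s n<m) → dp m n<m }

  *ₚ-≉0 : ∀ p q → ¬ (p ≈ₚ 0ₚ) → ¬ (q ≈ₚ 0ₚ) → ¬ (p *ₚ q ≈ₚ 0ₚ)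
  *ₚ-≉0 p q p≉0 q≉0 pq≈0 with leading p p≉0 | leading q q≉0
  ... | m , pₘ≉0 , dp | n , qₙ≉0 , dq =
    *-≉0 pₘ≉0 qₙ≉0 (trans (sym (coeff-*-top p q m n dp dq)) (pq≈0 (m ℕ.+ n)))

  -- The index n is any positive one with a nonzero coefficient, so no leading coefficient has to be
  -- located before a root is taken.
  IsAlgebraicallyClosed : Set (c ⊔ ℓ)
  IsAlgebraicallyClosed = ∀ p {n} → 1 ℕ.≤ n → coeff p n ≉ 0# → ∃ λ x → eval p x ≈ 0#

-- Polynomials and forms over an algebraically closed field

module AlgebraicallyClosed (em : ∀ {a} → ExcludedMiddle a) {c ℓ} (F : Field c ℓ)
  (closed : FieldProperties.IsAlgebraicallyClosed em F) where
  open Field F hiding (zero)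
  open IntegerRingSolver commutativeRing
  open Polynomials rawRing
  open PolynomialProperties commutativeRing
  open Evaluation commutativeRing
  open FieldProperties em F
  open import Relation.Binary.Reasoning.Setoid setoid

  -- A root x of z p(z) − 1 satisfies x p(x) = 1.
  nonroot : ∀ p → ¬ (p ≈ₚ 0ₚ) → ∃ λ x → eval p x ≉ 0#
  nonroot p p≉0 with ≉ₚ0⇒coeff p p≉0
  ... | n , pₙ≉0 with closed ((- 1#) ∷ p) {suc n} (s≤s z≤n) pₙ≉0
  ...   | x , root = x , λ p[x]≈0 → 1≉0 (begin
    1#
        ≈⟨ solve 1 (λ y → con (+ 1) := y :- (:- con (+ 1) :+ y)) refl (x * eval p x) ⟩
    x * eval p x - (- 1# + x * eval p x) ≈⟨ +-cong (trans (*-congˡ p[x]≈0) (zeroʳ x)) (-‿cong root) ⟩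
    0# - 0#                    ≈⟨ -‿inverseʳ 0# ⟩
    0#                         ∎)

  eval≈0⇒≈ₚ0 : ∀ p → (∀ x → eval p x ≈ 0#) → p ≈ₚ 0ₚ
  eval≈0⇒≈ₚ0 p p[x]≈0 = decidable-stable em (λ p≉0 → let x , p[x]≉0 = nonroot p p≉0 in p[x]≉0 (p[x]≈0 x))

  -ₚ≈0⇒≈ₚ : ∀ p q → p -ₚ q ≈ₚ 0ₚ → p ≈ₚ q
  -ₚ≈0⇒≈ₚ p q d n = x-y≈0⇒x≈y
      (trans (+-congˡ (sym (coeff-neg q n))) (trans (sym (coeff-+ p (-ₚ q) n)) (d n)))

  eval-ext : ∀ p q → (∀ x → eval p x ≈ eval q x) → p ≈ₚ q
  eval-ext p q p≈q = -ₚ≈0⇒≈ₚ p q (eval≈0⇒≈ₚ0 (p -ₚ q) (λ x → trans (eval-minus p q x) (x≈y⇒x-y≈0 (p≈q x))))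

  -- The product r (p - q) vanishes at every point, while a product of nonzero polynomials has a
  -- nonzero value somewhere.
  eval-ext-off : ∀ r p q → ¬ (r ≈ₚ 0ₚ) → (∀ x → eval r x ≉ 0# → eval p x ≈ eval q x) → p ≈ₚ q
  eval-ext-off r p q r≉0 p≈q = -ₚ≈0⇒≈ₚ p q (decidable-stable em (λ p-q≉0 →
    let x , rd≉0 = nonroot (r *ₚ (p -ₚ q)) (*ₚ-≉0 r (p -ₚ q) r≉0 p-q≉0)
    in rd≉0 (trans (eval-* r (p -ₚ q) x) (vanish x))))
    where
    vanish : ∀ x → eval r x * eval (p -ₚ q) x ≈ 0#
    vanish x with eval r x ≈? 0#
    ... | yes r≈0 = trans (*-congʳ r≈0) (zeroˡ _)
    ... | no  r≉0 = trans (*-congˡ (trans (eval-minus p q x) (x≈y⇒x-y≈0 (p≈q x r≉0)))) (zeroʳ _)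

  eval-ext-except : ∀ a p q → (∀ x → x ≉ a → eval p x ≈ eval q x) → ∀ x → eval p x ≈ eval q x
  eval-ext-except a p q p≈q x = eval-cong p q x (eval-ext-off ((- a) ∷ 1# ∷ []) p q (λ e → 1≉0 (e 1))
    (λ x r≉0 → p≈q x (λ x≈a → r≉0 (begin
      (- a) + x * (1# + x * 0#)
          ≈⟨ solve 2 (λ a x → :- a :+ x :* (con (+ 1) :+ x :* con (+ 0)) := x :- a) refl a x ⟩
      x - a                    ≈⟨ x≈y⇒x-y≈0 x≈a ⟩
      0#                       ∎))))

  private
    -- With s fixed, a form is a polynomial in t. Identities of forms, clear for t ≠ 0 by
    -- dehomogenising, then extend to t = 0 by `eval-ext-except`.
    form-at : Poly → ℕ → Carrier → Poly
    form-at p n s = homogenise p n (s ∷ []) X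

    eval-form-at : ∀ p n s t → eval (form-at p n s) t ≈ form p n s t
    eval-form-at p n s t = trans (eval-homogenise p n (s ∷ []) X t)
      (form-cong p n (solve 2 (λ s t → s :+ t :* con (+ 0) := s) refl s t) (eval-X t))

  form-dehomogenise : ∀ p n {t} → t ≉ 0# → DegreeAtMost p n → ∀ s →
                      ∃ λ z → s ≈ t * z × form p n s t ≈ t ^ n * eval p z
  form-dehomogenise p n {t} t≉0 dp s with invertible t≉0
  ... | t⁻¹ , tt⁻¹≈1 = z , s≈tz , (begin
    form p n s t               ≈⟨ form-cong p n s≈tz (sym (*-identityʳ t)) ⟩
    form p n (t * z) (t * 1#)  ≈⟨ form-scale p n t z 1# dp ⟩
    t ^ n * form p n z 1#      ≈⟨ *-congˡ (form-[x,1] p n z) ⟩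
    t ^ n * eval p z           ∎)
    where
    z : Carrier
    z = t⁻¹ * s

    s≈tz : s ≈ t * z
    s≈tz = sym (trans (sym (*-assoc t t⁻¹ s)) (trans (*-congʳ tt⁻¹≈1) (*-identityˡ s)))

  private
    degree-^ : ∀ v → DegreeAtMost v 1 → ∀ n → DegreeAtMost (v ^ₚ n) n
    degree-^ v dv zero    (suc m) _ = refl
    degree-^ v dv (suc n) = degree-* v (v ^ₚ n) 1 n dv (degree-^ v dv n)

  degree-homogenise : ∀ p d u v → DegreeAtMost p d → DegreeAtMost u 1 → DegreeAtMost v 1 →
                      DegreeAtMost (homogenise p d u v) d
  -- With d = 0 a list with trailing zeros still produces high powers of u in the recursion, all
  -- with coefficient zero; the comparison with a constant is therefore made on values.
  degree-homogenise p zero u v dp du dv (suc m) _ = eval-ext (homogenise p 0 u v) (coeff p 0 ∷ [])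
    (λ x → trans (eval-homogenise p 0 u v x)
      (trans (form-constant p (eval u x) (eval v x) dp)
        (solve 2 (λ a x → a := a :+ x :* con (+ 0)) refl (coeff p 0) x))) (suc m)
  degree-homogenise []      (suc d) u v dp du dv m _ = refl
  degree-homogenise (a ∷ p) (suc d) u v dp du dv =
      degree-+ (a ·ₚ (v ^ₚ suc d)) (u *ₚ homogenise p d u v) (suc d)
    (degree-· a (v ^ₚ suc d) (suc d) (degree-^ v dv (suc d)))
    (degree-* u (homogenise p d u v) 1 d du
      (degree-homogenise p d u v (λ m d<m → dp (suc m) (s≤s d<m)) du dv))

  -- For t ≠ 0 both sides are t to the power d times a value at s / t; both are polynomials in t, so
  -- the identity persists at t = 0.
  form-homogenise : ∀ p d u v → DegreeAtMost p d → DegreeAtMost u 1 → DegreeAtMost v 1 → ∀ s t →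
    form (homogenise p d u v) d s t ≈ form p d (form u 1 s t) (form v 1 s t)
  form-homogenise p d u v dp du dv s t = begin
    form h d s t                                            ≈⟨ eval-form-at h d s t ⟨
    eval (form-at h d s) t
        ≈⟨ eval-ext-except 0# (form-at h d s) rhs off t ⟩
    eval rhs t                                              ≈⟨ eval-rhs t ⟩
    form p d (form u 1 s t) (form v 1 s t)                  ∎
    where
    h rhs : Poly
    h   = homogenise p d u v
    rhs = homogenise p d (form-at u 1 s) (form-at v 1 s)

    eval-rhs : ∀ t → eval rhs t ≈ form p d (form u 1 s t) (form v 1 s t)
    eval-rhs t = trans (eval-homogenise p d _ _ t)
        (form-cong p d (eval-form-at u 1 s t) (eval-form-at v 1 s t))

    dh : DegreeAtMost h d
    dh = degree-homogenise p d u v dp du dv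

    linear : ∀ w {t z} → DegreeAtMost w 1 → s ≈ t * z → form w 1 s t ≈ t * eval w z
    linear w {t} {z} dw s≈tz = begin
      form w 1 s t                ≈⟨ form-cong w 1 s≈tz (sym (*-identityʳ t)) ⟩
      form w 1 (t * z) (t * 1#)   ≈⟨ form-scale w 1 t z 1# dw ⟩
      t ^ 1 * form w 1 z 1#       ≈⟨ *-cong (*-identityʳ t) (form-[x,1] w 1 z) ⟩
      t * eval w z                ∎

    off : ∀ t → t ≉ 0# → eval (form-at h d s) t ≈ eval rhs t
    off t t≉0 with form-dehomogenise h d t≉0 dh s
    ... | z , s≈tz , h≈ = begin
      eval (form-at h d s) t                          ≈⟨ eval-form-at h d s t ⟩
      form h d s t                                    ≈⟨ h≈ ⟩
      t ^ d * eval h z                                ≈⟨ *-congˡ (eval-homogenise p d u v z) ⟩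
      t ^ d * form p d (eval u z) (eval v z)          ≈⟨ form-scale p d t _ _ dp ⟨
      form p d (t * eval u z) (t * eval v z)
          ≈⟨ form-cong p d (linear u du s≈tz) (linear v dv s≈tz) ⟨
      form p d (form u 1 s t) (form v 1 s t)          ≈⟨ eval-rhs t ⟨
      eval rhs t                                      ∎

  -- The bounds are paired so that both products are homogeneous of degree m + n; for t ≠ 0 the same
  -- power of t then comes out on both sides, and t = 0 follows by extension.
  form-cross : ∀ p q p′ q′ m n → DegreeAtMost p m → DegreeAtMost q n → DegreeAtMost p′ n →
      DegreeAtMost q′ m →
    p *ₚ q ≈ₚ p′ *ₚ q′ → ∀ s t → form p m s t * form q n s t ≈ form p′ n s t * form q′ m s t
  form-cross p q p′ q′ m n dp dq dp′ dq′ pq≈p′q′ s t = begin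
    form p m s t * form q n s t                       ≈⟨ eval-product p q m n t ⟨
    eval (form-at p m s *ₚ form-at q n s) t
        ≈⟨ eval-ext-except 0# (form-at p m s *ₚ form-at q n s) (form-at p′ n s *ₚ form-at q′ m s) off t ⟩
    eval (form-at p′ n s *ₚ form-at q′ m s) t         ≈⟨ eval-product p′ q′ n m t ⟩
    form p′ n s t * form q′ m s t                     ∎
    where
    eval-product : ∀ p q m n t → eval (form-at p m s *ₚ form-at q n s) t ≈ form p m s t * form q n s t
    eval-product p q m n t = trans (eval-* (form-at p m s) _ t)
        (*-cong (eval-form-at p m s t) (eval-form-at q n s t))

    dehomogenise : ∀ p m {t z} → DegreeAtMost p m → s ≈ t * z → form p m s t ≈ t ^ m * eval p z
    dehomogenise p m {t} {z} dp s≈tz = trans (form-cong p m s≈tz (sym (*-identityʳ t)))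
      (trans (form-scale p m t z 1# dp) (*-congˡ (form-[x,1] p m z)))

    off : ∀ t → t ≉ 0# → eval (form-at p m s *ₚ form-at q n s) t ≈ eval (form-at p′ n s *ₚ form-at q′ m s) t
    off t t≉0 with form-dehomogenise p m t≉0 dp s
    ... | z , s≈tz , p≈ = begin
      eval (form-at p m s *ₚ form-at q n s) t         ≈⟨ eval-product p q m n t ⟩
      form p m s t * form q n s t                     ≈⟨ *-cong p≈ (dehomogenise q n dq s≈tz) ⟩
      (t ^ m * eval p z) * (t ^ n * eval q z)
        ≈⟨ solve 4 (λ a p b q → (a :* p) :* (b :* q) := (a :* b) :* (p :* q)) refl _ _ _ _ ⟩
      (t ^ m * t ^ n) * (eval p z * eval q z)
        ≈⟨ *-congˡ (trans (sym (eval-* p q z)) (trans (eval-cong (p *ₚ q) (p′ *ₚ q′) z pq≈p′q′)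
            (eval-* p′ q′ z))) ⟩
      (t ^ m * t ^ n) * (eval p′ z * eval q′ z)
        ≈⟨ solve 4 (λ a p b q → (a :* b) :* (p :* q) := (b :* p) :* (a :* q)) refl _ _ _ _ ⟩
      (t ^ n * eval p′ z) * (t ^ m * eval q′ z)
        ≈⟨ *-cong (dehomogenise p′ n dp′ s≈tz) (dehomogenise q′ m dq′ s≈tz) ⟨
      form p′ n s t * form q′ m s t                   ≈⟨ eval-product p′ q′ n m t ⟨
      eval (form-at p′ n s *ₚ form-at q′ m s) t       ∎

  -- If the top coefficient vanishes, the point at infinity (1 : 0) is a zero; otherwise p is
  -- nonconstant and has an affine root.
  form-root : ∀ p n → DegreeAtMost p (suc n) → ∃ λ s → ∃ λ t → ¬ (s ≈ 0# × t ≈ 0#) × form p (suc n) s t ≈ 0#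
  form-root p n dp with coeff p (suc n) ≈? 0#
  ... | yes pₙ≈0 = 1# , 0# , (λ (1≈0 , _) → 1≉0 1≈0) , trans (form-[1,0] p (suc n) dp) pₙ≈0
  ... | no  pₙ≉0 with closed p {suc n} (s≤s z≤n) pₙ≉0
  ...   | x , p[x]≈0 = x , 1# , (λ (_ , 1≈0) → 1≉0 1≈0) , trans (form-[x,1] p (suc n) x) p[x]≈0

  -- Such an e agrees with the difference quotient away from x, hence also at x. The rules of
  -- differentiation below follow by exhibiting e, without comparing coefficients.
  eval-derivative-unique : ∀ p e x k → (∀ z → eval p z ≈ (z - x) * eval e z + k) →
      eval e x ≈ eval (derivative p) x
  eval-derivative-unique p e x k p≈ = trans (eval-ext-except x e (quotient p x) off x)
      (eval-quotient-self p x)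
    where
    k≈p[x] : k ≈ eval p x
    k≈p[x] = sym (trans (p≈ x) (solve 3 (λ x e k → (x :- x) :* e :+ k := k) refl x _ k))

    off : ∀ z → z ≉ x → eval e z ≈ eval (quotient p x) z
    off z z≉x = *-cancelˡ-≈ {z - x} (λ z-x≈0 → z≉x (x-y≈0⇒x≈y z-x≈0)) (begin
      (z - x) * eval e z                              ≈⟨ solve 2 (λ a k → a := (a :+ k) :- k) refl _ k ⟩
      ((z - x) * eval e z + k) - k                    ≈⟨ +-cong (sym (p≈ z)) (-‿cong k≈p[x]) ⟩
      eval p z - eval p x                             ≈⟨ +-congʳ (eval-quotient p x z) ⟩
      ((z - x) * eval (quotient p x) z + eval p x) - eval p x
                                                      ≈⟨ solve 2 (λ a k → (a :+ k) :- k := a) refl _ _ ⟩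
      (z - x) * eval (quotient p x) z                 ∎)

  eval-derivative-cong : ∀ p q x → p ≈ₚ q → eval (derivative p) x ≈ eval (derivative q) x
  eval-derivative-cong p q x p≈q = trans (sym (eval-quotient-self p x))
    (eval-derivative-unique q (quotient p x) x (eval p x)
      (λ z → trans (sym (eval-cong p q z p≈q)) (eval-quotient p x z)))

  eval-derivative-+ : ∀ p q x → eval (derivative (p +ₚ q)) x ≈ eval (derivative p) x + eval (derivative q) x
  eval-derivative-+ p q x = begin
    eval (derivative (p +ₚ q)) x
      ≈⟨ eval-derivative-unique (p +ₚ q) (quotient p x +ₚ quotient q x) x (eval p x + eval q x) split ⟨
    eval (quotient p x +ₚ quotient q x) x
      ≈⟨ eval-+ (quotient p x) _ x ⟩
    eval (quotient p x) x + eval (quotient q x) x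
      ≈⟨ +-cong (eval-quotient-self p x) (eval-quotient-self q x) ⟩
    eval (derivative p) x + eval (derivative q) x ∎
    where
    split : ∀ z → eval (p +ₚ q) z ≈ (z - x) * eval (quotient p x +ₚ quotient q x) z + (eval p x + eval q x)
    split z = begin
      eval (p +ₚ q) z ≈⟨ eval-+ p q z ⟩
      eval p z + eval q z ≈⟨ +-cong (eval-quotient p x z) (eval-quotient q x z) ⟩
      ((z - x) * eval (quotient p x) z + eval p x) + ((z - x) * eval (quotient q x) z + eval q x)
        ≈⟨ solve 5 (λ d a k b l → (d :* a :+ k) :+ (d :* b :+ l) := d :* (a :+ b) :+ (k :+ l))
            refl _ _ _ _ _ ⟩
      (z - x) * (eval (quotient p x) z + eval (quotient q x) z) + (eval p x + eval q x)
        ≈⟨ +-congʳ (*-congˡ (eval-+ (quotient p x) (quotient q x) z)) ⟨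
      (z - x) * eval (quotient p x +ₚ quotient q x) z + (eval p x + eval q x) ∎

  eval-derivative-· : ∀ a p x → eval (derivative (a ·ₚ p)) x ≈ a * eval (derivative p) x
  eval-derivative-· a p x = begin
    eval (derivative (a ·ₚ p)) x
      ≈⟨ eval-derivative-unique (a ·ₚ p) (a ·ₚ quotient p x) x (a * eval p x) split ⟨
    eval (a ·ₚ quotient p x) x
      ≈⟨ trans (eval-· a (quotient p x) x) (*-congˡ (eval-quotient-self p x)) ⟩
    a * eval (derivative p) x ∎
    where
    split : ∀ z → eval (a ·ₚ p) z ≈ (z - x) * eval (a ·ₚ quotient p x) z + a * eval p x
    split z = begin
      eval (a ·ₚ p) z                                       ≈⟨ eval-· a p z ⟩
      a * eval p z                                          ≈⟨ *-congˡ (eval-quotient p x z) ⟩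
      a * ((z - x) * eval (quotient p x) z + eval p x)
        ≈⟨ solve 4 (λ a d q k → a :* (d :* q :+ k) := d :* (a :* q) :+ a :* k) refl a (z - x) _ _ ⟩
      (z - x) * (a * eval (quotient p x) z) + a * eval p x
        ≈⟨ +-congʳ (*-congˡ (eval-· a (quotient p x) z)) ⟨
      (z - x) * eval (a ·ₚ quotient p x) z + a * eval p x   ∎

  eval-derivative-* : ∀ p q x → eval (derivative (p *ₚ q)) x ≈
                      eval (derivative p) x * eval q x + eval p x * eval (derivative q) x
  eval-derivative-* p q x = begin
    eval (derivative (p *ₚ q)) x
      ≈⟨ eval-derivative-unique (p *ₚ q) e x (eval p x * eval q x) split ⟨
    eval e x
      ≈⟨ eval-e x ⟩
    eval p′ x * eval q x + eval p x * eval q′ x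
      ≈⟨ +-cong (*-congʳ (eval-quotient-self p x)) (*-congˡ (eval-quotient-self q x)) ⟩
    eval (derivative p) x * eval q x + eval p x * eval (derivative q) x ∎
    where
    p′ q′ e : Poly
    p′ = quotient p x
    q′ = quotient q x
    e  = p′ *ₚ q +ₚ eval p x ·ₚ q′

    eval-e : ∀ z → eval e z ≈ eval p′ z * eval q z + eval p x * eval q′ z
    eval-e z = trans (eval-+ (p′ *ₚ q) _ z) (+-cong (eval-* p′ q z) (eval-· (eval p x) q′ z))

    split : ∀ z → eval (p *ₚ q) z ≈ (z - x) * eval e z + eval p x * eval q x
    split z = begin
      eval (p *ₚ q) z                  ≈⟨ eval-* p q z ⟩
      eval p z * eval q z              ≈⟨ *-congʳ (eval-quotient p x z) ⟩
      ((z - x) * eval p′ z + eval p x) * eval q z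
        ≈⟨ solve 4 (λ d a k b → (d :* a :+ k) :* b := d :* (a :* b) :+ k :* b) refl _ _ _ _ ⟩
      (z - x) * (eval p′ z * eval q z) + eval p x * eval q z
        ≈⟨ +-congˡ (*-congˡ (eval-quotient q x z)) ⟩
      (z - x) * (eval p′ z * eval q z) + eval p x * ((z - x) * eval q′ z + eval q x)
        ≈⟨ solve 5 (λ d a k b l → d :* a :+ k :* (d :* b :+ l) := d :* (a :+ k :* b) :+ k :* l)
            refl _ _ _ _ _ ⟩
      (z - x) * (eval p′ z * eval q z + eval p x * eval q′ z) + eval p x * eval q x
        ≈⟨ +-congʳ (*-congˡ (eval-e z)) ⟨
      (z - x) * eval e z + eval p x * eval q x ∎

  rootless⇒constant : ∀ p → (∀ x → eval p x ≉ 0#) → ∃ λ a → a ≉ 0# × (∀ x → eval p x ≈ a)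
  rootless⇒constant p p[x]≉0 = coeff p 0 , (λ p₀≈0 → p[x]≉0 0# (trans (constant 0#) p₀≈0)) , constant
    where
    degree₀ : DegreeAtMost p 0
    degree₀ n 0<n = decidable-stable (_ ≈? _) (λ pₙ≉0 → let x , e = closed p 0<n pₙ≉0 in p[x]≉0 x e)

    constant : ∀ x → eval p x ≈ coeff p 0
    constant x = trans (sym (form-[x,1] p 0 x)) (form-constant p x 1# degree₀)

  -- The forms have no common zero on the projective line. Its affine points account for the
  -- coprimality of f and g, its point at infinity for the degree being exactly d.
  NonVanishing : Poly → Poly → ℕ → Set (c ⊔ ℓ)
  NonVanishing f g d = ∀ s t → form f d s t ≈ 0# → form g d s t ≈ 0# → s ≈ 0# × t ≈ 0#

  form-[s,0] : ∀ p n s {t} → t ≈ 0# → DegreeAtMost p n → form p n s t ≈ s ^ n * coeff p n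
  form-[s,0] p n s {t} t≈0 dp = begin
    form p n s t                ≈⟨ form-cong p n (sym (*-identityʳ s)) (trans t≈0 (sym (zeroʳ s))) ⟩
    form p n (s * 1#) (s * 0#)  ≈⟨ form-scale p n s 1# 0# dp ⟩
    s ^ n * form p n 1# 0#      ≈⟨ *-congˡ (form-[1,0] p n dp) ⟩
    s ^ n * coeff p n           ∎

  -- A common zero with t ≠ 0 yields a common root, and one with t = 0 and s ≠ 0 annuls both
  -- coefficients at d.
  rootless⇒nonVanishing : ∀ f g d → (∀ x → eval f x ≈ 0# → eval g x ≉ 0#) → MaxDegree f g d →
      NonVanishing f g d
  rootless⇒nonVanishing f g d rootless (df , dg , top) s t F≈0 G≈0 with t ≈? 0#
  ... | yes t≈0 = decidable-stable (_ ≈? _) (λ s≉0 → ⊥-elim (contra s≉0 top)) , t≈0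
    where
    vanish : ∀ {p} → DegreeAtMost p d → form p d s t ≈ 0# → s ≉ 0# → coeff p d ≈ 0#
    vanish {p} dp P≈0 s≉0 = *-cancel-≈0 (^-≉0 d s≉0) (trans (sym (form-[s,0] p d s t≈0 dp)) P≈0)

    contra : s ≉ 0# → coeff f d ≉ 0# ⊎ coeff g d ≉ 0# → ⊥
    contra s≉0 (inj₁ f≉0) = f≉0 (vanish {f} df F≈0 s≉0)
    contra s≉0 (inj₂ g≉0) = g≉0 (vanish {g} dg G≈0 s≉0)
  ... | no t≉0 with form-dehomogenise f d t≉0 df s
  ...   | z , s≈tz , f≈ = ⊥-elim (rootless z
    (*-cancel-≈0 (^-≉0 d t≉0) (trans (sym f≈) F≈0))
    (*-cancel-≈0 (^-≉0 d t≉0) (trans (sym g≈) G≈0)))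
    where
    g≈ : form g d s t ≈ t ^ d * eval g z
    g≈ = trans (form-cong g d s≈tz (sym (*-identityʳ t)))
      (trans (form-scale g d t z 1# dg) (*-congˡ (form-[x,1] g d z)))

  module _ {f g d} (df : DegreeAtMost f d) (dg : DegreeAtMost g d) (nv : NonVanishing f g d) where

    nonVanishing⇒rootless : ∀ x → eval f x ≈ 0# → eval g x ≉ 0#
    nonVanishing⇒rootless x f≈0 g≈0 =
      1≉0 (proj₂ (nv x 1# (trans (form-[x,1] f d x) f≈0) (trans (form-[x,1] g d x) g≈0)))

    nonVanishing⇒maxDegree : MaxDegree f g d
    nonVanishing⇒maxDegree = df , dg , top
      where
      top : coeff f d ≉ 0# ⊎ coeff g d ≉ 0#
      top with coeff f d ≈? 0#
      ... | no f≉0  = inj₁ f≉0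
      ... | yes f≈0 = inj₂ λ g≈0 →
        1≉0 (proj₁ (nv 1# 0# (trans (form-[1,0] f d df) f≈0) (trans (form-[1,0] g d dg) g≈0)))

    -- A root of a common divisor would be a common root of f and g, so the divisor is a nonzero
    -- constant and divides 1.
    nonVanishing⇒coprime : Coprime f g
    nonVanishing⇒coprime {z} (u RawMagma., uz≈f) (w RawMagma., wz≈g) with rootless⇒constant z rootless
      where
      multiple : ∀ p q → q *ₚ z ≈ₚ p → ∀ x → eval z x ≈ 0# → eval p x ≈ 0#
      multiple p q qz≈p x z≈0 = trans (sym (eval-cong (q *ₚ z) p x qz≈p))
        (trans (eval-* q z x) (trans (*-congˡ z≈0) (zeroʳ _)))

      rootless : ∀ x → eval z x ≉ 0#
      rootless x z≈0 = nonVanishing⇒rootless x (multiple f u uz≈f x z≈0) (multiple g w wz≈g x z≈0)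
    ... | a , a≉0 , z≈a with invertible a≉0
    ...   | a⁻¹ , aa⁻¹≈1 = (a⁻¹ ∷ []) RawMagma., eval-ext ((a⁻¹ ∷ []) *ₚ z) 1ₚ (λ x → begin
      eval ((a⁻¹ ∷ []) *ₚ z) x        ≈⟨ eval-* (a⁻¹ ∷ []) z x ⟩
      (a⁻¹ + x * 0#) * eval z x       ≈⟨ *-congˡ (z≈a x) ⟩
      (a⁻¹ + x * 0#) * a
          ≈⟨ solve 3 (λ i x a → (i :+ x :* con (+ 0)) :* a := a :* i) refl a⁻¹ x a ⟩
      a * a⁻¹                         ≈⟨ aa⁻¹≈1 ⟩
      1#                              ≈⟨ eval-1 x ⟨
      eval 1ₚ x                       ∎)

-- Division with remainder and Bézout's identity

module LeastElement (em : ∀ {a} → ExcludedMiddle a) where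

  least : ∀ {a} {P : ℕ → Set a} → ∃ P → ∃ λ n → P n × (∀ k → k ℕ.< n → ¬ P k)
  least {P = P} (n , Pn) = <-rec (λ n → P n → ∃ λ n → P n × (∀ k → k ℕ.< n → ¬ P k)) step n Pn
    where
    step : ∀ n → (∀ {k} → k ℕ.< n → P k → ∃ λ n → P n × (∀ k → k ℕ.< n → ¬ P k)) →
           P n → ∃ λ n → P n × (∀ k → k ℕ.< n → ¬ P k)
    step n rec Pn with em {P = ∃ λ k → k ℕ.< n × P k}
    ... | yes (k , k<n , Pk) = rec k<n Pk
    ... | no  ∄k             = n , Pn , λ k k<n Pk → ∄k (k , k<n , Pk)

-- Polynomial identities over K are checked at the points of an algebraically
-- closed field L.
module Bézout (em : ∀ {a} → ExcludedMiddle a) {k ℓk l ℓl} (K : Field k ℓk) (L : Field l ℓl)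
  (closed : FieldProperties.IsAlgebraicallyClosed em L)
  (ι : Field.Carrier K → Field.Carrier L)
  (isHom : RingMorphisms.IsRingHomomorphism (Field.rawRing K) (Field.rawRing L) ι)
  where
  private
    module L  = Field L
    module L[z] = Polynomials L.rawRing
    module LF = FieldProperties em L
    module LA = AlgebraicallyClosed em L closed
    module LE = Evaluation L.commutativeRing
    module At (x : L.Carrier) = Specialisation (Field.commutativeRing K) L.commutativeRing ι isHom x
      (λ p → L[z].eval (map ι p) x) L.refl (λ _ _ → L.refl)
  open Field K hiding (zero)
  open RingMorphisms.IsRingHomomorphism isHom
  open IntegerRingSolver L.commutativeRing
  open Polynomials rawRing
  open PolynomialProperties commutativeRing
  open FieldProperties em K
  open LeastElement em

  eval-ι : Poly → L.Carrier → L.Carrier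
  eval-ι p x = L[z].eval (map ι p) x

  coeff-ι : ∀ p n → L[z].coeff (map ι p) n L.≈ ι (coeff p n)
  coeff-ι []      n       = L.sym 0#-homo
  coeff-ι (a ∷ p) zero    = L.refl
  coeff-ι (a ∷ p) (suc n) = coeff-ι p n

  ι-≉0 : ∀ {x} → x ≉ 0# → ι x L.≉ L.0#
  ι-≉0 {x} x≉0 ιx≈0 with invertible x≉0
  ... | x⁻¹ , xx⁻¹≈1 = L.1≉0 (begin
    L.1#              ≈⟨ 1#-homo ⟨
    ι 1#              ≈⟨ ⟦⟧-cong xx⁻¹≈1 ⟨
    ι (x * x⁻¹)       ≈⟨ *-homo x x⁻¹ ⟩
    ι x L.* ι x⁻¹     ≈⟨ L.*-congʳ ιx≈0 ⟩
    L.0# L.* ι x⁻¹    ≈⟨ L.zeroˡ _ ⟩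
    L.0#              ∎)
    where open import Relation.Binary.Reasoning.Setoid L.setoid

  ι-≉ₚ0 : ∀ p → ¬ (p ≈ₚ 0ₚ) → ¬ (map ι p L[z].≈ₚ L[z].0ₚ)
  ι-≉ₚ0 p p≉0 ιp≈0 with ≉ₚ0⇒coeff p p≉0
  ... | n , pₙ≉0 = ι-≉0 pₙ≉0 (L.trans (L.sym (coeff-ι p n)) (ιp≈0 n))

  eval-ι-cong : ∀ p q → p ≈ₚ q → ∀ x → eval-ι p x L.≈ eval-ι q x
  eval-ι-cong p q p≈q x = At.e-cong x p q p≈q

  eval-ι-* : ∀ p q x → eval-ι (p *ₚ q) x L.≈ eval-ι p x L.* eval-ι q x
  eval-ι-* p q x = At.e-* x p q

  eval-ι-1 : ∀ x → eval-ι 1ₚ x L.≈ L.1#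
  eval-ι-1 x = L.trans (L.+-congʳ 1#-homo) (LE.eval-1 x)

  eval-ι-ext : ∀ p q → (∀ x → eval-ι p x L.≈ eval-ι q x) → p ≈ₚ q
  eval-ι-ext p q p≈q n = x-y≈0⇒x≈y (decidable-stable (_ ≈? _) (λ d≉0 →
    ι-≉ₚ0 (p -ₚ q) (λ d≈0 → d≉0 (trans (sym (coeff-minus n)) (d≈0 n)))
      (LA.eval≈0⇒≈ₚ0 (map ι (p -ₚ q)) (λ x → L.trans (At.e-minus x p q) (LF.x≈y⇒x-y≈0 (p≈q x))))))
    where
    coeff-minus : ∀ n → coeff (p -ₚ q) n ≈ coeff p n - coeff q n
    coeff-minus n = trans (coeff-+ p (-ₚ q) n) (+-congˡ (coeff-neg q n))

  -- Horner's scheme: from p = q m + r follows a + z p = (z q) m + (a + z r), and subtracting c m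
  -- from the last term removes its coefficient at n.
  division : ∀ m n → coeff m n ≉ 0# → DegreeAtMost m n → ∀ p →
             ∃ λ q → ∃ λ r → p ≈ₚ q *ₚ m +ₚ r × (∀ k → n ℕ.≤ k → coeff r k ≈ 0#)
  division m n mₙ≉0 dm []      = [] , [] , (λ _ → refl) , λ _ _ → refl
  division m n mₙ≉0 dm (a ∷ p) with division m n mₙ≉0 dm p | invertible mₙ≉0
  ... | q , r , p≈ , dr | u , mₙu≈1 = (c ∷ q) , s , eval-ι-ext (a ∷ p) ((c ∷ q) *ₚ m +ₚ s) eval≈ , degree
    where
    c : Carrier
    c = coeff (a ∷ r) n * u

    s : Poly
    s = (a ∷ r) -ₚ c ·ₚ m

    eval≈ : ∀ x → eval-ι (a ∷ p) x L.≈ eval-ι ((c ∷ q) *ₚ m +ₚ s) x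
    eval≈ x = begin
      ι a L.+ x L.* eval-ι p x
        ≈⟨ L.+-congˡ (L.*-congˡ (L.trans (eval-ι-cong p (q *ₚ m +ₚ r) p≈ x)
             (L.trans (At.e-+ x (q *ₚ m) r) (L.+-congʳ (eval-ι-* q m x))))) ⟩
      ι a L.+ x L.* (eval-ι q x L.* eval-ι m x L.+ eval-ι r x)
        ≈⟨ solve 6 (λ a x q m r c → a :+ x :* (q :* m :+ r)
              := (c :+ x :* q) :* m :+ ((a :+ x :* r) :- c :* m)) L.refl (ι a) x (eval-ι q x) (eval-ι m x)
                  (eval-ι r x) (ι c) ⟩
      (ι c L.+ x L.* eval-ι q x) L.* eval-ι m x L.+ ((ι a L.+ x L.* eval-ι r x) L.- ι c L.* eval-ι m x)
        ≈⟨ L.+-cong (eval-ι-* (c ∷ q) m x)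
             (L.trans (At.e-minus x (a ∷ r) (c ·ₚ m)) (L.+-congˡ (L.-‿cong (At.e-· x c m)))) ⟨
      eval-ι ((c ∷ q) *ₚ m) x L.+ eval-ι s x
        ≈⟨ At.e-+ x ((c ∷ q) *ₚ m) s ⟨
      eval-ι ((c ∷ q) *ₚ m +ₚ s) x ∎
      where open import Relation.Binary.Reasoning.Setoid L.setoid

    open import Relation.Binary.Reasoning.Setoid setoid
    module KS = IntegerRingSolver commutativeRing

    coeff-s : ∀ k → coeff s k ≈ coeff (a ∷ r) k - c * coeff m k
    coeff-s k = trans (coeff-+ (a ∷ r) (-ₚ (c ·ₚ m)) k)
        (+-congˡ (trans (coeff-neg (c ·ₚ m) k) (-‿cong (coeff-· c m k))))

    degree : ∀ k → n ℕ.≤ k → coeff s k ≈ 0#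
    degree k n≤k with ℕ.m≤n⇒m<n∨m≡n n≤k
    degree (suc k) n≤k | inj₁ n<k@(s≤s n≤k′) = begin
      coeff s (suc k)                       ≈⟨ coeff-s (suc k) ⟩
      coeff r k - c * coeff m (suc k)       ≈⟨ +-cong (dr k n≤k′) (-‿cong (*-congˡ (dm (suc k) n<k))) ⟩
      0# - c * 0#
          ≈⟨ KS.solve 1 (λ c → KS.con (+ 0) KS.:- c KS.:* KS.con (+ 0) KS.:= KS.con (+ 0)) refl c ⟩
      0#                                    ∎
    degree k n≤k | inj₂ ≡.refl = begin
      coeff s n                                             ≈⟨ coeff-s n ⟩
      coeff (a ∷ r) n - (coeff (a ∷ r) n * u) * coeff m n
        ≈⟨ +-congˡ (-‿cong (trans (*-assoc _ u _) (*-congˡ (trans (*-comm u _) mₙu≈1)))) ⟩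
      coeff (a ∷ r) n - coeff (a ∷ r) n * 1#
          ≈⟨ KS.solve 1 (λ c → c KS.:- c KS.:* KS.con (+ 1) KS.:= KS.con (+ 0)) refl _ ⟩
      0#                                                    ∎

  -- Remainders modulo an element of least degree lie in I and have smaller degree, so they vanish.
  principal : ∀ {i} (I : Poly → Set i) → (∀ p m q r → I p → I m → p ≈ₚ q *ₚ m +ₚ r → I r) →
              ∀ p → I p → ¬ (p ≈ₚ 0ₚ) → ∃ λ m → I m × (∀ p → I p → ∃ λ q → q *ₚ m ≈ₚ p)
  principal I ideal p Ip p≉0 with least {P = λ n → ∃ λ m → I m × coeff m n ≉ 0# × DegreeAtMost m n}
    (let n , pₙ≉0 , dp = leading p p≉0 in n , p , Ip , pₙ≉0 , dp)
  ... | n , (m , Im , mₙ≉0 , dm) , minimal = m , Im , divides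
    where
    divides : ∀ p → I p → ∃ λ q → q *ₚ m ≈ₚ p
    divides p Ip with division m n mₙ≉0 dm p
    ... | q , r , p≈ , dr = q , λ k →
        sym (trans (p≈ k) (trans (coeff-+ (q *ₚ m) r k) (trans (+-congˡ (r≈0 k)) (+-identityʳ _))))
      where
      r≈0 : r ≈ₚ 0ₚ
      r≈0 = decidable-stable em (λ r≉0 → let k , rₖ≉0 , dr′ = leading r r≉0 in
        minimal k (ℕ.≰⇒> (λ n≤k → rₖ≉0 (dr k n≤k))) (r , ideal p m q r Ip Im p≈ , rₖ≉0 , dr′))

  module _ {f g : Poly} where
    private
      -- The ideal generated by f and g in K[z]. Membership is tested at the points of L, where the
      -- identities become ring identities between values.
      Combination : Poly → Set _
      Combination p = ∃ λ u → ∃ λ w → ∀ x →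
        eval-ι p x L.≈ eval-ι u x L.* eval-ι f x L.+ eval-ι w x L.* eval-ι g x

      combination-ideal : ∀ p m q r → Combination p → Combination m → p ≈ₚ q *ₚ m +ₚ r → Combination r
      combination-ideal p m q r (u , w , p≈) (u′ , w′ , m≈) p≈qm+r =
          u -ₚ q *ₚ u′ , w -ₚ q *ₚ w′ , λ x → begin
        eval-ι r x
          ≈⟨ solve 2 (λ r y → r := (y :+ r) :- y) L.refl (eval-ι r x) (eval-ι q x L.* eval-ι m x) ⟩
        (eval-ι q x L.* eval-ι m x L.+ eval-ι r x) L.- eval-ι q x L.* eval-ι m x
          ≈⟨ L.+-congʳ (L.trans (L.+-congʳ (L.sym (eval-ι-* q m x)))
               (L.trans (L.sym (At.e-+ x (q *ₚ m) r)) (L.sym (eval-ι-cong p (q *ₚ m +ₚ r) p≈qm+r x)))) ⟩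
        eval-ι p x L.- eval-ι q x L.* eval-ι m x
          ≈⟨ L.+-cong (p≈ x) (L.-‿cong (L.*-congˡ (m≈ x))) ⟩
        (eval-ι u x L.* eval-ι f x L.+ eval-ι w x L.* eval-ι g x) L.-
        eval-ι q x L.* (eval-ι u′ x L.* eval-ι f x L.+ eval-ι w′ x L.* eval-ι g x)
          ≈⟨ solve 7 (λ u w u′ w′ q f g → (u :* f :+ w :* g) :- q :* (u′ :* f :+ w′ :* g)
                := (u :- q :* u′) :* f :+ (w :- q :* w′) :* g) L.refl
                (eval-ι u x) (eval-ι w x) (eval-ι u′ x) (eval-ι w′ x) (eval-ι q x) (eval-ι f x)
                    (eval-ι g x) ⟩
        (eval-ι u x L.- eval-ι q x L.* eval-ι u′ x) L.* eval-ι f x L.+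
        (eval-ι w x L.- eval-ι q x L.* eval-ι w′ x) L.* eval-ι g x
          ≈⟨ L.+-cong (L.*-congʳ (minus u u′ x)) (L.*-congʳ (minus w w′ x)) ⟨
        eval-ι (u -ₚ q *ₚ u′) x L.* eval-ι f x L.+ eval-ι (w -ₚ q *ₚ w′) x L.* eval-ι g x ∎
        where
        open import Relation.Binary.Reasoning.Setoid L.setoid
        minus : ∀ u u′ x → eval-ι (u -ₚ q *ₚ u′) x L.≈ eval-ι u x L.- eval-ι q x L.* eval-ι u′ x
        minus u u′ x = L.trans (At.e-minus x u (q *ₚ u′)) (L.+-congˡ (L.-‿cong (eval-ι-* q u′ x)))

      combination-f : Combination f
      combination-f = 1ₚ , 0ₚ , λ x → L.sym (L.trans (L.+-congʳ (L.*-congʳ (eval-ι-1 x)))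
        (solve 2 (λ f g → con (+ 1) :* f :+ con (+ 0) :* g := f) L.refl (eval-ι f x) (eval-ι g x)))

      combination-g : Combination g
      combination-g = 0ₚ , 1ₚ , λ x → L.sym (L.trans (L.+-congˡ (L.*-congʳ (eval-ι-1 x)))
        (solve 2 (λ f g → con (+ 0) :* f :+ con (+ 1) :* g := g) L.refl (eval-ι f x) (eval-ι g x)))

      generator : ¬ (f ≈ₚ 0ₚ × g ≈ₚ 0ₚ) →
                  ∃ λ m → Combination m × (∀ p → Combination p → ∃ λ q → q *ₚ m ≈ₚ p)
      generator fg≉0 with em {P = f ≈ₚ 0ₚ}
      ... | no  f≉0 = principal Combination combination-ideal f combination-f f≉0
      ... | yes f≈0 = principal Combination combination-ideal g combination-g (λ g≈0 → fg≉0 (f≈0 , g≈0))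

    bézout : ¬ (f ≈ₚ 0ₚ × g ≈ₚ 0ₚ) → Coprime f g → ∃ λ u → ∃ λ w → u *ₚ f +ₚ w *ₚ g ≈ₚ 1ₚ
    bézout fg≉0 coprime with generator fg≉0
    ... | m , (u , w , m≈) , divides with divides f combination-f | divides g combination-g
    ...   | a , am≈f | b , bm≈g with coprime (a RawMagma., am≈f) (b RawMagma., bm≈g)
    ...     | q RawMagma., qm≈1 = q *ₚ u , q *ₚ w , eval-ι-ext ((q *ₚ u) *ₚ f +ₚ (q *ₚ w) *ₚ g)
        1ₚ λ x → begin
      eval-ι ((q *ₚ u) *ₚ f +ₚ (q *ₚ w) *ₚ g) x
        ≈⟨ L.trans (At.e-+ x ((q *ₚ u) *ₚ f) ((q *ₚ w) *ₚ g)) (L.+-cong (expand q u f x) (expand q w g x)) ⟩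
      (eval-ι q x L.* eval-ι u x) L.* eval-ι f x L.+ (eval-ι q x L.* eval-ι w x) L.* eval-ι g x
        ≈⟨ solve 5 (λ q u w f g → (q :* u) :* f :+ (q :* w) :* g := q :* (u :* f :+ w :* g)) L.refl
             (eval-ι q x) (eval-ι u x) (eval-ι w x) (eval-ι f x) (eval-ι g x) ⟩
      eval-ι q x L.* (eval-ι u x L.* eval-ι f x L.+ eval-ι w x L.* eval-ι g x)
        ≈⟨ L.*-congˡ (m≈ x) ⟨
      eval-ι q x L.* eval-ι m x
        ≈⟨ eval-ι-* q m x ⟨
      eval-ι (q *ₚ m) x
        ≈⟨ eval-ι-cong (q *ₚ m) 1ₚ qm≈1 x ⟩
      eval-ι 1ₚ x ∎
      where
      open import Relation.Binary.Reasoning.Setoid L.setoid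
      expand : ∀ a b c x → eval-ι ((a *ₚ b) *ₚ c) x L.≈ (eval-ι a x L.* eval-ι b x) L.* eval-ι c x
      expand a b c x = L.trans (eval-ι-* (a *ₚ b) c x) (L.*-congʳ (eval-ι-* a b x))

  -- Coprimality concerns divisors in K[z] and says nothing directly about points of L; a Bézout
  -- identity does carry over to them.
  coprime⇒rootless : ∀ {f g} → ¬ (f ≈ₚ 0ₚ × g ≈ₚ 0ₚ) → Coprime f g →
                     ∀ x → eval-ι f x L.≈ L.0# → eval-ι g x L.≉ L.0#
  coprime⇒rootless {f} {g} fg≉0 coprime x f≈0 g≈0 = L.1≉0 (L.trans (L.sym one) zero′)
    where
    combination : ∃ λ u → ∃ λ w → u *ₚ f +ₚ w *ₚ g ≈ₚ 1ₚ
    combination = bézout {f} {g} fg≉0 coprime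

    u w : Poly
    u = proj₁ combination
    w = proj₁ (proj₂ combination)

    one : eval-ι (u *ₚ f +ₚ w *ₚ g) x L.≈ L.1#
    one = L.trans (eval-ι-cong (u *ₚ f +ₚ w *ₚ g) 1ₚ (proj₂ (proj₂ combination)) x) (eval-ι-1 x)

    multiple : ∀ u f → eval-ι f x L.≈ L.0# → eval-ι (u *ₚ f) x L.≈ L.0#
    multiple u f f≈0 = L.trans (eval-ι-* u f x) (L.trans (L.*-congˡ f≈0) (L.zeroʳ (eval-ι u x)))

    zero′ : eval-ι (u *ₚ f +ₚ w *ₚ g) x L.≈ L.0#
    zero′ = L.trans (At.e-+ x (u *ₚ f) (w *ₚ g))
      (L.trans (L.+-cong (multiple u f f≈0) (multiple w g g≈0)) (L.+-identityˡ L.0#))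

-- Points of the projective line as vectors of the plane

module Plane (em : ∀ {a} → ExcludedMiddle a) {c ℓ} (F : Field c ℓ) where
  open Field F hiding (zero)
  open IntegerRingSolver commutativeRing
  open RationalFunctions rawRing
  open FieldProperties em F
  open import Relation.Binary.Reasoning.Setoid setoid

  V : Set c
  V = Carrier × Carrier

  infix 4 _≈ⱽ_
  _≈ⱽ_ : V → V → Set ℓ
  (s , t) ≈ⱽ (s′ , t′) = s ≈ s′ × t ≈ t′

  infixr 7 _⊙_
  _⊙_ : Carrier → V → V
  k ⊙ (s , t) = k * s , k * t

  infix 6 _∧_
  -- The determinant; between nonzero vectors it vanishes exactly when they represent the same
  -- point.
  _∧_ : V → V → Carrier
  (s , t) ∧ (s′ , t′) = s * t′ - t * s′

  NonZero : V → Set ℓ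
  NonZero (s , t) = ¬ (s ≈ 0# × t ≈ 0#)

  ∧-cong : ∀ {u u′ v v′} → u ≈ⱽ u′ → v ≈ⱽ v′ → u ∧ v ≈ u′ ∧ v′
  ∧-cong (a , b) (c , d) = +-cong (*-cong a d) (-‿cong (*-cong b c))

  ∧-congʳ : ∀ {u u′} v → u ≈ⱽ u′ → u ∧ v ≈ u′ ∧ v
  ∧-congʳ {u} {u′} v u≈u′ = ∧-cong {u} {u′} {v} {v} u≈u′ (refl , refl)

  ∧-self : ∀ v → v ∧ v ≈ 0#
  ∧-self (s , t) = solve 2 (λ s t → s :* t :- t :* s := con (+ 0)) refl s t

  ∧-anti : ∀ u v → u ∧ v ≈ - (v ∧ u)
  ∧-anti (a , b) (c , d) = solve 4 (λ a b c d → a :* d :- b :* c := :- (c :* b :- d :* a)) refl a b c d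

  ∧-⊙ʳ : ∀ u k v → u ∧ (k ⊙ v) ≈ k * (u ∧ v)
  ∧-⊙ʳ (a , b) k (c , d) = solve 5 (λ a b k c d → a :* (k :* d) :- b :* (k :* c) := k :* (a :* d :- b :* c))
      refl a b k c d

  ∧-⊙ˡ : ∀ k u v → (k ⊙ u) ∧ v ≈ k * (u ∧ v)
  ∧-⊙ˡ k (a , b) (c , d) = solve 5 (λ a b k c d → (k :* a) :* d :- (k :* b) :* c := k :* (a :* d :- b :* c))
      refl a b k c d

  ∧-sym-≈0 : ∀ u v → u ∧ v ≈ 0# → v ∧ u ≈ 0#
  ∧-sym-≈0 u v uv≈0 = trans (∧-anti v u) (trans (-‿cong uv≈0) (solve 0 (:- con (+ 0) := con (+ 0)) refl))

  ∧≈0⇒multiple : ∀ u v → NonZero u → u ∧ v ≈ 0# → ∃ λ k → v ≈ⱽ k ⊙ u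
  ∧≈0⇒multiple u v u≉0 uv≈0 = parallel u≉0 (x-y≈0⇒x≈y uv≈0)

  ∧-trans : ∀ u v w → NonZero v → u ∧ v ≈ 0# → v ∧ w ≈ 0# → u ∧ w ≈ 0#
  ∧-trans u v w v≉0 uv≈0 vw≈0 with ∧≈0⇒multiple v u v≉0 (∧-sym-≈0 u v uv≈0) | ∧≈0⇒multiple v w v≉0 vw≈0
  ... | k , u≈kv | l , w≈lv = begin
    u ∧ w              ≈⟨ ∧-cong {u} {k ⊙ v} {w} {l ⊙ v} u≈kv w≈lv ⟩
    (k ⊙ v) ∧ (l ⊙ v)  ≈⟨ trans (∧-⊙ˡ k v (l ⊙ v)) (*-congˡ (∧-⊙ʳ v l v)) ⟩
    k * (l * (v ∧ v))  ≈⟨ *-congˡ (*-congˡ (∧-self v)) ⟩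
    k * (l * 0#)       ≈⟨ solve 2 (λ k l → k :* (l :* con (+ 0)) := con (+ 0)) refl k l ⟩
    0#                 ∎

  -- Vanishing at u means that (b , -a) is parallel to u, and α is the factor. This recovers the
  -- rows of h from the points sent to 0 and ∞.
  row : ∀ a b u → NonZero u → a * proj₁ u + b * proj₂ u ≈ 0# → ∃ λ α → ∀ w →
      a * proj₁ w + b * proj₂ w ≈ α * (u ∧ w)
  row a b (p , q) u≉0 e = α , λ (s , t) → begin
    a * s + b * t
        ≈⟨ solve 4 (λ a b s t → a :* s :+ b :* t := (:- (:- a)) :* s :+ b :* t) refl a b s t ⟩
    (- (- a)) * s + b * t
        ≈⟨ +-cong (*-congʳ (-‿cong (proj₂ (proj₂ multiple)))) (*-congʳ (proj₁ (proj₂ multiple))) ⟩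
    (- (α * q)) * s + (α * p) * t
        ≈⟨ solve 5 (λ α p q s t → (:- (α :* q)) :* s :+ (α :* p) :* t := α :* (p :* t :- q :* s))
        refl α p q s t ⟩
    α * (p * t - q * s)                 ∎
    where
    multiple : ∃ λ α → (b , - a) ≈ⱽ α ⊙ (p , q)
    multiple = ∧≈0⇒multiple (p , q) (b , - a) u≉0 (trans
      (solve 4 (λ a b p q → p :* :- a :- q :* b := :- (a :* p :+ b :* q)) refl a b p q)
      (trans (-‿cong e) (solve 0 (:- con (+ 0) := con (+ 0)) refl)))
    α = proj₁ multiple

  coordinates : P¹ → V
  coordinates (fin x) = x , 1#
  coordinates ∞       = 1# , 0#

  coordinates-nonZero : ∀ x → NonZero (coordinates x)
  coordinates-nonZero (fin x) (_ , 1≈0) = 1≉0 1≈0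
  coordinates-nonZero ∞       (1≈0 , _) = 1≉0 1≈0

  private
    ∧-fin : ∀ s t y → (s , t) ∧ coordinates (fin y) ≈ s - y * t
    ∧-fin s t y = solve 3 (λ s t y → s :* con (+ 1) :- t :* y := s :- y :* t) refl s t y

    ∧-∞ : ∀ s t → (s , t) ∧ coordinates ∞ ≈ - t
    ∧-∞ s t = solve 2 (λ s t → s :* con (+ 0) :- t :* con (+ 1) := :- t) refl s t

    -t≈0⇒t≈0 : ∀ {t} → - t ≈ 0# → t ≈ 0#
    -t≈0⇒t≈0 {t} -t≈0 = begin
      t        ≈⟨ solve 1 (λ t → t := :- (:- t)) refl t ⟩
      - (- t)  ≈⟨ -‿cong -t≈0 ⟩
      - 0#     ≈⟨ solve 0 (:- con (+ 0) := con (+ 0)) refl ⟩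
      0#       ∎

  ratio⇒nonZero : ∀ {s t} y → [ s ∶ t ]≈ y → NonZero (s , t)
  ratio⇒nonZero (fin y) (t≉0 , _) (_ , t≈0) = t≉0 t≈0
  ratio⇒nonZero ∞       (s≉0 , _) (s≈0 , _) = s≉0 s≈0

  ratio⇒∧≈0 : ∀ {s t} y → [ s ∶ t ]≈ y → (s , t) ∧ coordinates y ≈ 0#
  ratio⇒∧≈0 {s} {t} (fin y) (_ , s≈yt) = trans (∧-fin s t y) (x≈y⇒x-y≈0 s≈yt)
  ratio⇒∧≈0 {s} {t} ∞       (_ , t≈0)  =
      trans (∧-∞ s t) (trans (-‿cong t≈0) (solve 0 (:- con (+ 0) := con (+ 0)) refl))

  ∧≈0⇒ratio : ∀ {s t} y → NonZero (s , t) → (s , t) ∧ coordinates y ≈ 0# → [ s ∶ t ]≈ y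
  ∧≈0⇒ratio {s} {t} (fin y) st≉0 e =
      (λ t≈0 → st≉0 (trans s≈yt (trans (*-congˡ t≈0) (zeroʳ y)) , t≈0)) , s≈yt
    where
    s≈yt : s ≈ y * t
    s≈yt = x-y≈0⇒x≈y (trans (sym (∧-fin s t y)) e)
  ∧≈0⇒ratio {s} {t} ∞ st≉0 e = (λ s≈0 → st≉0 (s≈0 , t≈0)) , t≈0
    where
    t≈0 : t ≈ 0#
    t≈0 = -t≈0⇒t≈0 (trans (sym (∧-∞ s t)) e)

  point : ∀ v → NonZero v → ∃ λ y → v ∧ coordinates y ≈ 0#
  point (s , t) v≉0 with t ≈? 0#
  ... | yes t≈0 = ∞ , ratio⇒∧≈0 ∞ ((λ s≈0 → v≉0 (s≈0 , t≈0)) , t≈0)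
  ... | no  t≉0 with invertible t≉0
  ...   | t⁻¹ , tt⁻¹≈1 = fin (s * t⁻¹) , ratio⇒∧≈0 (fin (s * t⁻¹)) (t≉0 , sym
    (trans (*-assoc s t⁻¹ t) (trans (*-congˡ (trans (*-comm t⁻¹ t) tt⁻¹≈1)) (*-identityʳ s))))

  ≈ᴾ⇒∧≈0 : ∀ x y → x ≈ᴾ y → coordinates x ∧ coordinates y ≈ 0#
  ≈ᴾ⇒∧≈0 (fin x) (fin y) x≈y = trans (∧-fin x 1# y) (x≈y⇒x-y≈0 (trans x≈y (sym (*-identityʳ y))))
  ≈ᴾ⇒∧≈0 ∞       ∞       _   = ∧-self (coordinates ∞)

  ∧≈0⇒≈ᴾ : ∀ x y → coordinates x ∧ coordinates y ≈ 0# → x ≈ᴾ y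
  ∧≈0⇒≈ᴾ (fin x) (fin y) e = trans (x-y≈0⇒x≈y (trans (sym (∧-fin x 1# y)) e)) (*-identityʳ y)
  ∧≈0⇒≈ᴾ (fin x) ∞       e = ⊥-elim (1≉0 (-t≈0⇒t≈0 (trans (sym (∧-∞ x 1#)) e)))
  ∧≈0⇒≈ᴾ ∞       (fin y) e =
      ⊥-elim (1≉0 (trans (solve 1 (λ y → con (+ 1) := con (+ 1) :- y :* con (+ 0)) refl y)
      (trans (sym (∧-fin 1# 0# y)) e)))
  ∧≈0⇒≈ᴾ ∞       ∞       e = tt

-- Rational functions as pairs of forms without common zeros

module NormalForms (em : ∀ {a} → ExcludedMiddle a) {c ℓ} (F : Field c ℓ)
  (closed : FieldProperties.IsAlgebraicallyClosed em F) where
  open Field F hiding (zero)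
  open IntegerRingSolver commutativeRing
  open RationalFunctions rawRing
  open PolynomialProperties commutativeRing
  open Evaluation commutativeRing
  open FieldProperties em F
  open AlgebraicallyClosed em F closed
  open Plane em F
  open import Relation.Binary.Reasoning.Setoid setoid
  private
    module B = Bézout em F F closed (λ x → x) (Identity.isRingHomomorphism rawRing refl)

  coprime⇒rootless : ∀ {f g} → ¬ (f ≈ₚ 0ₚ × g ≈ₚ 0ₚ) → Coprime f g → ∀ x → eval f x ≈ 0# → eval g x ≉ 0#
  coprime⇒rootless {f} {g} fg≉0 coprime x f≈0 g≈0 =
    B.coprime⇒rootless {f} {g} fg≉0 coprime x (trans (eval-id f) f≈0) (trans (eval-id g) g≈0)
    where
    eval-id : ∀ p → eval (map (λ x → x) p) x ≈ eval p x
    eval-id p = reflexive (≡.cong (λ q → eval q x) (map-id p))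

  -- Away from its zeros the denominator of χ can be cancelled. If it is the zero polynomial, χ is
  -- the constant ∞ and both g and g′ are zero.
  ≐-cross : ∀ {χ f g f′ g′} → χ ≐ f / g → χ ≐ f′ / g′ → f *ₚ g′ ≈ₚ f′ *ₚ g
  ≐-cross {χ} {f} {g} {f′} {g′} (det , _ , Ng≈fD) (_ , _ , Ng′≈f′D) with em {P = den χ ≈ₚ 0ₚ}
  ... | no D≉0 = eval-ext-off (den χ) (f *ₚ g′) (f′ *ₚ g) D≉0 λ x D[x]≉0 → *-cancelˡ-≈ D[x]≉0 (begin
    eval (den χ) x * eval (f *ₚ g′) x               ≈⟨ *-congˡ (eval-* f g′ x) ⟩
    eval (den χ) x * (eval f x * eval g′ x)
      ≈⟨ solve 3 (λ d f g → d :* (f :* g) := (f :* d) :* g) refl (eval (den χ) x) (eval f x) (eval g′ x) ⟩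
    (eval f x * eval (den χ) x) * eval g′ x         ≈⟨ *-congʳ (pointwise x (num χ) g f (den χ) Ng≈fD) ⟨
    (eval (num χ) x * eval g x) * eval g′ x
      ≈⟨ solve 3 (λ n g g′ → (n :* g) :* g′ := g :* (n :* g′)) refl (eval (num χ) x) (eval g x)
          (eval g′ x) ⟩
    eval g x * (eval (num χ) x * eval g′ x)         ≈⟨ *-congˡ (pointwise x (num χ) g′ f′ (den χ) Ng′≈f′D) ⟩
    eval g x * (eval f′ x * eval (den χ) x)
      ≈⟨ solve 3 (λ d f g → g :* (f :* d) := d :* (f :* g)) refl (eval (den χ) x) (eval f′ x) (eval g x) ⟩
    eval (den χ) x * (eval f′ x * eval g x)         ≈⟨ *-congˡ (eval-* f′ g x) ⟨
    eval (den χ) x * eval (f′ *ₚ g) x               ∎)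
    where
    pointwise : ∀ x p q p′ q′ → p *ₚ q ≈ₚ p′ *ₚ q′ → eval p x * eval q x ≈ eval p′ x * eval q′ x
    pointwise x p q p′ q′ e =
        trans (sym (eval-* p q x)) (trans (eval-cong (p *ₚ q) (p′ *ₚ q′) x e) (eval-* p′ q′ x))
  ... | yes D≈0 = eval-ext (f *ₚ g′) (f′ *ₚ g) λ x →
    trans (eval-* f g′ x) (trans (trans (*-congˡ (g≈0 g′ f′ Ng′≈f′D x)) (zeroʳ _))
      (sym (trans (eval-* f′ g x) (trans (*-congˡ (g≈0 g f Ng≈fD x)) (zeroʳ _)))))
    where
    g≈0 : ∀ g f → num χ *ₚ g ≈ₚ f *ₚ den χ → ∀ x → eval g x ≈ 0#
    g≈0 g f e x = eval-zero g x (decidable-stable em (λ g≉0 →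
      *ₚ-≉0 (num χ) g (λ N≈0 → det (N≈0 , D≈0)) g≉0 (λ n → trans (e n)
        (eval-ext (f *ₚ den χ) 0ₚ (λ x → trans (eval-* f (den χ) x)
          (trans (*-congˡ (eval-zero (den χ) x D≈0)) (zeroʳ _))) n))))

  -- With u f′ + w g′ = 1 the factor is e = u f + w g: cross-multiplication turns e f′ into (u f′ +
  -- w g′) f, and likewise for g.
  common-factor : ∀ {f g f′ g′} → ¬ (f′ ≈ₚ 0ₚ × g′ ≈ₚ 0ₚ) → Coprime f′ g′ → f *ₚ g′ ≈ₚ f′ *ₚ g →
                  ∃ λ e → (∀ x → eval f x ≈ eval e x * eval f′ x) × (∀ x → eval g x ≈ eval e x * eval g′ x)
  common-factor {f} {g} {f′} {g′} fg≉0 coprime fg′≈f′g = u *ₚ f +ₚ w *ₚ g , f≈ , g≈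
    where
    combination : ∃ λ u → ∃ λ w → u *ₚ f′ +ₚ w *ₚ g′ ≈ₚ 1ₚ
    combination = B.bézout {f′} {g′} fg≉0 coprime

    u w : Poly
    u = proj₁ combination
    w = proj₁ (proj₂ combination)

    eval-combination : ∀ f g x → eval (u *ₚ f +ₚ w *ₚ g) x ≈ eval u x * eval f x + eval w x * eval g x
    eval-combination f g x = trans (eval-+ (u *ₚ f) (w *ₚ g) x) (+-cong (eval-* u f x) (eval-* w g x))

    one : ∀ x → eval u x * eval f′ x + eval w x * eval g′ x ≈ 1#
    one x = trans (sym (eval-combination f′ g′ x))
      (trans (eval-cong (u *ₚ f′ +ₚ w *ₚ g′) 1ₚ x (proj₂ (proj₂ combination))) (eval-1 x))

    cross : ∀ x → eval f x * eval g′ x ≈ eval f′ x * eval g x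
    cross x = trans (sym (eval-* f g′ x)) (trans (eval-cong (f *ₚ g′) (f′ *ₚ g) x fg′≈f′g) (eval-* f′ g x))

    f≈ : ∀ x → eval f x ≈ eval (u *ₚ f +ₚ w *ₚ g) x * eval f′ x
    f≈ x = begin
      eval f x
        ≈⟨ trans (sym (*-identityʳ _)) (*-congˡ (sym (one x))) ⟩
      eval f x * (eval u x * eval f′ x + eval w x * eval g′ x)
        ≈⟨ solve 5 (λ f u f′ w g′ → f :* (u :* f′ :+ w :* g′) := (u :* f) :* f′ :+ w :* (f :* g′)) refl
             (eval f x) (eval u x) (eval f′ x) (eval w x) (eval g′ x) ⟩
      (eval u x * eval f x) * eval f′ x + eval w x * (eval f x * eval g′ x)
        ≈⟨ +-congˡ (*-congˡ (cross x)) ⟩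
      (eval u x * eval f x) * eval f′ x + eval w x * (eval f′ x * eval g x)
        ≈⟨ solve 5 (λ f u f′ w g → (u :* f) :* f′ :+ w :* (f′ :* g) := (u :* f :+ w :* g) :* f′) refl
             (eval f x) (eval u x) (eval f′ x) (eval w x) (eval g x) ⟩
      (eval u x * eval f x + eval w x * eval g x) * eval f′ x
        ≈⟨ *-congʳ (eval-combination f g x) ⟨
      eval (u *ₚ f +ₚ w *ₚ g) x * eval f′ x ∎

    g≈ : ∀ x → eval g x ≈ eval (u *ₚ f +ₚ w *ₚ g) x * eval g′ x
    g≈ x = begin
      eval g x
        ≈⟨ trans (sym (*-identityʳ _)) (*-congˡ (sym (one x))) ⟩
      eval g x * (eval u x * eval f′ x + eval w x * eval g′ x)
        ≈⟨ solve 5 (λ g u f′ w g′ → g :* (u :* f′ :+ w :* g′) := u :* (f′ :* g) :+ (w :* g) :* g′) refl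
             (eval g x) (eval u x) (eval f′ x) (eval w x) (eval g′ x) ⟩
      eval u x * (eval f′ x * eval g x) + (eval w x * eval g x) * eval g′ x
        ≈⟨ +-congʳ (*-congˡ (cross x)) ⟨
      eval u x * (eval f x * eval g′ x) + (eval w x * eval g x) * eval g′ x
        ≈⟨ solve 5 (λ f u g′ w g → u :* (f :* g′) :+ (w :* g) :* g′ := (u :* f :+ w :* g) :* g′) refl
             (eval f x) (eval u x) (eval g′ x) (eval w x) (eval g x) ⟩
      (eval u x * eval f x + eval w x * eval g x) * eval g′ x
        ≈⟨ *-congʳ (eval-combination f g x) ⟨
      eval (u *ₚ f +ₚ w *ₚ g) x * eval g′ x ∎

  value : Poly → Poly → ℕ → V → V
  value f g d (s , t) = form f d s t , form g d s t

  -- Conjugation homogenises at the formal degree, which trailing zeros and common factors may push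
  -- above d. This ties χ to a pair of forms of the true degree.
  record NormalForm (χ : Fraction) (f g : Poly) (d : ℕ) : Set (c ⊔ ℓ) where
    field
      represents   : χ ≐ f / g
      degree-num   : DegreeAtMost f d
      degree-den   : DegreeAtMost g d
      nonVanishing : NonVanishing f g d

    value-nonZero : ∀ v → NonZero v → NonZero (value f g d v)
    value-nonZero (s , t) v≉0 (F≈0 , G≈0) = v≉0 (nonVanishing s t F≈0 G≈0)

    value-cong : ∀ {v w} → v ≈ⱽ w → value f g d v ≈ⱽ value f g d w
    value-cong (s≈ , t≈) = form-cong f d s≈ t≈ , form-cong g d s≈ t≈

    value-⊙ : ∀ k v → value f g d (k ⊙ v) ≈ⱽ (k ^ d) ⊙ value f g d v
    value-⊙ k (s , t) = form-scale f d k s t degree-num , form-scale g d k s t degree-den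

    coprime : Coprime f g
    coprime {z} = nonVanishing⇒coprime {f} {g} {d} degree-num degree-den nonVanishing {z}

    maxDegree : MaxDegree f g d
    maxDegree = nonVanishing⇒maxDegree {f} {g} {d} degree-num degree-den nonVanishing

    rootless : ∀ x → eval f x ≈ 0# → eval g x ≉ 0#
    rootless = nonVanishing⇒rootless {f} {g} {d} degree-num degree-den nonVanishing

    hasDegree : HasDegree χ d
    hasDegree = f , g , represents , (λ {z} → coprime {z}) , maxDegree

    -- The image may be witnessed by any representation of χ, which cross-multiplication compares
    -- with f / g. At ∞ its degree bound n may differ from d, and the comparison is made between
    -- forms of both degrees.
    image⇒∧≈0 : ∀ x y → χ ⟨ x ⟩≈ y → value f g d (coordinates x) ∧ coordinates y ≈ 0#
    image⇒∧≈0 (fin x) y (f′ , g′ , χ≐ , r) = ∧-trans (value f g d (x , 1#)) (eval f′ x , eval g′ x)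
        (coordinates y)
      (ratio⇒nonZero y r)
      (trans (∧-congʳ {value f g d (x , 1#)} {eval f x , eval g x} (eval f′ x , eval g′ x)
          (form-[x,1] f d x , form-[x,1] g d x))
        (x≈y⇒x-y≈0 (trans (sym (eval-* f g′ x)) (trans (eval-cong (f *ₚ g′) (f′ *ₚ g) x
          (≐-cross {χ} {f} {g} {f′} {g′} represents χ≐)) (trans (eval-* f′ g x) (*-comm _ _))))))
      (ratio⇒∧≈0 y r)
    image⇒∧≈0 ∞ y (f′ , g′ , n , χ≐ , df , dg , r) =
        ∧-trans (value f g d (1# , 0#)) (coeff f′ n , coeff g′ n) (coordinates y)
      (ratio⇒nonZero y r)
      (x≈y⇒x-y≈0 (begin
        form f d 1# 0# * coeff g′ n              ≈⟨ *-congˡ (form-[1,0] g′ n dg) ⟨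
        form f d 1# 0# * form g′ n 1# 0#         ≈⟨ form-cross f g′ f′ g d n degree-num dg df degree-den
                                                      (≐-cross {χ} {f} {g} {f′} {g′} represents χ≐) 1# 0# ⟩
        form f′ n 1# 0# * form g d 1# 0#         ≈⟨ *-comm _ _ ⟩
        form g d 1# 0# * form f′ n 1# 0#         ≈⟨ *-congˡ (form-[1,0] f′ n df) ⟩
        form g d 1# 0# * coeff f′ n              ∎))
      (ratio⇒∧≈0 y r)

    ∧≈0⇒image : ∀ x y → value f g d (coordinates x) ∧ coordinates y ≈ 0# → χ ⟨ x ⟩≈ y
    ∧≈0⇒image (fin x) y e = f , g , represents , ∧≈0⇒ratio y
      (λ (f≈0 , g≈0) → rootless x f≈0 g≈0)
      (trans (∧-congʳ {eval f x , eval g x} {value f g d (x , 1#)} (coordinates y)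
          (sym (form-[x,1] f d x) , sym (form-[x,1] g d x))) e)
    ∧≈0⇒image ∞ y e = f , g , d , represents , degree-num , degree-den , ∧≈0⇒ratio y
      (λ (f≈0 , g≈0) → value-nonZero (1# , 0#) (λ (1≈0 , _) → 1≉0 1≈0)
         (trans (form-[1,0] f d degree-num) f≈0 , trans (form-[1,0] g d degree-den) g≈0))
      (trans (∧-congʳ {coeff f d , coeff g d} {value f g d (1# , 0#)} (coordinates y)
         (sym (form-[1,0] f d degree-num) , sym (form-[1,0] g d degree-den))) e)

    -- A root of the common factor would be a common root of f and g, so the factor is constant.
    proportional : ∀ f′ g′ → χ ≐ f′ / g′ → Coprime f′ g′ → ∃ λ e → e ≉ 0# × f ≈ₚ e ·ₚ f′ × g ≈ₚ e ·ₚ g′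
    proportional f′ g′ χ≐ coprime′ = e₀ , e₀≉0
      , eval-ext f (e₀ ·ₚ f′) (λ x → trans (f≈ x) (trans (*-congʳ (e≈e₀ x)) (sym (eval-· e₀ f′ x))))
      , eval-ext g (e₀ ·ₚ g′) (λ x → trans (g≈ x) (trans (*-congʳ (e≈e₀ x)) (sym (eval-· e₀ g′ x))))
      where
      factor : ∃ λ e → (∀ x → eval f x ≈ eval e x * eval f′ x) × (∀ x → eval g x ≈ eval e x * eval g′ x)
      factor = common-factor {f} {g} {f′} {g′} (proj₁ (proj₂ χ≐)) (λ {z} → coprime′ {z})
        (≐-cross {χ} {f} {g} {f′} {g′} represents χ≐)

      e : Poly
      e = proj₁ factor

      f≈ : ∀ x → eval f x ≈ eval e x * eval f′ x
      f≈ = proj₁ (proj₂ factor)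

      g≈ : ∀ x → eval g x ≈ eval e x * eval g′ x
      g≈ = proj₂ (proj₂ factor)

      constant : ∃ λ e₀ → e₀ ≉ 0# × (∀ x → eval e x ≈ e₀)
      constant = rootless⇒constant e (λ x e≈0 →
        rootless x
          (trans (f≈ x) (trans (*-congʳ e≈0) (zeroˡ (eval f′ x))))
          (trans (g≈ x) (trans (*-congʳ e≈0) (zeroˡ (eval g′ x)))))

      e₀ : Carrier
      e₀ = proj₁ constant

      e₀≉0 : e₀ ≉ 0#
      e₀≉0 = proj₁ (proj₂ constant)

      e≈e₀ : ∀ x → eval e x ≈ e₀
      e≈e₀ = proj₂ (proj₂ constant)

  nonVanishing⇒determinate : ∀ f g d → NonVanishing f g d → Determinate (f / g)
  nonVanishing⇒determinate f g d nv (f≈0 , g≈0) =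
    1≉0 (proj₁ (nv 1# 0# (form-zero f d 1# 0# f≈0) (form-zero g d 1# 0# g≈0)))

  module NonConstant {χ f g n} (nf : NormalForm χ f g (suc n)) where
    open NormalForm nf
    private
      d = suc n

    -- The preimages of (a : b) are the zeros of b f - a g, a form of positive degree.
    surjective : ∀ v → NonZero v → ∃ λ w → NonZero w × value f g d w ∧ v ≈ 0#
    surjective (a , b) v≉0 with form-root (b ·ₚ f +ₚ (- a) ·ₚ g) n
      (degree-+ (b ·ₚ f) ((- a) ·ₚ g) d (degree-· b f d degree-num) (degree-· (- a) g d degree-den))
    ... | s , t , st≉0 , root = (s , t) , st≉0 , (begin
      form f d s t * b - form g d s t * a
        ≈⟨ solve 4 (λ F b G a → F :* b :- G :* a := b :* F :+ (:- a) :* G) refl (form f d s t) b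
            (form g d s t) a ⟩
      b * form f d s t + (- a) * form g d s t
        ≈⟨ trans (form-+ (b ·ₚ f) ((- a) ·ₚ g) d s t) (+-cong (form-· b f d s t) (form-· (- a) g d s t)) ⟨
      form (b ·ₚ f +ₚ (- a) ·ₚ g) d s t
        ≈⟨ root ⟩
      0# ∎)

    den≉0 : ¬ (g ≈ₚ 0ₚ)
    den≉0 g≈0 with form-root f n degree-num
    ... | s , t , st≉0 , F≈0 = st≉0 (nonVanishing s t F≈0 (form-zero g d s t g≈0))

    isRationalFunction : IsRationalFunction χ
    isRationalFunction D≈0 = *ₚ-≉0 (num χ) g (λ N≈0 → proj₁ represents (N≈0 , D≈0)) den≉0
      (λ m → trans (proj₂ (proj₂ represents) m) (eval-ext (f *ₚ den χ) 0ₚ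
        (λ x → trans (eval-* f (den χ) x) (trans (*-congˡ (eval-zero (den χ) x D≈0)) (zeroʳ _))) m))

  represents-self : ∀ {f g} → Determinate (f / g) → f / g ≐ f / g
  represents-self det = det , det , λ _ → refl

  module _ {χ f g d} (nf : NormalForm χ f g d) where
    open NormalForm nf

    -- Coprime representations differ by a nonzero scalar, so their coefficients vanish from the
    -- same index on.
    degree-unique : ∀ {D} → HasDegree χ D → D ≡ d
    degree-unique {D} (f′ , g′ , χ≐ , coprime′ , (df′ , dg′ , top′)) =
      ℕ.≤-antisym (ℕ.≮⇒≥ λ d<D → above d<D top′)
                  (ℕ.≮⇒≥ λ D<d → below D<d (proj₂ (proj₂ maxDegree)))
      where
      factor : ∃ λ e → e ≉ 0# × f ≈ₚ e ·ₚ f′ × g ≈ₚ e ·ₚ g′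
      factor = proportional f′ g′ χ≐ (λ {z} → coprime′ {z})

      e : Carrier
      e = proj₁ factor

      f≈ : ∀ n → coeff f n ≈ e * coeff f′ n
      f≈ n = trans (proj₁ (proj₂ (proj₂ factor)) n) (coeff-· e f′ n)

      g≈ : ∀ n → coeff g n ≈ e * coeff g′ n
      g≈ n = trans (proj₂ (proj₂ (proj₂ factor)) n) (coeff-· e g′ n)

      above : d ℕ.< D → coeff f′ D ≉ 0# ⊎ coeff g′ D ≉ 0# → ⊥
      above d<D (inj₁ f′≉0) =
          f′≉0 (*-cancel-≈0 (proj₁ (proj₂ factor)) (trans (sym (f≈ D)) (degree-num D d<D)))
      above d<D (inj₂ g′≉0) =
          g′≉0 (*-cancel-≈0 (proj₁ (proj₂ factor)) (trans (sym (g≈ D)) (degree-den D d<D)))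

      below : D ℕ.< d → coeff f d ≉ 0# ⊎ coeff g d ≉ 0# → ⊥
      below D<d (inj₁ f≉0) = f≉0 (trans (f≈ d) (trans (*-congˡ (df′ d D<d)) (zeroʳ e)))
      below D<d (inj₂ g≉0) = g≉0 (trans (g≈ d) (trans (*-congˡ (dg′ d D<d)) (zeroʳ e)))

    -- Allows f and g to be replaced by the integral pair of which they are a common multiple.
    rescale : ∀ {f′ g′} r → r ≉ 0# → f ≈ₚ r ·ₚ f′ → g ≈ₚ r ·ₚ g′ → NormalForm χ f′ g′ d
    rescale {f′} {g′} r r≉0 f≈ g≈ = record
      { represents   = proj₁ represents , nonVanishing⇒determinate f′ g′ d nonVanishing′
                     , eval-ext (num χ *ₚ g′) (f′ *ₚ den χ) (λ x → *-cancelˡ-≈ r≉0 (cross x))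
      ; degree-num   = λ m d<m →
          *-cancel-≈0 r≉0 (trans (sym (coeff-· r f′ m)) (trans (sym (f≈ m)) (degree-num m d<m)))
      ; degree-den   = λ m d<m →
          *-cancel-≈0 r≉0 (trans (sym (coeff-· r g′ m)) (trans (sym (g≈ m)) (degree-den m d<m)))
      ; nonVanishing = nonVanishing′
      }
      where
      nonVanishing′ : NonVanishing f′ g′ d
      nonVanishing′ s t F≈0 G≈0 = nonVanishing s t (vanish f f′ f≈ F≈0) (vanish g g′ g≈ G≈0)
        where
        vanish : ∀ f f′ → f ≈ₚ r ·ₚ f′ → form f′ d s t ≈ 0# → form f d s t ≈ 0#
        vanish f f′ f≈ F≈0 = trans (form-congˡ f (r ·ₚ f′) d s t f≈)
            (trans (form-· r f′ d s t) (trans (*-congˡ F≈0) (zeroʳ r)))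

      cross : ∀ x → r * eval (num χ *ₚ g′) x ≈ r * eval (f′ *ₚ den χ) x
      cross x = begin
        r * eval (num χ *ₚ g′) x           ≈⟨ *-congˡ (eval-* (num χ) g′ x) ⟩
        r * (eval (num χ) x * eval g′ x)
            ≈⟨ solve 3 (λ r n g → r :* (n :* g) := n :* (r :* g)) refl r (eval (num χ) x) (eval g′ x) ⟩
        eval (num χ) x * (r * eval g′ x)   ≈⟨ *-congˡ (trans (eval-cong g (r ·ₚ g′) x g≈) (eval-· r g′ x)) ⟨
        eval (num χ) x * eval g x
            ≈⟨ trans (sym (eval-* (num χ) g x))
            (trans (eval-cong (num χ *ₚ g) (f *ₚ den χ) x (proj₂ (proj₂ represents)))
            (eval-* f (den χ) x)) ⟩
        eval f x * eval (den χ) x          ≈⟨ *-congʳ (trans (eval-cong f (r ·ₚ f′) x f≈) (eval-· r f′ x)) ⟩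
        (r * eval f′ x) * eval (den χ) x   ≈⟨ *-assoc r _ _ ⟩
        r * (eval f′ x * eval (den χ) x)   ≈⟨ *-congˡ (eval-* f′ (den χ) x) ⟨
        r * eval (f′ *ₚ den χ) x           ∎

  -- If f and g had a common factor, the degree would drop.
  fullDegree⇒nonVanishing : ∀ {f g d} → HasDegree (f / g) d → DegreeAtMost f d → DegreeAtMost g d →
      NonVanishing f g d
  fullDegree⇒nonVanishing {f} {g} {d} (f′ , g′ , (det , det′ , cross) , coprime′ , md@(df′ , dg′ , top′)) df
      dg s t F≈0 G≈0 =
    nonVanishing′ s t (vanish f f′ f≈ F≈0) (vanish g g′ g≈ G≈0)
    where
    nonVanishing′ : NonVanishing f′ g′ d
    nonVanishing′ = rootless⇒nonVanishing f′ g′ d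
        (coprime⇒rootless {f′} {g′} det′ (λ {z} → coprime′ {z})) md

    factor : ∃ λ e → (∀ x → eval f x ≈ eval e x * eval f′ x) × (∀ x → eval g x ≈ eval e x * eval g′ x)
    factor = common-factor {f} {g} {f′} {g′} det′ (λ {z} → coprime′ {z}) cross

    e : Poly
    e = proj₁ factor

    f≈ : f ≈ₚ e *ₚ f′
    f≈ = eval-ext f (e *ₚ f′) (λ x → trans (proj₁ (proj₂ factor) x) (sym (eval-* e f′ x)))

    g≈ : g ≈ₚ e *ₚ g′
    g≈ = eval-ext g (e *ₚ g′) (λ x → trans (proj₂ (proj₂ factor) x) (sym (eval-* e g′ x)))

    e≉0 : ¬ (e ≈ₚ 0ₚ)
    e≉0 e≈0 = det ((λ n → trans (f≈ n) (*-zeroˡ e f′ e≈0 n)) , (λ n → trans (g≈ n) (*-zeroˡ e g′ e≈0 n)))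

    lead : ∃ λ n → coeff e n ≉ 0# × DegreeAtMost e n
    lead = leading e e≉0

    constant : ∀ m → coeff e m ≉ 0# → DegreeAtMost e m → m ≡ 0
    constant zero    eₘ≉0 de = ≡.refl
    constant (suc m) eₘ≉0 de = ⊥-elim (contra top′)
      where
      -- A factor e of positive degree puts the top term of e q above the degree bound of p, so the
      -- coefficient of q at d must vanish.
      high : ∀ p q → p ≈ₚ e *ₚ q → DegreeAtMost p d → DegreeAtMost q d → coeff q d ≈ 0#
      high p q p≈ dp dq = *-cancel-≈0 eₘ≉0 (trans (sym (coeff-*-top e q (suc m) d de dq))
        (trans (sym (p≈ (suc m ℕ.+ d))) (dp (suc m ℕ.+ d) (s≤s (ℕ.m≤n+m d m)))))

      contra : coeff f′ d ≉ 0# ⊎ coeff g′ d ≉ 0# → ⊥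
      contra (inj₁ f′≉0) = f′≉0 (high f f′ f≈ df df′)
      contra (inj₂ g′≉0) = g′≉0 (high g g′ g≈ dg dg′)

    e-degree : DegreeAtMost e 0
    e-degree = ≡.subst (DegreeAtMost e) (constant (proj₁ lead) (proj₁ (proj₂ lead)) (proj₂ (proj₂ lead)))
        (proj₂ (proj₂ lead))

    e₀≉0 : coeff e 0 ≉ 0#
    e₀≉0 = ≡.subst (λ m → coeff e m ≉ 0#) (constant (proj₁ lead) (proj₁ (proj₂ lead)) (proj₂ (proj₂ lead)))
        (proj₁ (proj₂ lead))

    vanish : ∀ p q → p ≈ₚ e *ₚ q → form p d s t ≈ 0# → form q d s t ≈ 0#
    vanish p q p≈ P≈0 = *-cancel-≈0 e₀≉0 (trans (sym (form-· (coeff e 0) q d s t))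
      (trans (form-congˡ (coeff e 0 ·ₚ q) p d s t (eval-ext (coeff e 0 ·ₚ q) p (λ x → begin
        eval (coeff e 0 ·ₚ q) x      ≈⟨ eval-· (coeff e 0) q x ⟩
        coeff e 0 * eval q x
            ≈⟨ *-congʳ (trans (sym (form-constant e x 1# e-degree)) (form-[x,1] e 0 x)) ⟩
        eval e x * eval q x          ≈⟨ eval-* e q x ⟨
        eval (e *ₚ q) x              ≈⟨ eval-cong p (e *ₚ q) x p≈ ⟨
        eval p x                     ∎))) P≈0))

-- Linear changes of coordinates

module LinearChange (em : ∀ {a} → ExcludedMiddle a) {ℓc ℓ} (F : Field ℓc ℓ)
  (closed : FieldProperties.IsAlgebraicallyClosed em F) where
  open Field F hiding (zero)
  open IntegerRingSolver commutativeRing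
  open RationalFunctions rawRing
  open PolynomialProperties commutativeRing
  open Evaluation commutativeRing
  open FieldProperties em F
  open AlgebraicallyClosed em F closed
  open Plane em F
  open NormalForms em F closed
  open import Relation.Binary.Reasoning.Setoid setoid

  combine : Carrier → Carrier → Poly → Poly → ℕ → Poly → Poly → Poly
  combine a b f g d u v = a ·ₚ homogenise f d u v +ₚ b ·ₚ homogenise g d u v

  private
    linear-zero : ∀ {a b x y} → x ≈ 0# → y ≈ 0# → a * x + b * y ≈ 0#
    linear-zero {a} {b} {x} {y} x≈0 y≈0 = trans (+-cong (*-congˡ x≈0) (*-congˡ y≈0))
      (solve 2 (λ a b → a :* con (+ 0) :+ b :* con (+ 0) := con (+ 0)) refl a b)

    cramer : ∀ {a b c d x y} → a * d - b * c ≉ 0# → a * x + b * y ≈ 0# → c * x + d * y ≈ 0# →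
        x ≈ 0# × y ≈ 0#
    cramer {a} {b} {c} {d} {x} {y} δ≉0 e₁ e₂ =
      *-cancel-≈0 δ≉0 (trans (solve 6 (λ a b c d x y → (a :* d :- b :* c) :* x
          := d :* (a :* x :+ b :* y) :+ (:- b) :* (c :* x :+ d :* y)) refl a b c d x y)
              (linear-zero e₁ e₂)) ,
      *-cancel-≈0 δ≉0 (trans (solve 6 (λ a b c d x y → (a :* d :- b :* c) :* y
          := (:- c) :* (a :* x :+ b :* y) :+ a :* (c :* x :+ d :* y)) refl a b c d x y) (linear-zero e₁ e₂))

  -- χ is the composite of φ with the linear maps (S , T) ↦ (u , v) on the
  -- inside and (a b ; c e) on the outside.
  module Composite {φ f g d} (nf : NormalForm φ f g d)
    (u v : Poly) (du : DegreeAtMost u 1) (dv : DegreeAtMost v 1)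
    (surjective : ∀ s t → ∃ λ s′ → ∃ λ t′ → form u 1 s′ t′ ≈ s × form v 1 s′ t′ ≈ t)
    (injective : ∀ s t → form u 1 s t ≈ 0# → form v 1 s t ≈ 0# → s ≈ 0# × t ≈ 0#)
    (a b c e : Carrier) (δ≉0 : a * e - b * c ≉ 0#)
    (n : ℕ) (dN : DegreeAtMost (num φ) n) (dD : DegreeAtMost (den φ) n)
    (χ : Fraction)
    (χ-num : ∀ z → eval (num χ) z ≈ a * form (num φ) n (eval u z) (eval v z) + b * form (den φ) n
        (eval u z) (eval v z))
    (χ-den : ∀ z → eval (den χ) z ≈ c * form (num φ) n (eval u z) (eval v z) + e * form (den φ) n
        (eval u z) (eval v z))
    where
    open NormalForm nf

    private
      f∘ g∘ : Poly
      f∘ = homogenise f d u v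
      g∘ = homogenise g d u v

      df∘ : DegreeAtMost f∘ d
      df∘ = degree-homogenise f d u v degree-num du dv

      dg∘ : DegreeAtMost g∘ d
      dg∘ = degree-homogenise g d u v degree-den du dv

    form-combine : ∀ a b s t → form (combine a b f g d u v) d s t ≈
      a * form f d (form u 1 s t) (form v 1 s t) + b * form g d (form u 1 s t) (form v 1 s t)
    form-combine a b s t = trans (form-+ (a ·ₚ f∘) (b ·ₚ g∘) d s t) (+-cong
      (trans (form-· a f∘ d s t) (*-congˡ (form-homogenise f d u v degree-num du dv s t)))
      (trans (form-· b g∘ d s t) (*-congˡ (form-homogenise g d u v degree-den du dv s t))))

    private
      eval-combine : ∀ a b z → eval (combine a b f g d u v) z ≈
        a * form f d (eval u z) (eval v z) + b * form g d (eval u z) (eval v z)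
      eval-combine a b z = trans (eval-+ (a ·ₚ f∘) (b ·ₚ g∘) z) (+-cong
        (trans (eval-· a f∘ z) (*-congˡ (eval-homogenise f d u v z)))
        (trans (eval-· b g∘ z) (*-congˡ (eval-homogenise g d u v z))))

      degree-combine : ∀ a b → DegreeAtMost (combine a b f g d u v) d
      degree-combine a b = degree-+ (a ·ₚ f∘) (b ·ₚ g∘) d (degree-· a f∘ d df∘) (degree-· b g∘ d dg∘)

      nonVanishing∘ : NonVanishing (combine a b f g d u v) (combine c e f g d u v) d
      nonVanishing∘ s t e₁ e₂ = injective s t (proj₁ uv≈0) (proj₂ uv≈0)
        where
        FG≈0 = cramer δ≉0 (trans (sym (form-combine a b s t)) e₁) (trans (sym (form-combine c e s t)) e₂)
        uv≈0 = nonVanishing (form u 1 s t) (form v 1 s t) (proj₁ FG≈0) (proj₂ FG≈0)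

      -- Since (u , v) reaches every vector, a form that vanishes after the substitution is itself
      -- zero.
      inner-zero : ∀ p → DegreeAtMost p n → (∀ z → form p n (eval u z) (eval v z) ≈ 0#) → p ≈ₚ 0ₚ
      inner-zero p dp p∘≈0 = eval-ext p 0ₚ λ x →
        let s , t , us≈ , vt≈ = surjective x 1# in begin
        eval p x                                ≈⟨ form-[x,1] p n x ⟨
        form p n x 1#                           ≈⟨ form-cong p n us≈ vt≈ ⟨
        form p n (form u 1 s t) (form v 1 s t)  ≈⟨ form-homogenise p n u v dp du dv s t ⟨
        form (homogenise p n u v) n s t         ≈⟨ form-zero (homogenise p n u v) n s t
          (eval≈0⇒≈ₚ0 (homogenise p n u v) (λ z → trans (eval-homogenise p n u v z) (p∘≈0 z))) ⟩
        0#                                      ∎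

      determinate : Determinate χ
      determinate (N≈0 , D≈0) = proj₁ represents
        (inner-zero (num φ) dN (λ z → proj₁ (zeros z)) , inner-zero (den φ) dD (λ z → proj₂ (zeros z)))
        where
        zeros : ∀ z → form (num φ) n (eval u z) (eval v z) ≈ 0# × form (den φ) n (eval u z) (eval v z) ≈ 0#
        zeros z = cramer δ≉0 (trans (sym (χ-num z)) (eval-zero (num χ) z N≈0))
                             (trans (sym (χ-den z)) (eval-zero (den χ) z D≈0))

      cross : ∀ z → eval (num χ) z * eval (combine c e f g d u v) z ≈ eval (combine a b f g d u v) z *
          eval (den χ) z
      cross z = begin
        eval (num χ) z * eval (combine c e f g d u v) z
          ≈⟨ *-cong (χ-num z) (eval-combine c e z) ⟩
        (a * N + b * D) * (c * F′ + e * G)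
          -- The two cross products differ by the determinant times N G - F D, which vanishes
          -- because f / g represents φ.
          ≈⟨ solve 8 (λ a b c e N D F G → (a :* N :+ b :* D) :* (c :* F :+ e :* G)
                := (a :* F :+ b :* G) :* (c :* N :+ e :* D) :+ (a :* e :- b :* c) :* (N :* G :- F :* D))
                refl a b c e N D F′ G ⟩
        (a * F′ + b * G) * (c * N + e * D) + (a * e - b * c) * (N * G - F′ * D)
          ≈⟨ trans (+-congˡ (trans (*-congˡ (x≈y⇒x-y≈0 NG≈FD)) (zeroʳ _))) (+-identityʳ _) ⟩
        (a * F′ + b * G) * (c * N + e * D)
          ≈⟨ *-cong (eval-combine a b z) (χ-den z) ⟨
        eval (combine a b f g d u v) z * eval (den χ) z ∎
        where
        N D F′ G : Carrier
        N  = form (num φ) n (eval u z) (eval v z)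
        D  = form (den φ) n (eval u z) (eval v z)
        F′ = form f d (eval u z) (eval v z)
        G  = form g d (eval u z) (eval v z)
        NG≈FD : N * G ≈ F′ * D
        NG≈FD = form-cross (num φ) g f (den φ) n d dN degree-den degree-num dD (proj₂ (proj₂ represents))
            (eval u z) (eval v z)

    normalForm : NormalForm χ (combine a b f g d u v) (combine c e f g d u v) d
    normalForm = record
      { represents   = determinate
                     , nonVanishing⇒determinate (combine a b f g d u v) (combine c e f g d u v) d
                         nonVanishing∘
                     , eval-ext (num χ *ₚ combine c e f g d u v) (combine a b f g d u v *ₚ den χ)
                         (λ z → trans (eval-* (num χ) (combine c e f g d u v) z)
                           (trans (cross z) (sym (eval-* (combine a b f g d u v) (den χ) z))))
      ; degree-num   = degree-combine a b
      ; degree-den   = degree-combine c e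
      ; nonVanishing = nonVanishing∘
      }

  -- The exponent at which composition of fractions homogenises.
  formal-degree : Fraction → ℕ
  formal-degree (f / g) = (length f ℕ.⊔ length g) ∸ 1

  degree-formal-num : ∀ φ → DegreeAtMost (num φ) (formal-degree φ)
  degree-formal-num (f / g) = degree-weaken f (ℕ.∸-monoˡ-≤ 1 (ℕ.m≤m⊔n (length f) (length g)))
      (degree-length f)

  degree-formal-den : ∀ φ → DegreeAtMost (den φ) (formal-degree φ)
  degree-formal-den (f / g) = degree-weaken g (ℕ.∸-monoˡ-≤ 1 (ℕ.m≤n⊔m (length f) (length g)))
      (degree-length g)

  -- The adjugate replaces the inverse matrix up to the factor `δ h`, so no division occurs;
  -- homogeneity turns that factor into a power.
  apply adjugate : PGL₂ → V → V
  apply h (s , t) = a * s + b * t , c * s + d * t  where open PGL₂ h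
  adjugate h (s , t) = d * s + (- b) * t , (- c) * s + a * t  where open PGL₂ h

  δ : PGL₂ → Carrier
  δ h = a * d - b * c  where open PGL₂ h

  apply-cong : ∀ h {v w} → v ≈ⱽ w → apply h v ≈ⱽ apply h w
  apply-cong h (s≈ , t≈) = +-cong (*-congˡ s≈) (*-congˡ t≈) , +-cong (*-congˡ s≈) (*-congˡ t≈)

  adjugate-apply : ∀ h v → adjugate h (apply h v) ≈ⱽ δ h ⊙ v
  adjugate-apply h (s , t) =
    solve 6 (λ a b c d s t → d :* (a :* s :+ b :* t) :+ (:- b) :* (c :* s :+ d :* t) :=
        (a :* d :- b :* c) :* s) refl a b c d s t ,
    solve 6 (λ a b c d s t → (:- c) :* (a :* s :+ b :* t) :+ a :* (c :* s :+ d :* t) :=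
        (a :* d :- b :* c) :* t) refl a b c d s t
    where open PGL₂ h

  apply-adjugate : ∀ h v → apply h (adjugate h v) ≈ⱽ δ h ⊙ v
  apply-adjugate h (s , t) =
    solve 6 (λ a b c d s t → a :* (d :* s :+ (:- b) :* t) :+ b :* ((:- c) :* s :+ a :* t) :=
        (a :* d :- b :* c) :* s) refl a b c d s t ,
    solve 6 (λ a b c d s t → c :* (d :* s :+ (:- b) :* t) :+ d :* ((:- c) :* s :+ a :* t) :=
        (a :* d :- b :* c) :* t) refl a b c d s t
    where open PGL₂ h

  apply-⊙ : ∀ h k v → apply h (k ⊙ v) ≈ⱽ k ⊙ apply h v
  apply-⊙ h k (s , t) =
    solve 5 (λ a b k s t → a :* (k :* s) :+ b :* (k :* t) := k :* (a :* s :+ b :* t)) refl a b k s t ,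
    solve 5 (λ a b k s t → a :* (k :* s) :+ b :* (k :* t) := k :* (a :* s :+ b :* t)) refl c d k s t
    where open PGL₂ h

  apply-∧ : ∀ h v w → apply h v ∧ apply h w ≈ δ h * (v ∧ w)
  apply-∧ h (s , t) (s′ , t′) =
    solve 8 (λ a b c d s t s′ t′ → (a :* s :+ b :* t) :* (c :* s′ :+ d :* t′) :- (c :* s :+ d :* t) :*
        (a :* s′ :+ b :* t′)
      := (a :* d :- b :* c) :* (s :* t′ :- t :* s′)) refl a b c d s t s′ t′
    where open PGL₂ h

  apply-∧-adjugate : ∀ h v w → apply h v ∧ w ≈ v ∧ adjugate h w
  apply-∧-adjugate h (s , t) (s′ , t′) =
    solve 8 (λ a b c d s t s′ t′ → (a :* s :+ b :* t) :* t′ :- (c :* s :+ d :* t) :* s′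
      := s :* ((:- c) :* s′ :+ a :* t′) :- t :* (d :* s′ :+ (:- b) :* t′)) refl a b c d s t s′ t′
    where open PGL₂ h

  apply-nonZero : ∀ h v → NonZero v → NonZero (apply h v)
  apply-nonZero h (s , t) v≉0 (e₁ , e₂) = v≉0 (cramer det≉0 e₁ e₂)
    where open PGL₂ h

  module _ (h : PGL₂) where
    open PGL₂ h

    inner-num inner-den : Poly
    inner-num = (- b) ∷ d ∷ []
    inner-den = a ∷ (- c) ∷ []

    degree-inner-num : DegreeAtMost inner-num 1
    degree-inner-num (suc (suc _)) _ = refl
    degree-inner-num (suc zero) (s≤s ())

    degree-inner-den : DegreeAtMost inner-den 1
    degree-inner-den (suc (suc _)) _ = refl
    degree-inner-den (suc zero) (s≤s ())

    form-inner : ∀ s t → (form inner-num 1 s t , form inner-den 1 s t) ≈ⱽ adjugate h (s , t)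
    form-inner s t =
      solve 4 (λ b d s t → (:- b) :* (t :* con (+ 1)) :+ s :* (d :* con (+ 1) :+ s :* con (+ 0)) := d :* s
          :+ (:- b) :* t) refl b d s t ,
      solve 4 (λ a c s t → a :* (t :* con (+ 1)) :+ s :* ((:- c) :* con (+ 1) :+ s :* con (+ 0)) :=
          (:- c) :* s :+ a :* t) refl a c s t

    conjugate-num conjugate-den : Poly → Poly → ℕ → Poly
    conjugate-num f g n = combine a b f g n inner-num inner-den
    conjugate-den f g n = combine c d f g n inner-num inner-den

    private
      inner-surjective : ∀ s t → ∃ λ s′ → ∃ λ t′ → form inner-num 1 s′ t′ ≈ s × form inner-den 1 s′ t′ ≈ t
      inner-surjective s t = proj₁ w , proj₂ w
        , trans (proj₁ (form-inner (proj₁ w) (proj₂ w))) (trans (proj₁ (adjugate-apply h v′)) (δδ⁻¹ s))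
        , trans (proj₂ (form-inner (proj₁ w) (proj₂ w))) (trans (proj₂ (adjugate-apply h v′)) (δδ⁻¹ t))
        where
        δ⁻¹ = proj₁ (invertible det≉0)
        v′ w : V
        v′ = δ⁻¹ ⊙ (s , t)
        w  = apply h v′
        δδ⁻¹ : ∀ x → δ h * (δ⁻¹ * x) ≈ x
        δδ⁻¹ x = trans (sym (*-assoc (δ h) δ⁻¹ x))
            (trans (*-congʳ (proj₂ (invertible det≉0))) (*-identityˡ x))

      inner-injective : ∀ s t → form inner-num 1 s t ≈ 0# → form inner-den 1 s t ≈ 0# → s ≈ 0# × t ≈ 0#
      inner-injective s t e₁ e₂ =
        *-cancel-≈0 det≉0 (trans (sym (proj₁ (apply-adjugate h (s , t)))) (linear-zero
          (trans (sym (proj₁ (form-inner s t))) e₁) (trans (sym (proj₂ (form-inner s t))) e₂))) ,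
        *-cancel-≈0 det≉0 (trans (sym (proj₂ (apply-adjugate h (s , t)))) (linear-zero
          (trans (sym (proj₁ (form-inner s t))) e₁) (trans (sym (proj₂ (form-inner s t))) e₂)))

    module Conjugate {φ f g n} (nf : NormalForm φ f g n) where
      private
        m : ℕ
        m = formal-degree φ

        N∘ D∘ : Poly
        N∘ = homogenise (num φ) m inner-num inner-den
        D∘ = homogenise (den φ) m inner-num inner-den

        -- Numerator and denominator of the outer map are both lists of length 2, hence homogenised
        -- at degree 1, and one computation serves both rows.
        outer : ∀ a b z → eval (homogenise (b ∷ a ∷ []) 1 N∘ D∘) z ≈
          a * form (num φ) m (eval inner-num z) (eval inner-den z) + b * form (den φ) m (eval inner-num z)
              (eval inner-den z)
        outer a b z = begin
          eval (homogenise (b ∷ a ∷ []) 1 N∘ D∘) z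
            ≈⟨ eval-homogenise (b ∷ a ∷ []) 1 N∘ D∘ z ⟩
          b * (eval D∘ z * 1#) + eval N∘ z * (a * 1# + eval N∘ z * 0#)
            ≈⟨ solve 4 (λ a b N D → b :* (D :* con (+ 1)) :+ N :* (a :* con (+ 1) :+ N :* con (+ 0)) := a
                :* N :+ b :* D)
                 refl a b (eval N∘ z) (eval D∘ z) ⟩
          a * eval N∘ z + b * eval D∘ z
            ≈⟨ +-cong (*-congˡ (eval-homogenise (num φ) m inner-num inner-den z))
                      (*-congˡ (eval-homogenise (den φ) m inner-num inner-den z)) ⟩
          a * form (num φ) m (eval inner-num z) (eval inner-den z) + b * form (den φ) m (eval inner-num z)
              (eval inner-den z) ∎

        module C = Composite nf inner-num inner-den degree-inner-num degree-inner-den inner-surjective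
            inner-injective
          a b c d det≉0 m (degree-formal-num φ) (degree-formal-den φ) (conjugate h φ)
              (outer a b) (outer c d)

      normalForm : NormalForm (conjugate h φ) (conjugate-num f g n) (conjugate-den f g n) n
      normalForm = C.normalForm

      value-conjugate : ∀ v → value (conjugate-num f g n) (conjugate-den f g n) n v ≈ⱽ apply h
          (value f g n (adjugate h v))
      value-conjugate (s , t) = trans (C.form-combine a b s t) (linear a b) , trans
          (C.form-combine c d s t) (linear c d)
        where
        w : V
        w = adjugate h (s , t)
        linear : ∀ a b → a * form f n (form inner-num 1 s t) (form inner-den 1 s t) + b * form g n
            (form inner-num 1 s t) (form inner-den 1 s t)
          ≈ a * form f n (proj₁ w) (proj₂ w) + b * form g n (proj₁ w) (proj₂ w)
        linear a b = +-cong (*-congˡ (form-cong f n (proj₁ (form-inner s t)) (proj₂ (form-inner s t))))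
                            (*-congˡ (form-cong g n (proj₁ (form-inner s t)) (proj₂ (form-inner s t))))

  swap : V → V
  swap (s , t) = t , s

  degree-1ₚ : DegreeAtMost 1ₚ 1
  degree-1ₚ (suc _) _ = refl

  degree-X : DegreeAtMost X 1
  degree-X (suc (suc _)) _ = refl
  degree-X (suc zero) (s≤s ())

  form-1ₚ : ∀ s t → form 1ₚ 1 s t ≈ t
  form-1ₚ s t = solve 2 (λ s t → con (+ 1) :* (t :* con (+ 1)) :+ s :* con (+ 0) := t) refl s t

  form-X : ∀ s t → form X 1 s t ≈ s
  form-X s t = solve 2 (λ s t → con (+ 0) :* (t :* con (+ 1)) :+ s :*
      (con (+ 1) :* con (+ 1) :+ s :* con (+ 0)) := s) refl s t

  form-reverse : ∀ p n → DegreeAtMost p n → ∀ s t → form (homogenise p n 1ₚ X) n s t ≈ form p n t s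
  form-reverse p n dp s t = trans (form-homogenise p n 1ₚ X dp degree-1ₚ degree-X s t)
    (form-cong p n (form-1ₚ s t) (form-X s t))

  -- The inversion z ↦ 1/z swaps the coordinates, so the behaviour at ∞ is the instance of
  -- `Composite` with the swap on both sides.
  module AtInfinity {φ f g n} (nf : NormalForm φ f g n) where
    private
      m : ℕ
      m = formal-degree φ

      outer-num : ∀ z → eval (num (atInfinity φ)) z ≈ 0# * form (num φ) m (eval 1ₚ z) (eval X z) + 1# * form
          (den φ) m (eval 1ₚ z) (eval X z)
      outer-num z = trans (eval-homogenise (den φ) m 1ₚ X z)
        (solve 2 (λ N D → D := con (+ 0) :* N :+ con (+ 1) :* D) refl
            (form (num φ) m (eval 1ₚ z) (eval X z)) (form (den φ) m (eval 1ₚ z) (eval X z)))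

      outer-den : ∀ z → eval (den (atInfinity φ)) z ≈ 1# * form (num φ) m (eval 1ₚ z) (eval X z) + 0# * form
          (den φ) m (eval 1ₚ z) (eval X z)
      outer-den z = trans (eval-homogenise (num φ) m 1ₚ X z)
        (solve 2 (λ N D → N := con (+ 1) :* N :+ con (+ 0) :* D) refl
            (form (num φ) m (eval 1ₚ z) (eval X z)) (form (den φ) m (eval 1ₚ z) (eval X z)))

      det≉0 : 0# * 0# - 1# * 1# ≉ 0#
      det≉0 e = 1≉0 (begin
        1#
            ≈⟨ solve 0 (con (+ 1) := :- (con (+ 0) :* con (+ 0) :- con (+ 1) :* con (+ 1))) refl ⟩
        - (0# * 0# - 1# * 1#)   ≈⟨ -‿cong e ⟩
        - 0#                    ≈⟨ solve 0 (:- con (+ 0) := con (+ 0)) refl ⟩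
        0#                      ∎)

      module C = Composite nf 1ₚ X degree-1ₚ degree-X (λ s t → t , s , form-1ₚ t s , form-X t s)
        (λ s t e₁ e₂ → trans (sym (form-X s t)) e₂ , trans (sym (form-1ₚ s t)) e₁)
        0# 1# 1# 0# det≉0 m (degree-formal-num φ) (degree-formal-den φ) (atInfinity φ) outer-num outer-den

    infinity-num infinity-den : Poly
    infinity-num = combine 0# 1# f g n 1ₚ X
    infinity-den = combine 1# 0# f g n 1ₚ X

    normalForm : NormalForm (atInfinity φ) infinity-num infinity-den n
    normalForm = C.normalForm

    value-infinity : ∀ v → value infinity-num infinity-den n v ≈ⱽ swap (value f g n (swap v))
    value-infinity (s , t) =
      trans (C.form-combine 0# 1# s t)
          (trans (solve 2 (λ N D → con (+ 0) :* N :+ con (+ 1) :* D := D) refl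
          (form f n (form 1ₚ 1 s t) (form X 1 s t)) (form g n (form 1ₚ 1 s t) (form X 1 s t)))
        (form-cong g n (form-1ₚ s t) (form-X s t))) ,
      trans (C.form-combine 1# 0# s t)
          (trans (solve 2 (λ N D → con (+ 1) :* N :+ con (+ 0) :* D := N) refl
          (form f n (form 1ₚ 1 s t) (form X 1 s t)) (form g n (form 1ₚ 1 s t) (form X 1 s t)))
        (form-cong f n (form-1ₚ s t) (form-X s t)))

-- Multipliers of fixed points

module Multipliers (em : ∀ {a} → ExcludedMiddle a) {ℓc ℓ} (F : Field ℓc ℓ)
  (closed : FieldProperties.IsAlgebraicallyClosed em F) where
  open Field F hiding (zero)
  open IntegerRingSolver commutativeRing
  open RationalFunctions rawRing
  open PolynomialProperties commutativeRing
  open Evaluation commutativeRing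
  open FieldProperties em F
  open AlgebraicallyClosed em F closed
  open Plane em F
  open NormalForms em F closed
  open LinearChange em F closed
  open import Relation.Binary.Reasoning.Setoid setoid

  formⱽ : Poly → ℕ → V → Carrier
  formⱽ p n v = form p n (proj₁ v) (proj₂ v)

  -- If Φ(v) = μ v, then v ∧ Φ(w) is divisible by v ∧ w, and the value at v of
  -- the quotient is μ times the multiplier of v.
  record Multiplier (f g : Poly) (n : ℕ) (v : V) (λ₀ : Carrier) : Set (ℓc ⊔ ℓ) where
    field
      μ               : Carrier
      eigen           : value f g (suc n) v ≈ⱽ μ ⊙ v
      cofactor        : Poly
      degree-cofactor : DegreeAtMost cofactor n
      factor          : ∀ w → v ∧ value f g (suc n) w ≈ (v ∧ w) * formⱽ cofactor n w
      cofactor-self   : formⱽ cofactor n v ≈ λ₀ * μ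

  module _ {χ f g n} (nf : NormalForm χ f g (suc n)) where
    open NormalForm nf

    eigenvalue≉0 : ∀ v μ → NonZero v → value f g (suc n) v ≈ⱽ μ ⊙ v → μ ≉ 0#
    eigenvalue≉0 v μ v≉0 (e₁ , e₂) μ≈0 = value-nonZero v v≉0
      (trans e₁ (trans (*-congʳ μ≈0) (zeroˡ _)) , trans e₂ (trans (*-congʳ μ≈0) (zeroˡ _)))

    -- Permits passing to a representative of norm 1. Both μ and the value of the cofactor change by
    -- kⁿ, so the multiplier stays.
    scale-multiplier : ∀ {v λ₀} k → Multiplier f g n v λ₀ → Multiplier f g n (k ⊙ v) λ₀
    scale-multiplier {v} {λ₀} k m = record
      { μ               = (k ^ n) * μ
      ; eigen           = scaled proj₁ (proj₁ (value-⊙ k v)) (proj₁ eigen)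
                        , scaled proj₂ (proj₂ (value-⊙ k v)) (proj₂ eigen)
      ; cofactor        = cofactor
      ; degree-cofactor = degree-cofactor
      ; factor          = λ w → begin
          (k ⊙ v) ∧ value f g (suc n) w        ≈⟨ ∧-⊙ˡ k v (value f g (suc n) w) ⟩
          k * (v ∧ value f g (suc n) w)        ≈⟨ *-congˡ (factor w) ⟩
          k * ((v ∧ w) * formⱽ cofactor n w)   ≈⟨ *-assoc _ _ _ ⟨
          (k * (v ∧ w)) * formⱽ cofactor n w   ≈⟨ *-congʳ (∧-⊙ˡ k v w) ⟨
          ((k ⊙ v) ∧ w) * formⱽ cofactor n w   ∎
      ; cofactor-self   = begin
          formⱽ cofactor n (k ⊙ v)
              ≈⟨ form-scale cofactor n k (proj₁ v) (proj₂ v) degree-cofactor ⟩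
          (k ^ n) * formⱽ cofactor n v         ≈⟨ *-congˡ cofactor-self ⟩
          (k ^ n) * (λ₀ * μ)
              ≈⟨ solve 3 (λ k l m → k :* (l :* m) := l :* (k :* m)) refl (k ^ n) λ₀ μ ⟩
          λ₀ * ((k ^ n) * μ)                   ∎
      }
      where
      open Multiplier m
      scaled : (π : V → Carrier) → ∀ {x y} → x ≈ (k ^ suc n) * y → y ≈ μ * π v →
          x ≈ ((k ^ n) * μ) * (k * π v)
      scaled π x≈ y≈ = trans x≈ (trans (*-congˡ y≈)
        (solve 4 (λ k kⁿ μ p → (k :* kⁿ) :* (μ :* p) := (kⁿ :* μ) :* (k :* p)) refl k (k ^ n) μ (π v)))

    -- The multiplier is invariant under conjugation: h multiplies `_∧_` by its determinant δ, and
    -- hv ∧ w = v ∧ adj(h) w. The cofactor becomes δ times its composite with the adjugate, and the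
    -- powers of δ in its value and in μ agree.
    conjugate-multiplier : ∀ {v λ₀} h → Multiplier f g n v λ₀ →
      Multiplier (conjugate-num h f g (suc n)) (conjugate-den h f g (suc n)) n (apply h v) λ₀
    conjugate-multiplier {v} {λ₀} h m = record
      { μ               = (δ h ^ suc n) * μ
      ; eigen           = trans (proj₁ (value-conjugate (apply h v))) (proj₁ eigen′)
                        , trans (proj₂ (value-conjugate (apply h v))) (proj₂ eigen′)
      ; cofactor        = K
      ; degree-cofactor = degree-· (δ h) (homogenise cofactor n (inner-num h) (inner-den h)) n
          (degree-homogenise cofactor n (inner-num h) (inner-den h) degree-cofactor (degree-inner-num h)
              (degree-inner-den h))
      ; factor          = λ w → begin
          apply h v ∧ value Ψ₁ Ψ₂ (suc n) w
            ≈⟨ ∧-cong {apply h v} {apply h v} {value Ψ₁ Ψ₂ (suc n) w} {apply h (Φ (adjugate h w))}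
                (refl , refl) (value-conjugate w) ⟩
          apply h v ∧ apply h (Φ (adjugate h w))
            ≈⟨ apply-∧ h v (Φ (adjugate h w)) ⟩
          δ h * (v ∧ Φ (adjugate h w))
            ≈⟨ *-congˡ (factor (adjugate h w)) ⟩
          δ h * ((v ∧ adjugate h w) * formⱽ cofactor n (adjugate h w))
            ≈⟨ solve 3 (λ d a b → d :* (a :* b) := a :* (d :* b)) refl (δ h) (v ∧ adjugate h w)
                (formⱽ cofactor n (adjugate h w)) ⟩
          (v ∧ adjugate h w) * (δ h * formⱽ cofactor n (adjugate h w))
            ≈⟨ *-cong (apply-∧-adjugate h v w) (form-K w) ⟨
          (apply h v ∧ w) * formⱽ K n w ∎
      ; cofactor-self   = begin
          formⱽ K n (apply h v)
            ≈⟨ form-K (apply h v) ⟩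
          δ h * formⱽ cofactor n (adjugate h (apply h v))
            ≈⟨ *-congˡ (form-cong cofactor n (proj₁ (adjugate-apply h v)) (proj₂ (adjugate-apply h v))) ⟩
          δ h * formⱽ cofactor n (δ h ⊙ v)
            ≈⟨ *-congˡ (form-scale cofactor n (δ h) (proj₁ v) (proj₂ v) degree-cofactor) ⟩
          δ h * ((δ h ^ n) * formⱽ cofactor n v)
            ≈⟨ *-congˡ (*-congˡ cofactor-self) ⟩
          δ h * ((δ h ^ n) * (λ₀ * μ))
            ≈⟨ solve 4 (λ d dⁿ l m → d :* (dⁿ :* (l :* m)) := l :* ((d :* dⁿ) :* m)) refl (δ h)
                (δ h ^ n) λ₀ μ ⟩
          λ₀ * ((δ h ^ suc n) * μ) ∎
      }
      where
      open Multiplier m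
      open Conjugate h nf using (value-conjugate)
      Φ : V → V
      Φ = value f g (suc n)

      Ψ₁ Ψ₂ K : Poly
      Ψ₁ = conjugate-num h f g (suc n)
      Ψ₂ = conjugate-den h f g (suc n)
      K  = δ h ·ₚ homogenise cofactor n (inner-num h) (inner-den h)

      form-K : ∀ w → formⱽ K n w ≈ δ h * formⱽ cofactor n (adjugate h w)
      form-K (s , t) = trans
          (form-· (δ h) (homogenise cofactor n (inner-num h) (inner-den h)) n s t) (*-congˡ
        (trans (form-homogenise cofactor n (inner-num h) (inner-den h) degree-cofactor (degree-inner-num h)
            (degree-inner-den h) s t)
          (form-cong cofactor n (proj₁ (form-inner h s t)) (proj₂ (form-inner h s t)))))

      Φ-eigen : Φ (adjugate h (apply h v)) ≈ⱽ ((δ h ^ suc n) * μ) ⊙ v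
      Φ-eigen = chain proj₁ (proj₁ (value-cong (adjugate-apply h v))) (proj₁ (value-⊙ (δ h) v))
          (proj₁ eigen)
              , chain proj₂ (proj₂ (value-cong (adjugate-apply h v))) (proj₂ (value-⊙ (δ h) v))
                  (proj₂ eigen)
        where
        chain : (π : V → Carrier) → ∀ {x y z} → x ≈ y → y ≈ (δ h ^ suc n) * z → z ≈ μ * π v →
            x ≈ ((δ h ^ suc n) * μ) * π v
        chain π x≈y y≈ z≈ = trans x≈y (trans y≈ (trans (*-congˡ z≈) (sym (*-assoc _ _ _))))

      eigen′ : apply h (Φ (adjugate h (apply h v))) ≈ⱽ ((δ h ^ suc n) * μ) ⊙ apply h v
      eigen′ = trans (proj₁ (apply-cong h Φ-eigen)) (proj₁ (apply-⊙ h ((δ h ^ suc n) * μ) v))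
             , trans (proj₂ (apply-cong h Φ-eigen)) (proj₂ (apply-⊙ h ((δ h ^ suc n) * μ) v))

  module AtFinitePoint {χ f g n} (nf : NormalForm χ f g (suc n)) (x : Carrier) (fixed : eval f x ≈ x * eval g x) where
    open NormalForm nf
    private
      d : ℕ
      d = suc n

      K : Poly
      K = f +ₚ (- x) ·ₚ g

      dK : DegreeAtMost K d
      dK = degree-+ f ((- x) ·ₚ g) d degree-num (degree-· (- x) g d degree-den)

      eval-K : ∀ z → eval K z ≈ eval f z - x * eval g z
      eval-K z = trans (eval-+ f ((- x) ·ₚ g) z) (+-congˡ (trans (eval-· (- x) g z)
        (solve 2 (λ x g → (:- x) :* g := :- (x :* g)) refl x (eval g z))))

      K[x]≈0 : eval K x ≈ 0#
      K[x]≈0 = trans (eval-K x) (x≈y⇒x-y≈0 fixed)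

      f[x] f′[x] g[x] g′[x] : Carrier
      f[x]  = eval f x
      f′[x] = eval (derivative f) x
      g[x]  = eval g x
      g′[x] = eval (derivative g) x

      g[x]≉0 : g[x] ≉ 0#
      g[x]≉0 g≈0 = rootless x
        (trans fixed (trans (*-congˡ g≈0) (zeroʳ x))) g≈0

      g≉0 : ¬ (g ≈ₚ 0ₚ)
      g≉0 e = g[x]≉0 (eval-zero g x e)

      D≉0 : ¬ (den χ ≈ₚ 0ₚ)
      D≉0 = NonConstant.isRationalFunction nf

      pointwise : ∀ z → eval (num χ) z * eval g z ≈ eval f z * eval (den χ) z
      pointwise z = trans (sym (eval-* (num χ) g z))
          (trans (eval-cong (num χ *ₚ g) (f *ₚ den χ) z (proj₂ (proj₂ represents))) (eval-* f (den χ) z))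

    -- At a fixed point f(x) = x g(x), and the quotient rule reduces to φ′(x) = (f′(x) - x g′(x)) /
    -- g(x). The numerator is the derivative of f - x g at its zero x, read off from the quotient by
    -- z - x.
    slope : Carrier
    slope = eval (quotient K x) x

    slope≈ : slope ≈ f′[x] - x * g′[x]
    slope≈ = begin
      slope                                                     ≈⟨ eval-quotient-self K x ⟩
      eval (derivative K) x                                     ≈⟨ eval-derivative-+ f ((- x) ·ₚ g) x ⟩
      f′[x] + eval (derivative ((- x) ·ₚ g)) x                  ≈⟨ +-congˡ (eval-derivative-· (- x) g x) ⟩
      f′[x] + (- x) * g′[x]
          ≈⟨ solve 3 (λ f x g → f :+ (:- x) :* g := f :- x :* g) refl f′[x] x g′[x] ⟩
      f′[x] - x * g′[x]                                         ∎

    private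
      A B : Poly
      A = derivative f *ₚ g -ₚ f *ₚ derivative g
      B = g *ₚ g

      eval-A : ∀ f g z → eval (derivative f *ₚ g -ₚ f *ₚ derivative g) z ≈
                         eval (derivative f) z * eval g z - eval f z * eval (derivative g) z
      eval-A f g z = trans (eval-minus (derivative f *ₚ g) (f *ₚ derivative g) z)
        (+-cong (eval-* (derivative f) g z) (-‿cong (eval-* f (derivative g) z)))

      -- The derivative of χ is formed from its given numerator and denominator. Differentiating the
      -- cross-multiplied equality with f / g shows that f and g give the same function.
      derivative-represents : (χ ′) ≐ A / B
      derivative-represents = (λ e → *ₚ-≉0 (den χ) (den χ) D≉0 D≉0 (proj₂ e)) ,
          (λ e → *ₚ-≉0 g g g≉0 g≉0 (proj₂ e)) ,
        eval-ext (num (χ ′) *ₚ B) (A *ₚ den (χ ′)) cross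
        where
        cross : ∀ z → eval (num (χ ′) *ₚ B) z ≈ eval (A *ₚ den (χ ′)) z
        cross z = begin
          eval (num (χ ′) *ₚ B) z
            ≈⟨ trans (eval-* (num (χ ′)) B z) (*-cong (eval-A (num χ) (den χ) z) (eval-* g g z)) ⟩
          (N′ * D - N * D′) * (G * G)
            ≈⟨ solve 8 (λ N N′ D D′ F F′ G G′ → (N′ :* D :- N :* D′) :* (G :* G)
                  := (F′ :* G :- F :* G′) :* (D :* D) :+
                      ((G :* D) :* ((N′ :* G :+ N :* G′) :- (F′ :* D :+ F :* D′))
                     :- (D :* G′ :+ D′ :* G) :* (N :* G :- F :* D))) refl N N′ D D′ F₀ F₀′ G G′ ⟩
          (F₀′ * G - F₀ * G′) * (D * D) +
              ((G * D) * ((N′ * G + N * G′) - (F₀′ * D + F₀ * D′)) - (D * G′ + D′ * G) * (N * G - F₀ * D))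
            ≈⟨ +-congˡ (+-cong (*-congˡ (x≈y⇒x-y≈0 product-rule))
                (-‿cong (*-congˡ (x≈y⇒x-y≈0 (pointwise z))))) ⟩
          (F₀′ * G - F₀ * G′) * (D * D) + ((G * D) * 0# - (D * G′ + D′ * G) * 0#)
            ≈⟨ solve 3 (λ a b c → a :+ (b :* con (+ 0) :- c :* con (+ 0)) := a) refl _ (G * D)
                (D * G′ + D′ * G) ⟩
          (F₀′ * G - F₀ * G′) * (D * D)
            ≈⟨ trans (eval-* A (den χ *ₚ den χ) z) (*-cong (eval-A f g z) (eval-* (den χ) (den χ) z)) ⟨
          eval (A *ₚ den (χ ′)) z ∎
          where
          N N′ D D′ F₀ F₀′ G G′ : Carrier
          N   = eval (num χ) z
          N′  = eval (derivative (num χ)) z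
          D   = eval (den χ) z
          D′  = eval (derivative (den χ)) z
          F₀  = eval f z
          F₀′ = eval (derivative f) z
          G   = eval g z
          G′  = eval (derivative g) z
          product-rule : N′ * G + N * G′ ≈ F₀′ * D + F₀ * D′
          product-rule = trans (sym (eval-derivative-* (num χ) g z))
            (trans (eval-derivative-cong (num χ *ₚ g) (f *ₚ den χ) z (proj₂ (proj₂ represents)))
                (eval-derivative-* f (den χ) z))

      A[x]≈ : eval A x ≈ g[x] * slope
      A[x]≈ = begin
        eval A x                              ≈⟨ eval-A f g x ⟩
        f′[x] * g[x] - f[x] * g′[x]           ≈⟨ +-congˡ (-‿cong (*-congʳ fixed)) ⟩
        f′[x] * g[x] - (x * g[x]) * g′[x]
          ≈⟨ solve 4 (λ f x g g′ → f :* g :- (x :* g) :* g′ := g :* (f :- x :* g′)) refl f′[x]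
              x g[x] g′[x] ⟩
        g[x] * (f′[x] - x * g′[x])            ≈⟨ *-congˡ slope≈ ⟨
        g[x] * slope                          ∎

    multiplier⇒slope : ∀ λ₀ → (χ ′) ⟨ fin x ⟩≈ fin λ₀ → slope ≈ λ₀ * g[x]
    multiplier⇒slope λ₀ (A′ , B′ , χ′≐ , B′≉0 , A′≈) = *-cancelˡ-≈ g[x]≉0 (*-cancelˡ-≈ B′≉0 (begin
      eval B′ x * (g[x] * slope)           ≈⟨ *-congˡ A[x]≈ ⟨
      eval B′ x * eval A x                 ≈⟨ *-comm _ _ ⟩
      eval A x * eval B′ x
          ≈⟨ trans (sym (eval-* A B′ x)) (trans (eval-cong (A *ₚ B′) (A′ *ₚ B) x
                                                (≐-cross {χ ′} {A} {B} {A′} {B′} derivative-represents χ′≐))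
                                                    (eval-* A′ B x)) ⟩
      eval A′ x * eval B x                 ≈⟨ *-cong A′≈ (eval-* g g x) ⟩
      (λ₀ * eval B′ x) * (g[x] * g[x])
          ≈⟨ solve 3 (λ l b g → (l :* b) :* (g :* g) := b :* (g :* (l :* g))) refl λ₀ (eval B′ x) g[x] ⟩
      eval B′ x * (g[x] * (λ₀ * g[x]))     ∎))

    slope⇒multiplier : ∀ λ₀ → slope ≈ λ₀ * g[x] → (χ ′) ⟨ fin x ⟩≈ fin λ₀
    slope⇒multiplier λ₀ e = A , B , derivative-represents
      , ≉-cong (sym (eval-* g g x)) (*-≉0 g[x]≉0 g[x]≉0)
      , (begin
        eval A x               ≈⟨ A[x]≈ ⟩
        g[x] * slope           ≈⟨ *-congˡ e ⟩
        g[x] * (λ₀ * g[x])     ≈⟨ solve 2 (λ g l → g :* (l :* g) := l :* (g :* g)) refl g[x] λ₀ ⟩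
        λ₀ * (g[x] * g[x])     ≈⟨ *-congˡ (eval-* g g x) ⟨
        λ₀ * eval B x          ∎)

    multiplier-exists : ∃ λ λ₀ → slope ≈ λ₀ * g[x]
    multiplier-exists = slope * g⁻¹ , sym
        (trans (*-assoc slope g⁻¹ g[x])
        (trans (*-congˡ (trans (*-comm g⁻¹ g[x]) (proj₂ (invertible g[x]≉0)))) (*-identityʳ slope)))
      where g⁻¹ = proj₁ (invertible g[x]≉0)

    -- Since Φ(x , 1) = g(x) (x , 1), the eigenvalue is g(x). Moreover (x , 1) ∧ Φ is -(f - x g) and
    -- (x , 1) ∧ (s , t) is -(s - x t), so the cofactor is the quotient of f - x g by z - x, whose
    -- value at x is the slope.
    slope⇒Multiplier : ∀ λ₀ → slope ≈ λ₀ * g[x] → Multiplier f g n (x , 1#) λ₀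
    slope⇒Multiplier λ₀ e = record
      { μ               = g[x]
      ; eigen           = trans (form-[x,1] f d x) (trans fixed (*-comm x g[x]))
                        , trans (form-[x,1] g d x) (sym (*-identityʳ g[x]))
      ; cofactor        = quotient K x
      ; degree-cofactor = degree-quotient K x n dK
      ; factor          = λ (s , t) → begin
          x * form g d s t - 1# * form f d s t
            ≈⟨ solve 3 (λ x g f → x :* g :- con (+ 1) :* f := :- (f :+ (:- x) :* g)) refl x (form g d s t)
                (form f d s t) ⟩
          - (form f d s t + (- x) * form g d s t)
            ≈⟨ -‿cong (trans (form-+ f ((- x) ·ₚ g) d s t) (+-congˡ (form-· (- x) g d s t))) ⟨
          - form K d s t
            ≈⟨ -‿cong (trans (form-quotient K n x s t dK)
                (+-congˡ (trans (*-congʳ K[x]≈0) (zeroˡ (t ^ d))))) ⟩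
          - ((s - x * t) * form (quotient K x) n s t + 0#)
            ≈⟨ solve 4 (λ s x t q → :- ((s :- x :* t) :* q :+ con (+ 0)) := (x :* t :- con (+ 1) :* s) :* q)
                refl s x t (form (quotient K x) n s t) ⟩
          (x * t - 1# * s) * form (quotient K x) n s t ∎
      ; cofactor-self   = trans (form-[x,1] (quotient K x) n x) e
      }

    -- From f - z g = (f - x g) - (z - x) g, the quotient of f - z g by z - x takes the value slope
    -- - g(x) at x.
    simple : slope ≉ g[x] → VanishesToOrder (χ -id) x 1
    simple slope≉g = q , g ,
        (determinate , (λ e → g≉0 (proj₂ e)) , eval-ext (num (χ -id) *ₚ g)
        (((linear ^ₚ 1) *ₚ q) *ₚ den χ) cross)
      , (λ q≈0 → slope≉g (x-y≈0⇒x≈y (trans (sym q[x]≈) q≈0))) , g[x]≉0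
      where
      M q linear : Poly
      M = f -ₚ X *ₚ g
      q = quotient M x
      linear = (- x) ∷ 1# ∷ []

      determinate : Determinate (χ -id)
      determinate e = D≉0 (proj₂ e)

      eval-minus-X : ∀ p r z → eval (p -ₚ X *ₚ r) z ≈ eval p z - z * eval r z
      eval-minus-X p r z = trans (eval-minus p (X *ₚ r) z)
          (+-congˡ (-‿cong (trans (eval-* X r z) (*-congʳ (eval-X z)))))

      M[x]≈0 : eval M x ≈ 0#
      M[x]≈0 = trans (eval-minus-X f g x) (x≈y⇒x-y≈0 fixed)

      eval-M : ∀ z → eval M z ≈ (z - x) * eval q z
      eval-M z = trans (eval-quotient M x z) (trans (+-congˡ M[x]≈0) (+-identityʳ _))

      q[x]≈ : eval q x ≈ slope - g[x]
      q[x]≈ = begin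
        eval q x ≈⟨ trans (eval-derivative-unique M (quotient K x -ₚ g) x 0# split)
            (sym (eval-quotient-self M x)) ⟨
        eval (quotient K x -ₚ g) x ≈⟨ eval-minus (quotient K x) g x ⟩
        slope - g[x] ∎
        where
        split : ∀ z → eval M z ≈ (z - x) * eval (quotient K x -ₚ g) z + 0#
        split z = begin
          eval M z                                   ≈⟨ eval-minus-X f g z ⟩
          eval f z - z * eval g z
            ≈⟨ solve 4 (λ f g x z → f :- z :* g := (f :- x :* g) :- (z :- x) :* g) refl (eval f z)
                (eval g z) x z ⟩
          (eval f z - x * eval g z) - (z - x) * eval g z
            ≈⟨ +-congʳ (trans (sym (eval-K z)) (trans (eval-quotient K x z) (+-congˡ K[x]≈0))) ⟩
          ((z - x) * eval (quotient K x) z + 0#) - (z - x) * eval g z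
            ≈⟨ solve 3 (λ d q g → (d :* q :+ con (+ 0)) :- d :* g := d :* (q :- g) :+ con (+ 0)) refl
                (z - x) (eval (quotient K x) z) (eval g z) ⟩
          (z - x) * (eval (quotient K x) z - eval g z) + 0#
            ≈⟨ +-congʳ (*-congˡ (eval-minus (quotient K x) g z)) ⟨
          (z - x) * eval (quotient K x -ₚ g) z + 0#  ∎

      eval-linear : ∀ z → eval (linear ^ₚ 1) z ≈ z - x
      eval-linear z = trans (eval-^ linear 1 z)
          (solve 2 (λ x z → (:- x :+ z :* (con (+ 1) :+ z :* con (+ 0))) :* con (+ 1) := z :- x) refl x z)

      cross : ∀ z → eval (num (χ -id) *ₚ g) z ≈ eval (((linear ^ₚ 1) *ₚ q) *ₚ den χ) z
      cross z = begin
        eval (num (χ -id) *ₚ g) z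
          ≈⟨ trans (eval-* (num (χ -id)) g z) (*-congʳ (eval-minus-X (num χ) (den χ) z)) ⟩
        (eval (num χ) z - z * eval (den χ) z) * eval g z
          ≈⟨ solve 4 (λ N z D g → (N :- z :* D) :* g := N :* g :- z :* (D :* g)) refl (eval (num χ) z) z
              (eval (den χ) z) (eval g z) ⟩
        eval (num χ) z * eval g z - z * (eval (den χ) z * eval g z)
          ≈⟨ +-congʳ (pointwise z) ⟩
        eval f z * eval (den χ) z - z * (eval (den χ) z * eval g z)
          ≈⟨ solve 4 (λ f D z g → f :* D :- z :* (D :* g) := (f :- z :* g) :* D) refl (eval f z)
              (eval (den χ) z) z (eval g z) ⟩
        (eval f z - z * eval g z) * eval (den χ) z
          ≈⟨ *-congʳ (trans (sym (eval-minus-X f g z)) (eval-M z)) ⟩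
        ((z - x) * eval q z) * eval (den χ) z
          ≈⟨ trans (eval-* ((linear ^ₚ 1) *ₚ q) (den χ) z)
              (*-congʳ (trans (eval-* (linear ^ₚ 1) q z) (*-congʳ (eval-linear z)))) ⟨
        eval (((linear ^ₚ 1) *ₚ q) *ₚ den χ) z ∎

  module FixedPointTheory {φ f g n} (nf : NormalForm φ f g (suc n)) where
    open NormalForm nf
    private
      d : ℕ
      d = suc n
      module I = AtInfinity nf

    fixed-finite : ∀ x → FixedPoint φ (fin x) → eval f x ≈ x * eval g x
    fixed-finite x fp = x-y≈0⇒x≈y (begin
      eval f x - x * eval g x
        ≈⟨ +-cong (form-[x,1] f d x) (-‿cong (*-congˡ (form-[x,1] g d x))) ⟨
      form f d x 1# - x * form g d x 1#
        ≈⟨ solve 3 (λ f x g → f :- x :* g := f :* con (+ 1) :- g :* x) refl (form f d x 1#) x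
            (form g d x 1#) ⟩
      form f d x 1# * 1# - form g d x 1# * x
        ≈⟨ image⇒∧≈0 (fin x) (fin x) fp ⟩
      0# ∎)

    fixed-infinity : FixedPoint φ ∞ → eval I.infinity-num 0# ≈ 0# * eval I.infinity-den 0#
    fixed-infinity fp = begin
      eval I.infinity-num 0#                  ≈⟨ form-[x,1] I.infinity-num d 0# ⟨
      form I.infinity-num d 0# 1#             ≈⟨ proj₁ (I.value-infinity (0# , 1#)) ⟩
      form g d 1# 0#
        ≈⟨ solve 2 (λ g f → g := :- (f :* con (+ 0) :- g :* con (+ 1))) refl (form g d 1# 0#)
            (form f d 1# 0#) ⟩
      - (form f d 1# 0# * 0# - form g d 1# 0# * 1#)
        ≈⟨ -‿cong (image⇒∧≈0 ∞ ∞ fp) ⟩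
      - 0#
        ≈⟨ solve 1 (λ y → :- con (+ 0) := con (+ 0) :* y) refl (eval I.infinity-den 0#) ⟩
      0# * eval I.infinity-den 0#             ∎

    multiplier : ∀ x λ₀ → FixedPoint φ x → FixedPointMultiplier φ x λ₀ → Multiplier f g n (coordinates x) λ₀
    multiplier (fin x) λ₀ fp m = A.slope⇒Multiplier λ₀ (A.multiplier⇒slope λ₀ m)
      where module A = AtFinitePoint nf x (fixed-finite x fp)
    -- Everything is transported from the fixed point 0 of 1/φ(1/z) by swapping coordinates; the
    -- swap changes the sign of `_∧_` on both sides of the factorisation.
    multiplier ∞ λ₀ fp m = record
      { μ               = M.μ
      ; eigen           = trans (sym (proj₂ (I.value-infinity (0# , 1#)))) (proj₂ M.eigen)
                        , trans (sym (proj₁ (I.value-infinity (0# , 1#)))) (proj₁ M.eigen)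
      ; cofactor        = homogenise M.cofactor n 1ₚ X
      ; degree-cofactor = degree-homogenise M.cofactor n 1ₚ X M.degree-cofactor degree-1ₚ degree-X
      ; factor          = λ (s , t) → begin
          1# * form g d s t - 0# * form f d s t
            ≈⟨ +-cong (*-congˡ (sym (proj₁ (I.value-infinity (t , s)))))
                (-‿cong (*-congˡ (sym (proj₂ (I.value-infinity (t , s)))))) ⟩
          1# * form I.infinity-num d t s - 0# * form I.infinity-den d t s
            ≈⟨ solve 2 (λ a b → con (+ 1) :* a :- con (+ 0) :* b := :- (con (+ 0) :* b :- con (+ 1) :* a))
                refl (form I.infinity-num d t s) (form I.infinity-den d t s) ⟩
          - (0# * form I.infinity-den d t s - 1# * form I.infinity-num d t s)
            ≈⟨ -‿cong (M.factor (t , s)) ⟩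
          - ((0# * s - 1# * t) * form M.cofactor n t s)
            ≈⟨ solve 3 (λ s t k → :- ((con (+ 0) :* s :- con (+ 1) :* t) :* k) :=
                (con (+ 1) :* t :- con (+ 0) :* s) :* k) refl s t (form M.cofactor n t s) ⟩
          (1# * t - 0# * s) * form M.cofactor n t s
            ≈⟨ *-congˡ (form-reverse M.cofactor n M.degree-cofactor s t) ⟨
          (1# * t - 0# * s) * form (homogenise M.cofactor n 1ₚ X) n s t ∎
      ; cofactor-self   = trans (form-reverse M.cofactor n M.degree-cofactor 1# 0#) M.cofactor-self
      }
      where
      module A = AtFinitePoint I.normalForm 0# (fixed-infinity fp)
      module M = Multiplier (A.slope⇒Multiplier λ₀ (A.multiplier⇒slope λ₀ m))

    multiplier-exists : ∀ x → FixedPoint φ x → ∃ λ λ₀ → FixedPointMultiplier φ x λ₀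
    multiplier-exists (fin x) fp = proj₁ A.multiplier-exists , A.slope⇒multiplier
        (proj₁ A.multiplier-exists) (proj₂ A.multiplier-exists)
      where module A = AtFinitePoint nf x (fixed-finite x fp)
    multiplier-exists ∞ fp = proj₁ A.multiplier-exists , A.slope⇒multiplier (proj₁ A.multiplier-exists)
        (proj₂ A.multiplier-exists)
      where module A = AtFinitePoint I.normalForm 0# (fixed-infinity fp)

    -- Stated for any χ, because the case of ∞ applies it to 1/φ(1/z) at 0.
    simple-finite : ∀ {χ f g} (nf : NormalForm χ f g d) x λ₀ → eval f x ≈ x * eval g x →
                    (χ ′) ⟨ fin x ⟩≈ fin λ₀ → λ₀ ≉ 1# → VanishesToOrder (χ -id) x 1
    simple-finite {χ} {f} {g} nf x λ₀ fixed m λ≉1 = A.simple (λ slope≈g → λ≉1 (*-cancelˡ-≈ {eval g x} g≉0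
      (trans (*-comm _ λ₀) (trans (sym (A.multiplier⇒slope λ₀ m)) (trans slope≈g (sym (*-identityʳ _)))))))
      where
      module A = AtFinitePoint nf x fixed
      module N = NormalForm nf
      g≉0 : eval g x ≉ 0#
      g≉0 g≈0 = N.rootless x
        (trans fixed (trans (*-congˡ g≈0) (zeroʳ x))) g≈0

    multiplier≉1⇒simple : ∀ x λ₀ → FixedPoint φ x → FixedPointMultiplier φ x λ₀ → λ₀ ≉ 1# →
        FixedPointMultiplicity φ x 1
    multiplier≉1⇒simple (fin x) λ₀ fp m λ≉1 = simple-finite nf x λ₀ (fixed-finite x fp) m λ≉1
    multiplier≉1⇒simple ∞       λ₀ fp m λ≉1 = simple-finite I.normalForm 0# λ₀ (fixed-infinity fp) m λ≉1

-- The valuation and its residue field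

module Valuation (em : ∀ {a} → ExcludedMiddle a) {r ℓr₁ ℓr₂ l ℓl} (ℝ : CompleteOrderedField r ℓr₁ ℓr₂)
  (L : Field l ℓl) (v : NonArchimedeanAbsoluteValue ℝ L) where
  private
    module ℝ  = CompleteOrderedField ℝ
    module ℝF = FieldProperties em ℝ.underlyingField
    module ℝS = IntegerRingSolver ℝ.commutativeRing
  open NonArchimedeanAbsoluteValue v
  open Dynamics ℝ L v using (𝒪; residueField)
  open Field L hiding (zero)
  open IntegerRingSolver commutativeRing
  open FieldProperties em L

  private
    *-monoˡ-≤ : ∀ {x y z} → ℝ.0# ℝ.≤ z → x ℝ.≤ y → z ℝ.* x ℝ.≤ z ℝ.* y
    *-monoˡ-≤ {x} {y} {z} 0≤z x≤y = ℝ.≤-respˡ-≈ (ℝ.+-identityˡ _) (ℝ.≤-respʳ-≈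
      (ℝS.solve 3 (λ x y z → z ℝS.:* (y ℝS.:- x) ℝS.:+ z ℝS.:* x ℝS.:= z ℝS.:* y) ℝ.refl x y z)
      (ℝ.+-monoˡ-≤ (z ℝ.* x) (ℝ.*-nonneg 0≤z (ℝ.≤-respˡ-≈ (ℝ.-‿inverseʳ x) (ℝ.+-monoˡ-≤ (ℝ.- x) x≤y)))))

    ∣1∣≈1 : ∣ 1# ∣ᵥ ℝ.≈ ℝ.1#
    ∣1∣≈1 = ℝF.*-cancelˡ-≈ {∣ 1# ∣ᵥ} (λ e → 1≉0 (Equivalence.to (∣x∣≈0⇔x≈0 1#) e))
      (ℝ.trans (ℝ.sym (∣∣-* 1# 1#)) (ℝ.trans (∣∣-cong (*-identityʳ 1#)) (ℝ.sym (ℝ.*-identityʳ _))))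

  infix 4 _≼_
  -- Comparing field elements by size keeps the later estimates inside L, with products and inverses
  -- taken there.
  _≼_ : Carrier → Carrier → Set ℓr₂
  x ≼ y = ∣ x ∣ᵥ ℝ.≤ ∣ y ∣ᵥ

  ≼-reflexive : ∀ {x y} → x ≈ y → x ≼ y
  ≼-reflexive x≈y = ℝ.≤-reflexive (∣∣-cong x≈y)

  ≼-refl : ∀ {x} → x ≼ x
  ≼-refl = ≼-reflexive refl

  ≼-trans : ∀ {x y z} → x ≼ y → y ≼ z → x ≼ z
  ≼-trans = ℝ.≤-trans

  ≼-resp : ∀ {x x′ y y′} → x ≈ x′ → y ≈ y′ → x ≼ y → x′ ≼ y′
  ≼-resp x≈ y≈ x≼y = ≼-trans (≼-reflexive (sym x≈)) (≼-trans x≼y (≼-reflexive y≈))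

  ≼-total : ∀ x y → x ≼ y ⊎ y ≼ x
  ≼-total x y = ℝ.total ∣ x ∣ᵥ ∣ y ∣ᵥ

  ≼-*ˡ : ∀ z {x y} → x ≼ y → z * x ≼ z * y
  ≼-*ˡ z {x} {y} x≼y = ℝ.≤-respˡ-≈ (ℝ.sym (∣∣-* z x))
      (ℝ.≤-respʳ-≈ (ℝ.sym (∣∣-* z y)) (*-monoˡ-≤ (∣∣-nonneg z) x≼y))

  ≼-* : ∀ {x x′ y y′} → x ≼ x′ → y ≼ y′ → x * y ≼ x′ * y′
  ≼-* {x} {x′} {y} {y′} x≼ y≼ = ≼-trans (≼-*ˡ x y≼) (≼-resp (*-comm y′ x) (*-comm y′ x′) (≼-*ˡ y′ x≼))

  ≼-cancelˡ : ∀ {z x y} → z ≉ 0# → z * x ≼ z * y → x ≼ y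
  ≼-cancelˡ {z} {x} {y} z≉0 zx≼zy = ≼-resp (undo x) (undo y) (≼-*ˡ z⁻¹ zx≼zy)
    where
    z⁻¹ = proj₁ (invertible z≉0)
    undo : ∀ w → z⁻¹ * (z * w) ≈ w
    undo w = trans (sym (*-assoc z⁻¹ z w)) (trans (*-congʳ (trans (*-comm z⁻¹ z) (proj₂ (invertible z≉0))))
        (*-identityˡ w))

  ≼-+ : ∀ {x y z} → x ≼ z → y ≼ z → x + y ≼ z
  ≼-+ {x} {y} x≼z y≼z = ℝ.≤-trans (ultrametric x y) (ℝ.⊔-lub x≼z y≼z)

  0≼ : ∀ x → 0# ≼ x
  0≼ x = ℝ.≤-respˡ-≈ (ℝ.sym (Equivalence.from (∣x∣≈0⇔x≈0 0#) refl)) (∣∣-nonneg x)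

  ≼0⇒≈0 : ∀ {x} → x ≼ 0# → x ≈ 0#
  ≼0⇒≈0 {x} x≼0 = Equivalence.to (∣x∣≈0⇔x≈0 x) (ℝ.antisym
    (ℝ.≤-respʳ-≈ (Equivalence.from (∣x∣≈0⇔x≈0 0#) refl) x≼0) (∣∣-nonneg x))

  ≼⇒≉0 : ∀ {x y} → x ≉ 0# → x ≼ y → y ≉ 0#
  ≼⇒≉0 x≉0 x≼y y≈0 = x≉0 (≼0⇒≈0 (≼-trans x≼y (≼-reflexive y≈0)))

  ≼-neg : ∀ x → - x ≼ x
  ≼-neg x = ≼-resp (solve 1 (λ x → x :* :- con (+ 1) := :- x) refl x) (*-identityʳ x) (≼-*ˡ x -1≼1)
    where
    -1≼1 : - 1# ≼ 1#
    -1≼1 with ≼-total (- 1#) 1#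
    ... | inj₁ -1≼1 = -1≼1
    ... | inj₂ 1≼-1 = ≼-resp (*-identityʳ (- 1#))
        (solve 0 ((:- con (+ 1)) :* (:- con (+ 1)) := con (+ 1)) refl) (≼-*ˡ (- 1#) 1≼-1)

  ≼-minus : ∀ {x y z} → x ≼ z → y ≼ z → x - y ≼ z
  ≼-minus {y = y} x≼z y≼z = ≼-+ x≼z (≼-trans (≼-neg y) y≼z)

  -- By the ultrametric inequality a sum is no larger than its larger summand.
  ≼-+-split : ∀ {x y z} → z ≼ x + y → z ≼ x ⊎ z ≼ y
  ≼-+-split {x} {y} z≼x+y with ≼-total x y
  ... | inj₁ x≼y = inj₂ (≼-trans z≼x+y (≼-+ x≼y ≼-refl))
  ... | inj₂ y≼x = inj₁ (≼-trans z≼x+y (≼-+ ≼-refl y≼x))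

  ≤1⇒≼1 : ∀ {x} → ∣ x ∣ᵥ ℝ.≤ ℝ.1# → x ≼ 1#
  ≤1⇒≼1 = ℝ.≤-respʳ-≈ (ℝ.sym ∣1∣≈1)

  ≼1⇒≤1 : ∀ {x} → x ≼ 1# → ∣ x ∣ᵥ ℝ.≤ ℝ.1#
  ≼1⇒≤1 = ℝ.≤-respʳ-≈ ∣1∣≈1

  1≤⇒1≼ : ∀ {x} → ℝ.1# ℝ.≤ ∣ x ∣ᵥ → 1# ≼ x
  1≤⇒1≼ = ℝ.≤-respˡ-≈ (ℝ.sym ∣1∣≈1)

  ≈1⇒1≼ : ∀ {x} → ∣ x ∣ᵥ ℝ.≈ ℝ.1# → 1# ≼ x
  ≈1⇒1≼ e = 1≤⇒1≼ (ℝ.≤-reflexive (ℝ.sym e))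

  ≼∧≽⇒≈1 : ∀ {x} → x ≼ 1# → 1# ≼ x → ∣ x ∣ᵥ ℝ.≈ ℝ.1#
  ≼∧≽⇒≈1 x≼1 1≼x = ℝ.antisym (≼1⇒≤1 x≼1) (ℝ.≤-respˡ-≈ ∣1∣≈1 1≼x)

  -- Among all elements this singles out the maximal ideal, because sizes are totally ordered; the
  -- negative form suits arguments that refute 1 ≼ x.
  Small : Carrier → Set ℓr₂
  Small x = ¬ (1# ≼ x)

  <1⇒Small : ∀ {x} → ∣ x ∣ᵥ ℝ.< ℝ.1# → Small x
  <1⇒Small (x≤1 , x≉1) 1≼x = x≉1 (≼∧≽⇒≈1 (≤1⇒≼1 x≤1) 1≼x)

  Small⇒<1 : ∀ {x} → Small x → ∣ x ∣ᵥ ℝ.< ℝ.1#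
  Small⇒<1 {x} small with ≼-total x 1#
  ... | inj₁ x≼1 = ≼1⇒≤1 x≼1 , λ e → small (≈1⇒1≼ e)
  ... | inj₂ 1≼x = contradiction 1≼x small

  Small-resp : ∀ {x y} → x ≈ y → Small x → Small y
  Small-resp x≈y small 1≼y = small (≼-trans 1≼y (≼-reflexive (sym x≈y)))

  Small-0 : ∀ {x} → x ≈ 0# → Small x
  Small-0 x≈0 1≼x = 1≉0 (≼0⇒≈0 (≼-trans 1≼x (≼-reflexive x≈0)))

  Small-+ : ∀ {x y} → Small x → Small y → Small (x + y)
  Small-+ sx sy 1≼x+y with ≼-+-split 1≼x+y
  ... | inj₁ 1≼x = sx 1≼x
  ... | inj₂ 1≼y = sy 1≼y

  Small-neg : ∀ {x} → Small x → Small (- x)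
  Small-neg {x} sx 1≼-x = sx (≼-trans 1≼-x (≼-neg x))

  Small-*ˡ : ∀ {x y} → x ≼ 1# → Small y → Small (x * y)
  Small-*ˡ {x} {y} x≼1 sy 1≼xy =
      sy (≼-trans 1≼xy (≼-resp refl (*-identityˡ y) (≼-* {x} {1#} {y} {y} x≼1 ≼-refl)))

  private
    module 𝒪 = RawRing residueField

    integral : (x : 𝒪) → proj₁ x ≼ 1#
    integral (x , x≤1) = ≤1⇒≼1 x≤1

    Small⇒≈ : ∀ {x y : 𝒪} → Small (proj₁ x - proj₁ y) → x 𝒪.≈ y
    Small⇒≈ = Small⇒<1

    ≈⇒≈ : (x y : 𝒪) → proj₁ x ≈ proj₁ y → x 𝒪.≈ y
    ≈⇒≈ x y e = Small⇒≈ {x} {y} (Small-0 (x≈y⇒x-y≈0 e))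

    ≈-trans : (x y z : 𝒪) → x 𝒪.≈ y → y 𝒪.≈ z → x 𝒪.≈ z
    ≈-trans (x , _) (y , _) (z , _) x≈y y≈z = Small⇒<1 (Small-resp
      (solve 3 (λ x y z → (x :- y) :+ (y :- z) := x :- z) refl x y z)
          (Small-+ (<1⇒Small x≈y) (<1⇒Small y≈z)))

    ≈-sym : (x y : 𝒪) → x 𝒪.≈ y → y 𝒪.≈ x
    ≈-sym (x , _) (y , _) x≈y =
        Small⇒<1 (Small-resp (solve 2 (λ x y → :- (x :- y) := y :- x) refl x y) (Small-neg (<1⇒Small x≈y)))

    +-cong′ : (x y u w : 𝒪) → x 𝒪.≈ y → u 𝒪.≈ w → (x 𝒪.+ u) 𝒪.≈ (y 𝒪.+ w)
    +-cong′ (x , _) (y , _) (u , _) (w , _) x≈y u≈w = Small⇒<1 (Small-resp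
      (solve 4 (λ x y u w → (x :- y) :+ (u :- w) := (x :+ u) :- (y :+ w)) refl x y u w)
          (Small-+ (<1⇒Small x≈y) (<1⇒Small u≈w)))

    *-cong′ : (x y u w : 𝒪) → x 𝒪.≈ y → u 𝒪.≈ w → (x 𝒪.* u) 𝒪.≈ (y 𝒪.* w)
    *-cong′ (x , p) (y , _) (u , _) (w , q) x≈y u≈w = Small⇒<1 (Small-resp
      (solve 4 (λ x y u w → x :* (u :- w) :+ w :* (x :- y) := (x :* u) :- (y :* w)) refl x y u w)
      (Small-+ (Small-*ˡ {x} (≤1⇒≼1 p) (<1⇒Small u≈w)) (Small-*ˡ {w} (≤1⇒≼1 q) (<1⇒Small x≈y))))

    neg-cong′ : (x y : 𝒪) → x 𝒪.≈ y → (𝒪.- x) 𝒪.≈ (𝒪.- y)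
    neg-cong′ (x , _) (y , _) x≈y =
        Small⇒<1 (Small-resp (solve 2 (λ x y → :- (x :- y) := (:- x) :- (:- y)) refl x y)
        (Small-neg (<1⇒Small x≈y)))

  residueRing : CommutativeRing (l ⊔ ℓr₂) (ℓr₁ ⊔ ℓr₂)
  residueRing = record
    { Carrier = 𝒪.Carrier ; _≈_ = 𝒪._≈_ ; _+_ = 𝒪._+_ ; _*_ = 𝒪._*_ ; -_ = 𝒪.-_ ; 0# = 𝒪.0# ; 1# = 𝒪.1#
    ; isCommutativeRing = record
      { isRing = record
        { +-isAbelianGroup = record
          { isGroup = record
            { isMonoid = record
              { isSemigroup = record
                { isMagma = record
                  { isEquivalence = record
                    { refl  = λ {x} → ≈⇒≈ x x refl
                    ; sym   = λ {x} {y} → ≈-sym x y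
                    ; trans = λ {x} {y} {z} → ≈-trans x y z
                    }
                  ; ∙-cong = λ {x} {y} {u} {w} → +-cong′ x y u w
                  }
                ; assoc = λ x y z → ≈⇒≈ ((x 𝒪.+ y) 𝒪.+ z) (x 𝒪.+ (y 𝒪.+ z)) (+-assoc _ _ _)
                }
              ; identity = (λ x → ≈⇒≈ (𝒪.0# 𝒪.+ x) x (+-identityˡ _)) ,
                  (λ x → ≈⇒≈ (x 𝒪.+ 𝒪.0#) x (+-identityʳ _))
              }
            ; inverse = (λ x → ≈⇒≈ ((𝒪.- x) 𝒪.+ x) 𝒪.0# (-‿inverseˡ _)) ,
                (λ x → ≈⇒≈ (x 𝒪.+ (𝒪.- x)) 𝒪.0# (-‿inverseʳ _))
            ; ⁻¹-cong = λ {x} {y} → neg-cong′ x y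
            }
          ; comm = λ x y → ≈⇒≈ (x 𝒪.+ y) (y 𝒪.+ x) (+-comm _ _)
          }
        ; *-cong = λ {x} {y} {u} {w} → *-cong′ x y u w
        ; *-assoc = λ x y z → ≈⇒≈ ((x 𝒪.* y) 𝒪.* z) (x 𝒪.* (y 𝒪.* z)) (*-assoc _ _ _)
        ; *-identity = (λ x → ≈⇒≈ (𝒪.1# 𝒪.* x) x (*-identityˡ _)) ,
            (λ x → ≈⇒≈ (x 𝒪.* 𝒪.1#) x (*-identityʳ _))
        ; distrib = (λ x y z → ≈⇒≈ (x 𝒪.* (y 𝒪.+ z)) ((x 𝒪.* y) 𝒪.+ (x 𝒪.* z)) (distribˡ _ _ _))
                  , (λ x y z → ≈⇒≈ ((y 𝒪.+ z) 𝒪.* x) ((y 𝒪.* x) 𝒪.+ (z 𝒪.* x)) (distribʳ _ _ _))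
        }
      ; *-comm = λ x y → ≈⇒≈ (x 𝒪.* y) (y 𝒪.* x) (*-comm _ _)
      }
    }

  x-0≈x : ∀ x → x - 0# ≈ x
  x-0≈x x = solve 1 (λ x → x :- con (+ 0) := x) refl x

  ≈0⇒Small : (x : 𝒪) → x 𝒪.≈ 𝒪.0# → Small (proj₁ x)
  ≈0⇒Small (x , _) x≈0 = Small-resp (x-0≈x x) (<1⇒Small x≈0)

  Small⇒≈0 : (x : 𝒪) → Small (proj₁ x) → x 𝒪.≈ 𝒪.0#
  Small⇒≈0 (x , _) small = Small⇒<1 (Small-resp (sym (x-0≈x x)) small)

  ≉0⇒1≼ : (x : 𝒪) → ¬ (x 𝒪.≈ 𝒪.0#) → 1# ≼ proj₁ x
  ≉0⇒1≼ x x≉0 = decidable-stable em (λ small → x≉0 (Small⇒≈0 x small))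

  inverse-≼1 : ∀ {x y} → 1# ≼ x → x * y ≈ 1# → y ≼ 1#
  inverse-≼1 {x} {y} 1≼x xy≈1 = ≼-cancelˡ {x} (≼⇒≉0 1≉0 1≼x) (≼-resp (sym xy≈1) (sym (*-identityʳ x)) 1≼x)

  residue : Field (l ⊔ ℓr₂) (ℓr₁ ⊔ ℓr₂)
  residue = record
    { commutativeRing = residueRing
    ; 1≉0 = λ 1≈0 → ≈0⇒Small 𝒪.1# 1≈0 ≼-refl
    ; invertible = λ {x} x≉0 → inverse x (≉0⇒1≼ x x≉0)
    }
    where
    inverse : ∀ x → 1# ≼ proj₁ x → ∃ λ y → (x 𝒪.* y) 𝒪.≈ 𝒪.1#
    inverse x′@(x , _) 1≼x = y , ≈⇒≈ (x′ 𝒪.* y) 𝒪.1# xx⁻¹≈1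
      where
      x⁻¹ = proj₁ (invertible (≼⇒≉0 1≉0 1≼x))
      xx⁻¹≈1 = proj₂ (invertible (≼⇒≉0 1≉0 1≼x))
      y : 𝒪
      y = x⁻¹ , ≼1⇒≤1 (inverse-≼1 1≼x xx⁻¹≈1)

  private
    module k where
      open Field residue public hiding (zero)
      open Polynomials residueField public
      open PolynomialProperties residueRing public
      open Evaluation residueRing public
      open FieldProperties em residue public
  open Polynomials rawRing
  open PolynomialProperties commutativeRing
  open Evaluation commutativeRing

  lifts : List 𝒪 → Poly
  lifts = map proj₁

  coeff-lifts : ∀ p n → coeff (lifts p) n ≡ proj₁ (k.coeff p n)
  coeff-lifts []      n       = ≡.refl
  coeff-lifts (a ∷ p) zero    = ≡.refl
  coeff-lifts (a ∷ p) (suc n) = coeff-lifts p n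

  eval-lifts : ∀ p x → eval (lifts p) (proj₁ x) ≡ proj₁ (k.eval p x)
  eval-lifts []      x = ≡.refl
  eval-lifts (a ∷ p) x = ≡.cong (λ y → proj₁ a + proj₁ x * y) (eval-lifts p x)

  ^-proj : ∀ x n → proj₁ x ^ n ≡ proj₁ (x k.^ n)
  ^-proj x zero    = ≡.refl
  ^-proj x (suc n) = ≡.cong (proj₁ x *_) (^-proj x n)

  form-lifts : ∀ p n s t → form (lifts p) n (proj₁ s) (proj₁ t) ≡ proj₁ (k.form p n s t)
  form-lifts []      n s t = ≡.refl
  form-lifts (a ∷ p) n s t = ≡.cong₂ (λ x y → proj₁ a * x + proj₁ s * y) (^-proj t n)
      (form-lifts p (n ∸ 1) s t)

  degree-lifts : ∀ p n → DegreeAtMost (lifts p) n → k.DegreeAtMost p n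
  degree-lifts p n dp m n<m =
      ≈⇒≈ (k.coeff p m) 𝒪.0# (trans (reflexive (≡.sym (coeff-lifts p m))) (dp m n<m))

  lift-integral : ∀ p → (∀ n → coeff p n ≼ 1#) → ∃ λ q → lifts q ≡ p
  lift-integral []      int = [] , ≡.refl
  lift-integral (a ∷ p) int = (a , ≼1⇒≤1 (int 0)) ∷ proj₁ q , ≡.cong (a ∷_) (proj₂ q)
    where q = lift-integral p (λ n → int (suc n))

  ≼-^ : ∀ {x} n → 1# ≼ x → 1# ≼ x ^ n
  ≼-^     zero    1≼x = ≼-refl
  ≼-^ {x} (suc n) 1≼x = ≼-resp (*-identityʳ 1#) refl (≼-* {1#} {x} {1#} {x ^ n} 1≼x (≼-^ n 1≼x))

  private
    -- For |x| > 1 the tail contributes at least |x| to the power n + 1 by induction, and the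
    -- integral constant term is too small to cancel it.
    growth : ∀ (p : List 𝒪) n x → 1# ≼ coeff (lifts p) n → 1# ≼ x → ¬ (x ≼ 1#) →
        x ^ n ≼ eval (lifts (take (suc n) p)) x
    growth []      n x 1≼0 1≼x x⋠1 = contradiction (≼0⇒≈0 1≼0) 1≉0
    growth (a ∷ p) zero x 1≼a 1≼x x⋠1 =
        ≼-resp refl (solve 2 (λ a x → a := a :+ x :* con (+ 0)) refl (proj₁ a) x) 1≼a
    growth (a ∷ p) (suc n) x 1≼pₙ 1≼x x⋠1 with ≼-+-split {proj₁ a + x * e} { - proj₁ a} {x ^ suc n}
      (≼-resp refl (solve 2 (λ a y → y := (a :+ y) :+ (:- a)) refl (proj₁ a) (x * e))
          (≼-*ˡ x (growth p n x 1≼pₙ 1≼x x⋠1)))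
      where e = eval (lifts (take (suc n) p)) x
    ... | inj₁ ≼e = ≼e
    ... | inj₂ ≼a = contradiction (≼-trans (≼-resp (*-identityʳ x) refl (≼-*ˡ x (≼-^ n 1≼x)))
                      (≼-trans ≼a (≼-trans (≼-neg (proj₁ a)) (integral a)))) x⋠1

    integral-root : ∀ (p : List 𝒪) n x → 1# ≼ coeff (lifts p) n →
        eval (lifts (take (suc n) p)) x ≈ 0# → x ≼ 1#
    integral-root p n x 1≼pₙ p[x]≈0 with ≼-total x 1#
    ... | inj₁ x≼1 = x≼1
    ... | inj₂ 1≼x = decidable-stable em (λ x⋠1 → 1≉0 (≼0⇒≈0 (≼-trans (≼-^ n 1≼x)
      (≼-trans (growth p n x 1≼pₙ 1≼x x⋠1) (≼-reflexive p[x]≈0)))))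

    coeff-take : ∀ (p : List 𝒪) n m → m ℕ.≤ n → k.coeff (take (suc n) p) m ≡ k.coeff p m
    coeff-take []      n       m       m≤n       = ≡.refl
    coeff-take (a ∷ p) n       zero    m≤n       = ≡.refl
    coeff-take (a ∷ p) (suc n) (suc m) (s≤s m≤n) = coeff-take p n m m≤n

    coeff-take-> : ∀ (p : List 𝒪) n m → n ℕ.< m → k.coeff (take (suc n) p) m ≡ 𝒪.0#
    coeff-take-> []      n       m             n<m       = ≡.refl
    coeff-take-> (a ∷ p) zero    (suc m)       n<m       = ≡.refl
    coeff-take-> (a ∷ p) (suc n) (suc m)       (s≤s n<m) = coeff-take-> p n m n<m

  module ResidueClosed (closed : IsAlgebraicallyClosed) where

    -- Dropping the terms of p above its reduced degree makes the leading
    -- coefficient a unit, which forces the roots to be integral.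
    residue-closed : k.IsAlgebraicallyClosed
    residue-closed p {n} 1≤n pₙ≉0 = root , ≈-trans (k.eval p root) (k.eval q root) 𝒪.0#
        (k.eval-cong p q root p≈q)
      (≈⇒≈ (k.eval q root) 𝒪.0# (trans (reflexive (≡.sym (eval-lifts q root))) (proj₂ x)))
      where
      lead = k.leading p (λ p≈0 → pₙ≉0 (p≈0 n))
      m = proj₁ lead

      1≤m : 1 ℕ.≤ m
      1≤m = ℕ.≤-trans 1≤n (ℕ.≮⇒≥ (λ m<n → pₙ≉0 (proj₂ (proj₂ lead) n m<n)))

      q : List 𝒪
      q = take (suc m) p

      p≈q : p k.≈ₚ q
      p≈q i with i ℕ.≤? m
      ... | yes i≤m = ≈⇒≈ (k.coeff p i) (k.coeff q i)
          (reflexive (≡.cong proj₁ (≡.sym (coeff-take p m i i≤m))))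
      ... | no  i≰m = ≈-trans (k.coeff p i) 𝒪.0# (k.coeff q i) (proj₂ (proj₂ lead) i (ℕ.≰⇒> i≰m))
        (≈⇒≈ 𝒪.0# (k.coeff q i) (reflexive (≡.cong proj₁ (≡.sym (coeff-take-> p m i (ℕ.≰⇒> i≰m))))))

      unit : ∀ q → ¬ (k.coeff q m 𝒪.≈ 𝒪.0#) → 1# ≼ coeff (lifts q) m
      unit q qₘ≉0 = ≼-resp refl (reflexive (≡.sym (coeff-lifts q m))) (≉0⇒1≼ (k.coeff q m) qₘ≉0)

      x : ∃ λ x → eval (lifts q) x ≈ 0#
      x = closed (lifts q) 1≤m (≼⇒≉0 1≉0 (unit q (λ qₘ≈0 → proj₁ (proj₂ lead)
        (≈-trans (k.coeff p m) (k.coeff q m) 𝒪.0# (p≈q m) qₘ≈0))))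

      root : 𝒪
      root = proj₁ x , ≼1⇒≤1 (integral-root p m (proj₁ x) (unit p (proj₁ (proj₂ lead))) (proj₂ x))

    private
      dominant : ∀ p → ∃ λ i → ∀ j → coeff p j ≼ coeff p i
      dominant []      = 0 , λ j → ≼-refl
      dominant (a ∷ p) with dominant p
      ... | i , max with ≼-total a (coeff p i)
      ...   | inj₁ a≼pᵢ = suc i , λ { zero → a≼pᵢ ; (suc j) → max j }
      ...   | inj₂ pᵢ≼a = 0 , λ { zero → ≼-refl ; (suc j) → ≼-trans (max j) pᵢ≼a }

    -- It suffices to bound p away from the zeros of the reduction of a.
    gauss : ∀ p r (a : List 𝒪) → ¬ (a k.≈ₚ k.0ₚ) →
            (∀ (η : 𝒪) → 1# ≼ eval (lifts a) (proj₁ η) → eval p (proj₁ η) ≼ r) → ∀ n → coeff p n ≼ r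
    gauss p r a a≉0 bound n = ≼-trans (max n) (decidable-stable em contra)
      where
      i = proj₁ (dominant p)
      max = proj₂ (dominant p)
      c = coeff p i

      contra : ¬ ¬ (c ≼ r)
      contra c⋠r = c⋠r (≼-trans c≼p[η] (bound η 1≼a[η]))
        where
        c≉0 : c ≉ 0#
        c≉0 c≈0 = c⋠r (≼-trans (≼-reflexive c≈0) (0≼ r))

        c⁻¹ = proj₁ (invertible c≉0)
        cc⁻¹≈1 = proj₂ (invertible c≉0)

        c⁻¹p≼1 : ∀ j → coeff (c⁻¹ ·ₚ p) j ≼ 1#
        c⁻¹p≼1 j = ≼-resp (sym (coeff-· c⁻¹ p j)) (trans (*-comm c⁻¹ c) cc⁻¹≈1) (≼-*ˡ c⁻¹ (max j))

        q = proj₁ (lift-integral (c⁻¹ ·ₚ p) c⁻¹p≼1)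
        q≡ = proj₂ (lift-integral (c⁻¹ ·ₚ p) c⁻¹p≼1)

        q≉0 : ¬ (q k.≈ₚ k.0ₚ)
        q≉0 q≈0 = ≈0⇒Small (k.coeff q i) (q≈0 i) (≼-reflexive (sym (begin
          proj₁ (k.coeff q i)   ≡⟨ coeff-lifts q i ⟨
          coeff (lifts q) i     ≡⟨ ≡.cong (λ p → coeff p i) q≡ ⟩
          coeff (c⁻¹ ·ₚ p) i    ≈⟨ coeff-· c⁻¹ p i ⟩
          c⁻¹ * c               ≈⟨ trans (*-comm c⁻¹ c) cc⁻¹≈1 ⟩
          1#                    ∎)))
          where open import Relation.Binary.Reasoning.Setoid setoid

        module kA = AlgebraicallyClosed em residue residue-closed

        -- Divided by its largest coefficient c, p becomes q with nonzero reduction. The product of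
        -- the reductions of a and q is then nonzero, and at a point η off its zeros a(η) is a unit
        -- and |p(η)| is at least |c|.
        η = proj₁ (kA.nonroot (a k.*ₚ q) (k.*ₚ-≉0 a q a≉0 q≉0))

        aq≉0 : ¬ (k.eval a η 𝒪.* k.eval q η 𝒪.≈ 𝒪.0#)
        aq≉0 e = proj₂ (kA.nonroot (a k.*ₚ q) (k.*ₚ-≉0 a q a≉0 q≉0))
            (≈-trans (k.eval (a k.*ₚ q) η) (k.eval a η 𝒪.* k.eval q η) 𝒪.0# (k.eval-* a q η) e)

        1≼a[η] : 1# ≼ eval (lifts a) (proj₁ η)
        1≼a[η] = ≼-resp refl (reflexive (≡.sym (eval-lifts a η)))
          (≉0⇒1≼ (k.eval a η) (λ e → aq≉0 (≈-trans (k.eval a η 𝒪.* k.eval q η) (𝒪.0# 𝒪.* k.eval q η) 𝒪.0#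
            (*-cong′ (k.eval a η) 𝒪.0# (k.eval q η) (k.eval q η) e (≈⇒≈ (k.eval q η) (k.eval q η) refl))
                (k.zeroˡ (k.eval q η)))))

        1≼q[η] : 1# ≼ eval (lifts q) (proj₁ η)
        1≼q[η] = ≼-resp refl (reflexive (≡.sym (eval-lifts q η)))
          (≉0⇒1≼ (k.eval q η) (λ e → aq≉0 (≈-trans (k.eval a η 𝒪.* k.eval q η) (k.eval a η 𝒪.* 𝒪.0#) 𝒪.0#
            (*-cong′ (k.eval a η) (k.eval a η) (k.eval q η) 𝒪.0# (≈⇒≈ (k.eval a η) (k.eval a η) refl) e)
                (k.zeroʳ (k.eval a η)))))

        c≼p[η] : c ≼ eval p (proj₁ η)
        c≼p[η] = ≼-resp (*-identityʳ c) (begin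
          c * eval (lifts q) (proj₁ η)         ≡⟨ ≡.cong (λ p → c * eval p (proj₁ η)) q≡ ⟩
          c * eval (c⁻¹ ·ₚ p) (proj₁ η)        ≈⟨ *-congˡ (eval-· c⁻¹ p (proj₁ η)) ⟩
          c * (c⁻¹ * eval p (proj₁ η))
              ≈⟨ trans (sym (*-assoc c c⁻¹ _)) (trans (*-congʳ cc⁻¹≈1) (*-identityˡ _)) ⟩
          eval p (proj₁ η)                     ∎) (≼-*ˡ c 1≼q[η])
          where open import Relation.Binary.Reasoning.Setoid setoid

-- The maximum norm on the plane

module Norms (em : ∀ {a} → ExcludedMiddle a) {r ℓr₁ ℓr₂ l ℓl} (ℝ : CompleteOrderedField r ℓr₁ ℓr₂)
  (L : Field l ℓl) (v : NonArchimedeanAbsoluteValue ℝ L) where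
  open Field L hiding (zero)
  open Plane em L
  open Valuation em ℝ L v

  -- m has the absolute value max(|s|, |t|).
  Norm : V → Carrier → Set ℓr₂
  Norm (s , t) m = s ≼ m × t ≼ m × (m ≼ s ⊎ m ≼ t)

  -- The maximum is attained by a coordinate, so every norm is the size of an element of L and can
  -- be divided out there.
  norm-exists : ∀ v → ∃ (Norm v)
  norm-exists (s , t) with ≼-total s t
  ... | inj₁ s≼t = t , s≼t , ≼-refl , inj₂ ≼-refl
  ... | inj₂ t≼s = s , ≼-refl , t≼s , inj₁ ≼-refl

  norm-equiv : ∀ v {m m′} → m ≼ m′ → m′ ≼ m → Norm v m → Norm v m′
  norm-equiv v m≼m′ m′≼m (s≼ , t≼ , inj₁ ≼s) = ≼-trans s≼ m≼m′ , ≼-trans t≼ m≼m′ , inj₁ (≼-trans m′≼m ≼s)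
  norm-equiv v m≼m′ m′≼m (s≼ , t≼ , inj₂ ≼t) = ≼-trans s≼ m≼m′ , ≼-trans t≼ m≼m′ , inj₂ (≼-trans m′≼m ≼t)

  norm-respⱽ : ∀ {u v m} → u ≈ⱽ v → Norm u m → Norm v m
  norm-respⱽ (s≈ , t≈) (s≼ , t≼ , inj₁ ≼s) = ≼-resp s≈ refl s≼ , ≼-resp t≈ refl t≼ , inj₁
      (≼-resp refl s≈ ≼s)
  norm-respⱽ (s≈ , t≈) (s≼ , t≼ , inj₂ ≼t) = ≼-resp s≈ refl s≼ , ≼-resp t≈ refl t≼ , inj₂
      (≼-resp refl t≈ ≼t)

  norm-resp : ∀ v {m m′} → m ≈ m′ → Norm v m → Norm v m′
  norm-resp v m≈ = norm-equiv v (≼-reflexive m≈) (≼-reflexive (sym m≈))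

  norm-≼ : ∀ v {m m′} → Norm v m → Norm v m′ → m ≼ m′
  norm-≼ v (_ , _ , inj₁ m≼s) (s≼m′ , _ , _) = ≼-trans m≼s s≼m′
  norm-≼ v (_ , _ , inj₂ m≼t) (_ , t≼m′ , _) = ≼-trans m≼t t≼m′

  norm-⊙ : ∀ k v {m} → Norm v m → Norm (k ⊙ v) (k * m)
  norm-⊙ k v (s≼ , t≼ , inj₁ ≼s) = ≼-*ˡ k s≼ , ≼-*ˡ k t≼ , inj₁ (≼-*ˡ k ≼s)
  norm-⊙ k v (s≼ , t≼ , inj₂ ≼t) = ≼-*ˡ k s≼ , ≼-*ˡ k t≼ , inj₂ (≼-*ˡ k ≼t)

  norm-≉0 : ∀ v {m} → NonZero v → Norm v m → m ≉ 0#
  norm-≉0 v v≉0 (s≼ , t≼ , _) m≈0 = v≉0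
    (≼0⇒≈0 (≼-trans s≼ (≼-reflexive m≈0)) , ≼0⇒≈0 (≼-trans t≼ (≼-reflexive m≈0)))

  ∧-≼ : ∀ u w {m m′} → Norm u m → Norm w m′ → u ∧ w ≼ m * m′
  ∧-≼ u w (s≼ , t≼ , _) (s′≼ , t′≼ , _) = ≼-minus (≼-* s≼ t′≼) (≼-* t≼ s′≼)

-- Good reduction in terms of norms

module GoodReductions (em : ∀ {a} → ExcludedMiddle a) {r ℓr₁ ℓr₂ l ℓl} (ℝ : CompleteOrderedField r ℓr₁ ℓr₂)
  (L : Field l ℓl) (closed : FieldProperties.IsAlgebraicallyClosed em L) (v : NonArchimedeanAbsoluteValue ℝ L) where
  open Field L hiding (zero)
  open RationalFunctions rawRing
  open PolynomialProperties commutativeRing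
  open Evaluation commutativeRing
  open FieldProperties em L
  open AlgebraicallyClosed em L closed
  open Plane em L
  open NormalForms em L closed
  open Dynamics ℝ L v
  open Valuation em ℝ L v
  open ResidueClosed closed
  open Norms em ℝ L v
  private
    module k[z] = RationalFunctions residueField
    open RawRing residueField using () renaming (_≈_ to _≈ₖ_; 0# to 0ₖ)
    module kE = Evaluation residueRing
    module kA = AlgebraicallyClosed em residue residue-closed
    module kN = NormalForms em residue residue-closed

  -- Stands between `GoodReduction`, which chooses its own representation of the fraction, and
  -- `GoodNorm`: the integral pair is tied to the given f and g by a scalar.
  record IntegralForm (f g : Poly) (d : ℕ) : Set (l ⊔ ℓl ⊔ ℓr₁ ⊔ ℓr₂) where
    field
      unit         : Carrier
      unit≉0       : unit ≉ 0#
      f̃ g̃          : List 𝒪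
      f≈           : f ≈ₚ unit ·ₚ lifts f̃
      g≈           : g ≈ₚ unit ·ₚ lifts g̃
      nonVanishing : kA.NonVanishing f̃ g̃ d

    form-f : ∀ s t → form f d (proj₁ s) (proj₁ t) ≈ unit * proj₁ (kE.form f̃ d s t)
    form-f s t = trans (form-congˡ f (unit ·ₚ lifts f̃) d _ _ f≈)
      (trans (form-· unit (lifts f̃) d _ _) (*-congˡ (reflexive (form-lifts f̃ d s t))))

    form-g : ∀ s t → form g d (proj₁ s) (proj₁ t) ≈ unit * proj₁ (kE.form g̃ d s t)
    form-g s t = trans (form-congˡ g (unit ·ₚ lifts g̃) d _ _ g≈)
      (trans (form-· unit (lifts g̃) d _ _) (*-congˡ (reflexive (form-lifts g̃ d s t))))

  -- ‖Φ(w)‖ = |r| ‖w‖ᵈ for all w.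
  GoodNorm : (f g : Poly) (d : ℕ) → Set (l ⊔ ℓl ⊔ ℓr₂)
  GoodNorm f g d = ∃ λ r → r ≉ 0# × (∀ w m → Norm w m → Norm (value f g d w) (r * m ^ d))

  module _ {f g n} (df : DegreeAtMost f (suc n)) (dg : DegreeAtMost g (suc n)) where
    private
      d : ℕ
      d = suc n

    -- A vector of norm 1 has nonzero reduction, where one of the reduced forms does not vanish; so
    -- a coordinate of its image has exactly the size of the unit. Homogeneity covers the other
    -- nonzero vectors.
    integral⇒goodNorm : IntegralForm f g d → GoodNorm f g d
    integral⇒goodNorm integralForm = unit , unit≉0 , norm
      where
      open IntegralForm integralForm

      unit-norm : ∀ (s t : 𝒪) → 1# ≼ proj₁ s ⊎ 1# ≼ proj₁ t → Norm (value f g d (proj₁ s , proj₁ t)) unit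
      unit-norm s t st = norm-respⱽ (sym (form-f s t) , sym (form-g s t))
        (norm-resp (unit ⊙ w) (*-identityʳ unit) (norm-⊙ unit w
          (≤1⇒≼1 (proj₂ (kE.form f̃ d s t)) , ≤1⇒≼1 (proj₂ (kE.form g̃ d s t)) , unital)))
        where
        w : V
        w = proj₁ (kE.form f̃ d s t) , proj₁ (kE.form g̃ d s t)

        reduced-nonZero : Small (proj₁ s) → Small (proj₁ t) → ⊥
        reduced-nonZero s-small t-small = [ s-small , t-small ]′ st

        unital : 1# ≼ proj₁ w ⊎ 1# ≼ proj₂ w
        unital with em {P = 1# ≼ proj₁ w} | em {P = 1# ≼ proj₂ w}
        ... | yes 1≼f | _       = inj₁ 1≼f
        ... | no _    | yes 1≼g = inj₂ 1≼g
        ... | no sf   | no sg   =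
            ⊥-elim (reduced-nonZero (≈0⇒Small s (proj₁ st≈0)) (≈0⇒Small t (proj₂ st≈0)))
          where st≈0 = nonVanishing s t (Small⇒≈0 (kE.form f̃ d s t) sf) (Small⇒≈0 (kE.form g̃ d s t) sg)

      norm : ∀ w m → Norm w m → Norm (value f g d w) (unit * m ^ d)
      norm (s , t) m st∼m@(s≼m , t≼m , _) with m ≈? 0#
      -- Here w = 0, and both sides vanish because d is positive.
      ... | yes m≈0 = norm-respⱽ (sym (vanish f df) , sym (vanish g dg))
          (norm-resp (0# , 0#) (sym rm≈0) (≼-refl , ≼-refl , inj₁ ≼-refl))
        where
        vanish : ∀ p → DegreeAtMost p d → form p d s t ≈ 0#
        vanish p dp = trans (form-[s,0] p d s (≼0⇒≈0 (≼-trans t≼m (≼-reflexive m≈0))) dp)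
          (trans (*-congʳ (trans (*-congʳ (≼0⇒≈0 (≼-trans s≼m (≼-reflexive m≈0)))) (zeroˡ _))) (zeroˡ _))
        rm≈0 : unit * m ^ d ≈ 0#
        rm≈0 = trans (*-congˡ (trans (*-congʳ m≈0) (zeroˡ _))) (zeroʳ unit)
      ... | no m≉0 = norm-respⱽ (sym (scaled f df) , sym (scaled g dg))
        (norm-resp (m ^ d ⊙ value f g d (proj₁ s′ , proj₁ t′)) (*-comm _ unit)
          (norm-⊙ (m ^ d) (value f g d (proj₁ s′ , proj₁ t′))
              (unit-norm s′ t′ (unital (proj₂ (proj₂ st∼m))))))
        where
        m⁻¹ = proj₁ (invertible m≉0)
        mm⁻¹≈1 = proj₂ (invertible m≉0)

        integral : ∀ {x} → x ≼ m → m⁻¹ * x ≼ 1#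
        integral x≼m = ≼-resp refl (trans (*-comm m⁻¹ m) mm⁻¹≈1) (≼-*ˡ m⁻¹ x≼m)

        s′ t′ : 𝒪
        s′ = m⁻¹ * s , ≼1⇒≤1 (integral s≼m)
        t′ = m⁻¹ * t , ≼1⇒≤1 (integral t≼m)

        unital : m ≼ s ⊎ m ≼ t → 1# ≼ proj₁ s′ ⊎ 1# ≼ proj₁ t′
        unital (inj₁ m≼s) = inj₁ (≼-resp (trans (*-comm m⁻¹ m) mm⁻¹≈1) refl (≼-*ˡ m⁻¹ m≼s))
        unital (inj₂ m≼t) = inj₂ (≼-resp (trans (*-comm m⁻¹ m) mm⁻¹≈1) refl (≼-*ˡ m⁻¹ m≼t))

        restore : ∀ x → x ≈ m * (m⁻¹ * x)
        restore x = sym (trans (sym (*-assoc m m⁻¹ x)) (trans (*-congʳ mm⁻¹≈1) (*-identityˡ x)))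

        scaled : ∀ p → DegreeAtMost p d → form p d s t ≈ m ^ d * form p d (proj₁ s′) (proj₁ t′)
        scaled p dp = trans (form-cong p d (restore s) (restore t))
            (form-scale p d m (proj₁ s′) (proj₁ t′) dp)

    -- At (η , 1) with η integral the forms have size at most |r|, so Gauss's bound makes f / r and
    -- g / r integral. A common zero of their reductions would come from a vector of norm 1 whose
    -- image is smaller than r.
    goodNorm⇒integral : GoodNorm f g d → IntegralForm f g d
    goodNorm⇒integral (r , r≉0 , norm) = record
      { unit = r ; unit≉0 = r≉0 ; f̃ = f̃ ; g̃ = g̃
      ; f≈ = lifted f f̃ f̃≡
      ; g≈ = lifted g g̃ g̃≡
      ; nonVanishing = λ s t F≈0 G≈0 →
          let sf = ≈0⇒Small (kE.form f̃ d s t) F≈0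
              sg = ≈0⇒Small (kE.form g̃ d s t) G≈0
          in Small⇒≈0 s (λ 1≼s → contra s t (inj₁ 1≼s) sf sg) , Small⇒≈0 t
              (λ 1≼t → contra s t (inj₂ 1≼t) sf sg)
      }
      where
      r⁻¹ = proj₁ (invertible r≉0)
      rr⁻¹≈1 = proj₂ (invertible r≉0)

      r1ᵈ≈r : r * 1# ^ d ≈ r
      r1ᵈ≈r = trans (*-congˡ (1^n≈1 d)) (*-identityʳ r)

      unit-norm : ∀ (s t : 𝒪) → 1# ≼ proj₁ s ⊎ 1# ≼ proj₁ t → Norm (value f g d (proj₁ s , proj₁ t)) r
      unit-norm s t st = norm-resp (value f g d (proj₁ s , proj₁ t)) r1ᵈ≈r
        (norm (proj₁ s , proj₁ t) 1# (≤1⇒≼1 (proj₂ s) , ≤1⇒≼1 (proj₂ t) , st))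

      1̃ : 𝒪
      1̃ = RawRing.1# residueField

      bounded : ∀ p → (∀ (η : 𝒪) → form p d (proj₁ η) 1# ≼ r) → ∀ n → coeff (r⁻¹ ·ₚ p) n ≼ 1#
      bounded p p≼r n = ≼-resp (sym (coeff-· r⁻¹ p n)) (trans (*-comm r⁻¹ r) rr⁻¹≈1) (≼-*ˡ r⁻¹
        -- All integral η satisfy the bound, so none has to be avoided and the auxiliary polynomial
        -- is 1.
        (gauss p r k[z].1ₚ (λ 1≈0 → ≈0⇒Small 1̃ (1≈0 0) ≼-refl)
          (λ η _ → ≼-resp (form-[x,1] p d (proj₁ η)) refl (p≼r η)) n))

      f̃ g̃ : List 𝒪
      f̃ = proj₁ (lift-integral (r⁻¹ ·ₚ f) (bounded f (λ η → proj₁ (unit-norm η 1̃ (inj₂ ≼-refl)))))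
      g̃ = proj₁ (lift-integral (r⁻¹ ·ₚ g) (bounded g (λ η → proj₁ (proj₂ (unit-norm η 1̃ (inj₂ ≼-refl))))))

      f̃≡ : lifts f̃ ≡ r⁻¹ ·ₚ f
      f̃≡ = proj₂ (lift-integral (r⁻¹ ·ₚ f) (bounded f (λ η → proj₁ (unit-norm η 1̃ (inj₂ ≼-refl)))))

      g̃≡ : lifts g̃ ≡ r⁻¹ ·ₚ g
      g̃≡ = proj₂ (lift-integral (r⁻¹ ·ₚ g)
          (bounded g (λ η → proj₁ (proj₂ (unit-norm η 1̃ (inj₂ ≼-refl))))))

      lifted : ∀ p p̃ → lifts p̃ ≡ r⁻¹ ·ₚ p → p ≈ₚ r ·ₚ lifts p̃
      lifted p p̃ p̃≡ n = sym (begin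
        coeff (r ·ₚ lifts p̃) n        ≡⟨ ≡.cong (λ q → coeff (r ·ₚ q) n) p̃≡ ⟩
        coeff (r ·ₚ (r⁻¹ ·ₚ p)) n     ≈⟨ trans (coeff-· r (r⁻¹ ·ₚ p) n) (*-congˡ (coeff-· r⁻¹ p n)) ⟩
        r * (r⁻¹ * coeff p n)
            ≈⟨ trans (sym (*-assoc r r⁻¹ _)) (trans (*-congʳ rr⁻¹≈1) (*-identityˡ _)) ⟩
        coeff p n                     ∎)
        where open import Relation.Binary.Reasoning.Setoid setoid

      form≈ : ∀ p p̃ → lifts p̃ ≡ r⁻¹ ·ₚ p → ∀ s t → form p d (proj₁ s) (proj₁ t) ≈ r * proj₁
          (kE.form p̃ d s t)
      form≈ p p̃ p̃≡ s t = trans (form-congˡ p (r ·ₚ lifts p̃) d _ _ (lifted p p̃ p̃≡))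
        (trans (form-· r (lifts p̃) d _ _) (*-congˡ (reflexive (form-lifts p̃ d s t))))

      unital : ∀ {x y} → x ≈ r * y → r ≼ x → 1# ≼ y
      unital x≈ry r≼x = ≼-cancelˡ r≉0 (≼-resp (sym (*-identityʳ r)) x≈ry r≼x)

      contra : ∀ s t → 1# ≼ proj₁ s ⊎ 1# ≼ proj₁ t → Small (proj₁ (kE.form f̃ d s t)) →
          Small (proj₁ (kE.form g̃ d s t)) → ⊥
      contra s t st sf sg = [ (λ r≼f → sf (unital (form≈ f f̃ f̃≡ s t) r≼f))
                            , (λ r≼g → sg (unital (form≈ g g̃ g̃≡ s t) r≼g)) ]′
                                (proj₂ (proj₂ (unit-norm s t st)))

  module _ {χ f g n} (nf : NormalForm χ f g (suc n)) where
    private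
      d : ℕ
      d = suc n
      module N = NormalForm nf

    -- Coprime representations differ by a scalar, which is the unit. The reduced pair still has a
    -- quotient of degree d, so no common zero can have been cancelled from it.
    goodReduction⇒integral : GoodReduction χ → IntegralForm f g d
    goodReduction⇒integral gr = record
      { unit = e ; unit≉0 = proj₁ (proj₂ factor) ; f̃ = GR.f ; g̃ = GR.g
      ; f≈ = proj₁ (proj₂ (proj₂ factor)) ; g≈ = proj₂ (proj₂ (proj₂ factor))
      ; nonVanishing = kN.fullDegree⇒nonVanishing {GR.f} {GR.g} {d} reduced-degree
          (degree-lifts GR.f d lifted.degree-num) (degree-lifts GR.g d lifted.degree-den)
      }
      where
      module GR = GoodReduction gr
      factor : ∃ λ e → e ≉ 0# × f ≈ₚ e ·ₚ lifts GR.f × g ≈ₚ e ·ₚ lifts GR.g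
      factor = N.proportional (lifts GR.f) (lifts GR.g) GR.represents (λ {z} → GR.coprime {z})

      e : Carrier
      e = proj₁ factor

      module lifted = NormalForm (rescale nf {lifts GR.f} {lifts GR.g} e (proj₁ (proj₂ factor))
          (proj₁ (proj₂ (proj₂ factor))) (proj₂ (proj₂ (proj₂ factor))))

      reduced-degree : k[z].HasDegree (GR.f k[z]./ GR.g) d
      reduced-degree = ≡.subst (k[z].HasDegree (GR.f k[z]./ GR.g)) (degree-unique nf GR.deg-φ) GR.deg-φ̄

    private
      unit-coefficient : ∀ p n → 1# ≼ proj₁ (k[z].coeff p n) →
          Any (λ x → CompleteOrderedField._≈_ ℝ (NonArchimedeanAbsoluteValue.∣_∣ᵥ v (proj₁ x))
          (CompleteOrderedField.1# ℝ)) p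
      unit-coefficient []      n       1≼0 = contradiction (≼0⇒≈0 1≼0) 1≉0
      unit-coefficient (a ∷ p) zero    1≼a = here (≼∧≽⇒≈1 (≤1⇒≼1 (proj₂ a)) 1≼a)
      unit-coefficient (a ∷ p) (suc n) 1≼p = there (unit-coefficient p n 1≼p)

    integral⇒goodReduction : IntegralForm f g d → GoodReduction χ
    integral⇒goodReduction integralForm = record
      { f = f̃ ; g = g̃
      ; represents = lifted.represents
      ; coprime    = λ {z} → lifted.coprime {z}
      -- The reduced forms do not both vanish at (1 : 0), so one of the two coefficients at d is a
      -- unit.
      ; unitCoeff  = unit-coefficients
          (proj₂ (proj₂ (kA.nonVanishing⇒maxDegree {f̃} {g̃} {d} df̃ dg̃ nonVanishing)))
      ; degree     = d
      ; deg-φ      = N.hasDegree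
      ; deg-φ̄      = kN.NormalForm.hasDegree reduced
      }
      where
      open IntegralForm integralForm
      module lifted = NormalForm (rescale nf {lifts f̃} {lifts g̃} unit unit≉0 f≈ g≈)

      df̃ : k[z].DegreeAtMost f̃ d
      df̃ = degree-lifts f̃ d lifted.degree-num

      dg̃ : k[z].DegreeAtMost g̃ d
      dg̃ = degree-lifts g̃ d lifted.degree-den

      reduced : kN.NormalForm (f̃ k[z]./ g̃) f̃ g̃ d
      reduced = record
        { represents   = kN.represents-self {f̃} {g̃} (kN.nonVanishing⇒determinate f̃ g̃ d nonVanishing)
        ; degree-num   = df̃
        ; degree-den   = dg̃
        ; nonVanishing = nonVanishing
        }

      unit-coefficients : ¬ (k[z].coeff f̃ d ≈ₖ 0ₖ) ⊎ ¬ (k[z].coeff g̃ d ≈ₖ 0ₖ) → Any _ f̃ ⊎ Any _ g̃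
      unit-coefficients (inj₁ f̃≉0) = inj₁ (unit-coefficient f̃ d (≉0⇒1≼ (k[z].coeff f̃ d) f̃≉0))
      unit-coefficients (inj₂ g̃≉0) = inj₂ (unit-coefficient g̃ d (≉0⇒1≼ (k[z].coeff g̃ d) g̃≉0))

-- Points with distinct reductions

module Separation (em : ∀ {a} → ExcludedMiddle a) {r ℓr₁ ℓr₂ l ℓl} (ℝ : CompleteOrderedField r ℓr₁ ℓr₂)
  (L : Field l ℓl) (closed : FieldProperties.IsAlgebraicallyClosed em L) (v : NonArchimedeanAbsoluteValue ℝ L) where
  open Field L hiding (zero)
  open IntegerRingSolver commutativeRing
  open RationalFunctions rawRing
  open PolynomialProperties commutativeRing
  open Evaluation commutativeRing
  open FieldProperties em L
  open Plane em L
  open NormalForms em L closed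
  open Multipliers em L closed
  open Dynamics ℝ L v
  open Valuation em ℝ L v
  open ResidueClosed closed
  open Norms em ℝ L v
  open GoodReductions em ℝ L closed v
  private
    module k[z] = RationalFunctions residueField
    module kE = Evaluation residueRing
    module kP = Plane em residue

  -- The reductions of u and w in the projective line over the residue field
  -- are distinct.
  Separated : V → V → Set (l ⊔ ℓr₂)
  Separated u w = ∀ m m′ → Norm u m → Norm w m′ → m * m′ ≼ u ∧ w

  separated-by : ∀ u w {m m′} → Norm u m → Norm w m′ → m * m′ ≼ u ∧ w → Separated u w
  separated-by u w um wm′ mm′≼ m₁ m₁′ um₁ wm₁′ = ≼-trans (≼-* (norm-≼ u um₁ um) (norm-≼ w wm₁′ wm′)) mm′≼

  separated-sym : ∀ u w → Separated u w → Separated w u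
  separated-sym u w sep m m′ wm um′ = ≼-resp (*-comm m′ m) refl (≼-trans (sep m′ m um′ wm)
    (≼-trans (≼-reflexive (∧-anti u w)) (≼-neg (w ∧ u))))

  ∧-⊙⊙ : ∀ a u b w → (a ⊙ u) ∧ (b ⊙ w) ≈ (a * b) * (u ∧ w)
  ∧-⊙⊙ a u b w = trans (∧-⊙ˡ a u (b ⊙ w)) (trans (*-congˡ (∧-⊙ʳ u b w)) (sym (*-assoc a b _)))

  separated-multiple : ∀ {u w u′ w′ a b} → a ≉ 0# → b ≉ 0# → u ≈ⱽ a ⊙ u′ → w ≈ⱽ b ⊙ w′ → Separated u w →
      Separated u′ w′
  separated-multiple {u} {w} {u′} {w′} {a} {b} a≉0 b≉0 (u₁ , u₂) (w₁ , w₂) sep m m′ u′m w′m′ =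
      ≼-cancelˡ (*-≉0 a≉0 b≉0)
    (≼-resp (solve 4 (λ a b m m′ → (a :* m) :* (b :* m′) := (a :* b) :* (m :* m′)) refl a b m m′)
      (trans (∧-cong {u} {a ⊙ u′} {w} {b ⊙ w′} (u₁ , u₂) (w₁ , w₂)) (∧-⊙⊙ a u′ b w′))
      (sep (a * m) (b * m′) (norm-respⱽ (sym u₁ , sym u₂) (norm-⊙ a u′ u′m))
          (norm-respⱽ (sym w₁ , sym w₂) (norm-⊙ b w′ w′m′))))

  -- Norm 1 makes a representative integral with nonzero reduction, hence a point over the residue
  -- field.
  record UnitMultiple (u : V) : Set (l ⊔ ℓl ⊔ ℓr₂) where
    field
      scalar   : Carrier
      scalar≉0 : scalar ≉ 0#
      unitary  : Norm (scalar ⊙ u) 1#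

  unitMultiple : ∀ u → NonZero u → UnitMultiple u
  unitMultiple u u≉0 = record
    { scalar   = m⁻¹
    ; scalar≉0 = λ m⁻¹≈0 → 1≉0 (trans (sym mm⁻¹≈1) (trans (*-congˡ m⁻¹≈0) (zeroʳ m)))
    ; unitary  = norm-resp (m⁻¹ ⊙ u) (trans (*-comm m⁻¹ m) mm⁻¹≈1) (norm-⊙ m⁻¹ u (proj₂ (norm-exists u)))
    }
    where
    m = proj₁ (norm-exists u)
    m≉0 = norm-≉0 u u≉0 (proj₂ (norm-exists u))
    m⁻¹ = proj₁ (invertible m≉0)
    mm⁻¹≈1 = proj₂ (invertible m≉0)

  private
    inverse-multiple : ∀ {a} (a≉0 : a ≉ 0#) u → u ≈ⱽ proj₁ (invertible a≉0) ⊙ (a ⊙ u)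
    inverse-multiple {a} a≉0 (s , t) = undo s , undo t
      where
      undo : ∀ x → x ≈ proj₁ (invertible a≉0) * (a * x)
      undo x = sym (trans (sym (*-assoc _ a x))
          (trans (*-congʳ (trans (*-comm _ a) (proj₂ (invertible a≉0)))) (*-identityˡ x)))

    inverse≉0 : ∀ {a} (a≉0 : a ≉ 0#) → proj₁ (invertible a≉0) ≉ 0#
    inverse≉0 {a} a≉0 e = 1≉0 (trans (sym (proj₂ (invertible a≉0))) (trans (*-congˡ e) (zeroʳ a)))

  separated-unit : ∀ u w (u₀ : UnitMultiple u) (w₀ : UnitMultiple w) →
    1# ≼ (UnitMultiple.scalar u₀ ⊙ u) ∧ (UnitMultiple.scalar w₀ ⊙ w) → Separated u w
  separated-unit u w u₀ w₀ 1≼ = separated-multiple {U.scalar ⊙ u} {W.scalar ⊙ w} {u} {w} U.scalar≉0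
      W.scalar≉0 (refl , refl) (refl , refl)
    (separated-by (U.scalar ⊙ u) (W.scalar ⊙ w) U.unitary W.unitary (≼-resp (sym (*-identityʳ 1#)) refl 1≼))
    where
    module U = UnitMultiple u₀
    module W = UnitMultiple w₀

  separated-parallel : ∀ {A B u w} → NonZero A → NonZero B → NonZero u → NonZero w →
    u ∧ A ≈ 0# → w ∧ B ≈ 0# → Separated A B → Separated u w
  separated-parallel {A} {B} {u} {w} A≉0 B≉0 u≉0 w≉0 uA≈0 wB≈0 sep =
    separated-multiple {A} {B} {u} {w} {proj₁ a} {proj₁ b} (multiplier≉0 A u (proj₁ a) A≉0 (proj₂ a))
        (multiplier≉0 B w (proj₁ b) B≉0 (proj₂ b)) (proj₂ a) (proj₂ b) sep
    where
    a : ∃ λ a → A ≈ⱽ a ⊙ u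
    a = ∧≈0⇒multiple u A u≉0 uA≈0
    b : ∃ λ b → B ≈ⱽ b ⊙ w
    b = ∧≈0⇒multiple w B w≉0 wB≈0
    multiplier≉0 : ∀ A u a → NonZero A → A ≈ⱽ a ⊙ u → a ≉ 0#
    multiplier≉0 A u a A≉0 (e₁ , e₂) a≈0 =
        A≉0 (trans e₁ (trans (*-congʳ a≈0) (zeroˡ _)) , trans e₂ (trans (*-congʳ a≈0) (zeroˡ _)))

  private
    reduce : ∀ u → Norm u 1# → kP.V
    reduce (s , t) (s≼1 , t≼1 , _) = (s , ≼1⇒≤1 s≼1) , (t , ≼1⇒≤1 t≼1)

    reduce-nonZero : ∀ u (u₁ : Norm u 1#) → kP.NonZero (reduce u u₁)
    reduce-nonZero (s , t) (s≼1 , t≼1 , st) (s≈0 , t≈0) =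
      [ ≈0⇒Small (s , ≼1⇒≤1 s≼1) s≈0 , ≈0⇒Small (t , ≼1⇒≤1 t≼1) t≈0 ]′ st

    reduce-parallel : ∀ u w (u₁ : Norm u 1#) (w₁ : Norm w 1#) → Small (u ∧ w) → ∃ λ c →
        reduce w w₁ kP.≈ⱽ c kP.⊙ reduce u u₁
    reduce-parallel u w u₁ w₁ small = kP.∧≈0⇒multiple (reduce u u₁) (reduce w w₁) (reduce-nonZero u u₁)
      (Small⇒≈0 (reduce u u₁ kP.∧ reduce w w₁) small)

  module _ {χ f g n} (nf : NormalForm χ f g (suc n)) (good : GoodNorm f g (suc n)) where
    open NormalForm nf
    private
      d : ℕ
      d = suc n

      Φ : V → V
      Φ = value f g d

      ρ : Carrier
      ρ = proj₁ good

      ρ≉0 : ρ ≉ 0#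
      ρ≉0 = proj₁ (proj₂ good)

      Φ-norm : ∀ w → Norm w 1# → Norm (Φ w) ρ
      Φ-norm w w₁ = norm-resp (Φ w) (trans (*-congˡ (1^n≈1 d)) (*-identityʳ ρ)) (proj₂ (proj₂ good) w 1# w₁)

      -- The vector Φ(w) has norm |ρ| by good reduction and norm |ν| as a multiple of w.
      ρ-eigenvalue : ∀ w ν → Norm w 1# → Φ w ≈ⱽ ν ⊙ w → ν ≼ ρ × ρ ≼ ν
      ρ-eigenvalue w ν w₁ (e₁ , e₂) = norm-≼ (ν ⊙ w) ν-norm ρ-norm , norm-≼ (ν ⊙ w) ρ-norm ν-norm
        where
        ν-norm : Norm (ν ⊙ w) ν
        ν-norm = norm-resp (ν ⊙ w) (*-identityʳ ν) (norm-⊙ ν w w₁)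
        ρ-norm : Norm (ν ⊙ w) ρ
        ρ-norm = norm-respⱽ (e₁ , e₂) (Φ-norm w w₁)

      ρ⁻¹ : Carrier
      ρ⁻¹ = proj₁ (invertible ρ≉0)

      ρρ⁻¹≈1 : ρ * ρ⁻¹ ≈ 1#
      ρρ⁻¹≈1 = proj₂ (invertible ρ≉0)

    record Reducible (p : Poly) (m : ℕ) : Set (l ⊔ ℓl ⊔ ℓr₁ ⊔ ℓr₂) where
      field
        p̃      : List 𝒪
        degree : k[z].DegreeAtMost p̃ m
        form≈  : ∀ s t → form p m (proj₁ s) (proj₁ t) ≈ ρ * proj₁ (kE.form p̃ m s t)

    reducible : ∀ p m → DegreeAtMost p m → (∀ i → coeff p i ≼ ρ) → Reducible p m
    reducible p m dp p≼ρ = record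
      { p̃      = proj₁ p̃
      ; degree = degree-lifts (proj₁ p̃) m (≡.subst (λ q → DegreeAtMost q m) (≡.sym (proj₂ p̃))
          (degree-· ρ⁻¹ p m dp))
      ; form≈  = λ s t → begin
          form p m (proj₁ s) (proj₁ t)
              ≈⟨ trans (sym (*-assoc ρ ρ⁻¹ _)) (trans (*-congʳ ρρ⁻¹≈1) (*-identityˡ _)) ⟨
          ρ * (ρ⁻¹ * form p m (proj₁ s) (proj₁ t))
              ≈⟨ *-congˡ (form-· ρ⁻¹ p m (proj₁ s) (proj₁ t)) ⟨
          ρ * form (ρ⁻¹ ·ₚ p) m (proj₁ s) (proj₁ t)
              ≡⟨ ≡.cong (λ q → ρ * form q m (proj₁ s) (proj₁ t)) (proj₂ p̃) ⟨
          ρ * form (lifts (proj₁ p̃)) m (proj₁ s) (proj₁ t)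
              ≡⟨ ≡.cong (ρ *_) (form-lifts (proj₁ p̃) m s t) ⟩
          ρ * proj₁ (kE.form (proj₁ p̃) m s t)                 ∎
      }
      where
      open import Relation.Binary.Reasoning.Setoid setoid
      p̃ : ∃ λ q → lifts q ≡ ρ⁻¹ ·ₚ p
      p̃ = lift-integral (ρ⁻¹ ·ₚ p) (λ i → ≼-resp (sym (coeff-· ρ⁻¹ p i)) (trans (*-comm ρ⁻¹ ρ) ρρ⁻¹≈1)
          (≼-*ˡ ρ⁻¹ (p≼ρ i)))

    module _ {p m} (red : Reducible p m) where
      open Reducible red

      reducible-≼ : ∀ u → Norm u 1# → formⱽ p m u ≼ ρ
      reducible-≼ (s , t) u₁ = ≼-resp (sym (form≈ (proj₁ ũ) (proj₂ ũ))) (*-identityʳ ρ)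
        (≼-*ˡ ρ (≤1⇒≼1 (proj₂ (kE.form p̃ m (proj₁ ũ) (proj₂ ũ)))))
        where ũ = reduce (s , t) u₁

      reduced-form-Small : ∀ u (u₁ : Norm u 1#) → ¬ (ρ ≼ formⱽ p m u) →
          Small (proj₁ (kE.form p̃ m (proj₁ (reduce u u₁)) (proj₂ (reduce u u₁))))
      reduced-form-Small (s , t) u₁ small 1≼ =
          small (≼-resp (*-identityʳ ρ) (sym (form≈ (proj₁ ũ) (proj₂ ũ))) (≼-*ˡ ρ 1≼))
        where ũ = reduce (s , t) u₁

      private
        reduced-small : ∀ (ũ w̃ : kP.V) c → w̃ kP.≈ⱽ c kP.⊙ ũ →
            Small (proj₁ (kE.form p̃ m (proj₁ ũ) (proj₂ ũ))) →
                        Small (proj₁ (kE.form p̃ m (proj₁ w̃) (proj₂ w̃)))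
        reduced-small ũ w̃ c (e₁ , e₂) small = ≈0⇒Small (kE.form p̃ m (proj₁ w̃) (proj₂ w̃)) (vanish e₁ e₂)
          where
          module k = Field residue
          open import Relation.Binary.Reasoning.Setoid k.setoid
          vanish : proj₁ w̃ k.≈ c k.* proj₁ ũ → proj₂ w̃ k.≈ c k.* proj₂ ũ →
              kE.form p̃ m (proj₁ w̃) (proj₂ w̃) k.≈ k.0#
          vanish e₁ e₂ = begin
            kE.form p̃ m (proj₁ w̃) (proj₂ w̃)
              ≈⟨ kE.form-cong p̃ m {proj₁ w̃} {c k.* proj₁ ũ} {proj₂ w̃} {c k.* proj₂ ũ} e₁ e₂ ⟩
            kE.form p̃ m (c k.* proj₁ ũ) (c k.* proj₂ ũ)
              ≈⟨ kE.form-scale p̃ m c (proj₁ ũ) (proj₂ ũ) degree ⟩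
            PolynomialProperties._^_ residueRing c m k.* kE.form p̃ m (proj₁ ũ) (proj₂ ũ)
              ≈⟨ k.*-congˡ {PolynomialProperties._^_ residueRing c m} {kE.form p̃ m (proj₁ ũ) (proj₂ ũ)}
                  {k.0#} (Small⇒≈0 (kE.form p̃ m (proj₁ ũ) (proj₂ ũ)) small) ⟩
            PolynomialProperties._^_ residueRing c m k.* k.0#
              ≈⟨ k.zeroʳ (PolynomialProperties._^_ residueRing c m) ⟩
            k.0# ∎

      -- When u ∧ w is small the reductions of u and w are proportional, and a form over the residue
      -- field that vanishes at one vanishes at its multiples.
      reducible-residue : ∀ u w → Norm u 1# → Norm w 1# → Small (u ∧ w) → ρ ≼ formⱽ p m w → ρ ≼ formⱽ p m u
      reducible-residue u w u₁ w₁ small ρ≼ = decidable-stable em λ ρ⋠ →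
        reduced-small (reduce u u₁) (reduce w w₁) (proj₁ multiple) (proj₂ multiple)
            (reduced-form-Small u u₁ ρ⋠)
          (≼-cancelˡ ρ≉0 (≼-resp (sym (*-identityʳ ρ))
              (form≈ (proj₁ (reduce w w₁)) (proj₂ (reduce w w₁))) ρ≼))
        where multiple = reduce-parallel u w u₁ w₁ small

    -- By contraposition: Φ divided by ρ reduces to a map over the residue field, which sends
    -- proportional vectors to proportional vectors.
    Φ-separated : ∀ u w → NonZero u → NonZero w → Separated (Φ u) (Φ w) → Separated u w
    Φ-separated u w u≉0 w≉0 sep = separated-unit u w u₀ w₀ (decidable-stable em contra)
      where
      u₀ = unitMultiple u u≉0
      w₀ = unitMultiple w w≉0
      module U = UnitMultiple u₀
      module W = UnitMultiple w₀
      u′ = U.scalar ⊙ u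
      w′ = W.scalar ⊙ w

      form₀ : IntegralForm f g d
      form₀ = goodNorm⇒integral degree-num degree-den good

      open IntegralForm form₀ using (f̃; g̃; form-f; form-g; f≈; g≈)

      ũ w̃ Φũ Φw̃ : kP.V
      ũ = reduce u′ U.unitary
      w̃ = reduce w′ W.unitary
      Φũ = kE.form f̃ d (proj₁ ũ) (proj₂ ũ) , kE.form g̃ d (proj₁ ũ) (proj₂ ũ)
      Φw̃ = kE.form f̃ d (proj₁ w̃) (proj₂ w̃) , kE.form g̃ d (proj₁ w̃) (proj₂ w̃)

      Φu′ Φw′ : V
      Φu′ = proj₁ (proj₁ Φũ) , proj₁ (proj₂ Φũ)
      Φw′ = proj₁ (proj₁ Φw̃) , proj₁ (proj₂ Φw̃)

      sep′ : Separated (Φ u′) (Φ w′)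
      sep′ = separated-multiple {Φ u} {Φ w} {Φ u′} {Φ w′} {a⁻¹} {b⁻¹} (inverse≉0 a≉0) (inverse≉0 b≉0)
        (unscale U.scalar a≉0 u) (unscale W.scalar b≉0 w) sep
        where
        a≉0 = ^-≉0 d U.scalar≉0
        b≉0 = ^-≉0 d W.scalar≉0
        a⁻¹ = proj₁ (invertible a≉0)
        b⁻¹ = proj₁ (invertible b≉0)
        unscale : ∀ c (c^d≉0 : c ^ d ≉ 0#) u → Φ u ≈ⱽ proj₁ (invertible c^d≉0) ⊙ Φ (c ⊙ u)
        unscale c c^d≉0 u = trans (proj₁ (inverse-multiple c^d≉0 (Φ u)))
            (*-congˡ (sym (proj₁ (value-⊙ c u))))
                          , trans (proj₂ (inverse-multiple c^d≉0 (Φ u)))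
                              (*-congˡ (sym (proj₂ (value-⊙ c u))))

      lifted-lists : k[z].DegreeAtMost f̃ d × k[z].DegreeAtMost g̃ d
      lifted-lists = degree-lifts f̃ d (NormalForm.degree-num lifted) , degree-lifts g̃ d
          (NormalForm.degree-den lifted)
        where lifted = rescale nf {lifts f̃} {lifts g̃} ρ ρ≉0 f≈ g≈

      small-images : Small (u′ ∧ w′) → Small (Φu′ ∧ Φw′)
      small-images small = ≈0⇒Small (Φũ kP.∧ Φw̃) (begin
        Φũ kP.∧ Φw̃
            ≈⟨ kP.∧-cong {Φũ} {Φũ} {Φw̃} {c^d kP.⊙ Φũ} (k.refl {proj₁ Φũ} , k.refl {proj₂ Φũ}) Φw̃≈ ⟩
        Φũ kP.∧ (c^d kP.⊙ Φũ)         ≈⟨ kP.∧-⊙ʳ Φũ c^d Φũ ⟩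
        c^d k.* (Φũ kP.∧ Φũ)          ≈⟨ k.*-congˡ {c^d} {Φũ kP.∧ Φũ} {k.0#} (kP.∧-self Φũ) ⟩
        c^d k.* k.0#                  ≈⟨ k.zeroʳ c^d ⟩
        k.0#                          ∎)
        where
        module k = Field residue
        open import Relation.Binary.Reasoning.Setoid k.setoid
        multiple : ∃ λ c → w̃ kP.≈ⱽ c kP.⊙ ũ
        multiple = reduce-parallel u′ w′ U.unitary W.unitary small
        c c^d : 𝒪
        c = proj₁ multiple
        c^d = PolynomialProperties._^_ residueRing c d
        scaled : ∀ p → k[z].DegreeAtMost p d → kE.form p d (proj₁ w̃) (proj₂ w̃) k.≈ c^d k.* kE.form p d
            (proj₁ ũ) (proj₂ ũ)
        scaled p dp = begin
          kE.form p d (proj₁ w̃) (proj₂ w̃)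
            ≈⟨ kE.form-cong p d {proj₁ w̃} {c k.* proj₁ ũ} {proj₂ w̃} {c k.* proj₂ ũ}
                (proj₁ (proj₂ multiple)) (proj₂ (proj₂ multiple)) ⟩
          kE.form p d (c k.* proj₁ ũ) (c k.* proj₂ ũ)
            ≈⟨ kE.form-scale p d c (proj₁ ũ) (proj₂ ũ) dp ⟩
          c^d k.* kE.form p d (proj₁ ũ) (proj₂ ũ) ∎
        Φw̃≈ : Φw̃ kP.≈ⱽ c^d kP.⊙ Φũ
        Φw̃≈ = scaled f̃ (proj₁ lifted-lists) , scaled g̃ (proj₂ lifted-lists)

      contra : ¬ Small (u′ ∧ w′)
      contra small = small-images small (≼-cancelˡ (*-≉0 ρ≉0 ρ≉0) (≼-resp (sym (*-identityʳ (ρ * ρ)))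
        (trans (∧-cong {Φ u′} {ρ ⊙ Φu′} {Φ w′} {ρ ⊙ Φw′}
                 (form-f (proj₁ ũ) (proj₂ ũ) , form-g (proj₁ ũ) (proj₂ ũ))
                     (form-f (proj₁ w̃) (proj₂ w̃) , form-g (proj₁ w̃) (proj₂ w̃)))
               (∧-⊙⊙ ρ Φu′ ρ Φw′))
        (sep′ ρ ρ (Φ-norm u′ U.unitary) (Φ-norm w′ W.unitary))))

    module _ {P λ₀} (m : Multiplier f g n P λ₀) where
      open Multiplier m

      -- Off the residue class of P the divisor P ∧ w is a unit, and P ∧ Φ(w) has size at most |ρ|,
      -- which bounds the cofactor there. Gauss's bound shows that these points control the
      -- coefficients.
      cofactor-≼ : Norm P 1# → ∀ i → coeff cofactor i ≼ ρ
      cofactor-≼ P₁ = gauss cofactor ρ a a≉0 bound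
        where
        P̃ : kP.V
        P̃ = reduce P P₁

        a : List 𝒪
        -- The value of this polynomial at η is P ∧ (η , 1); its reduction is nonzero since P has
        -- norm 1.
        a = proj₁ P̃ ∷ RawRing.-_ residueField (proj₂ P̃) ∷ []

        a≉0 : ¬ (k[z]._≈ₚ_ a k[z].0ₚ)
        a≉0 e = reduce-nonZero P P₁
            (e 0 , Small⇒≈0 (proj₂ P̃) (λ 1≼q → ≈0⇒Small (RawRing.-_ residueField (proj₂ P̃)) (e 1)
          (≼-trans 1≼q (≼-trans (≼-reflexive (solve 1 (λ q → q := :- (:- q)) refl (proj₂ P)))
              (≼-neg (- proj₂ P))))))

        bound : ∀ (η : 𝒪) → 1# ≼ eval (lifts a) (proj₁ η) → eval cofactor (proj₁ η) ≼ ρ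
        bound η 1≼a = ≼-trans (≼-resp (*-identityˡ K) refl (≼-* {1#} {P ∧ w} {K} {K} 1≼P∧w ≼-refl))
          (≼-resp (trans (factor w) (*-congˡ (form-[x,1] cofactor n (proj₁ η)))) (*-identityˡ ρ)
              (∧-≼ P (Φ w) P₁ (Φ-norm w w₁)))
          where
          w : V
          w = proj₁ η , 1#
          K = eval cofactor (proj₁ η)
          w₁ : Norm w 1#
          w₁ = ≤1⇒≼1 (proj₂ η) , ≼-refl , inj₂ ≼-refl
          1≼P∧w : 1# ≼ P ∧ w
          1≼P∧w = ≼-resp refl (solve 3 (λ p q x → p :+ x :* ((:- q) :+ x :* con (+ 0)) := p :* con
              (+ 1) :- q :* x) refl (proj₁ P) (proj₂ P) (proj₁ η)) 1≼a

      cofactor-reducible : Norm P 1# → Reducible cofactor n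
      cofactor-reducible P₁ = reducible cofactor n degree-cofactor (cofactor-≼ P₁)

      unit-multiplier-≼1 : Norm P 1# → λ₀ ≼ 1#
      unit-multiplier-≼1 P₁ = ≼-cancelˡ {μ} (≼⇒≉0 ρ≉0 (proj₂ μ∼ρ))
          (≼-resp (*-comm λ₀ μ) (sym (*-identityʳ μ))
        (≼-trans (≼-resp cofactor-self refl (reducible-≼ (cofactor-reducible P₁) P P₁)) (proj₂ μ∼ρ)))
        where
        μ∼ρ : μ ≼ ρ × ρ ≼ μ
        μ∼ρ = ρ-eigenvalue P μ P₁ eigen

      -- The cofactor takes the value λ₀ μ at P, and |μ| = |ρ|.
      1≼multiplier⇔ : Norm P 1# → (1# ≼ λ₀ → ρ ≼ formⱽ cofactor n P) × (ρ ≼ formⱽ cofactor n P → 1# ≼ λ₀)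
      1≼multiplier⇔ P₁ =
        (λ 1≼λ → ≼-trans (proj₂ μ∼ρ)
            (≼-resp (*-identityˡ μ) (sym cofactor-self) (≼-* {1#} {λ₀} {μ} {μ} 1≼λ ≼-refl))) ,
        (λ ρ≼K → ≼-cancelˡ {μ} (≼⇒≉0 ρ≉0 (proj₂ μ∼ρ))
            (≼-resp (sym (*-identityʳ μ)) (trans cofactor-self (*-comm λ₀ μ)) (≼-trans (proj₁ μ∼ρ) ρ≼K)))
        where
        μ∼ρ : μ ≼ ρ × ρ ≼ μ
        μ∼ρ = ρ-eigenvalue P μ P₁ eigen

    multiplier-≼1 : ∀ {P λ₀} → NonZero P → Multiplier f g n P λ₀ → λ₀ ≼ 1#
    multiplier-≼1 {P} P≉0 m = unit-multiplier-≼1 (scale-multiplier nf (UnitMultiple.scalar P₀) m)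
        (UnitMultiple.unitary P₀)
      where P₀ = unitMultiple P P≉0

    private
      cancel-∧ : ∀ a u b w → a ≉ 0# → b ≉ 0# → (a ⊙ u) ∧ (b ⊙ w) ≈ 0# → u ∧ w ≈ 0#
      cancel-∧ a u b w a≉0 b≉0 e = *-cancel-≈0 (*-≉0 a≉0 b≉0) (trans (sym (∧-⊙⊙ a u b w)) e)

      scaled-∧ : ∀ a u b w → u ∧ w ≈ 0# → (a ⊙ u) ∧ (b ⊙ w) ≈ 0#
      scaled-∧ a u b w e = trans (∧-⊙⊙ a u b w) (trans (*-congˡ e) (zeroʳ _))

      Φ-scaled : ∀ a u b w → u ∧ Φ w ≈ 0# → (a ⊙ u) ∧ Φ (b ⊙ w) ≈ 0#
      Φ-scaled a u b w e = trans (∧-cong {a ⊙ u} {a ⊙ u} {Φ (b ⊙ w)} {b ^ d ⊙ Φ w} (refl , refl)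
          (value-⊙ b w)) (scaled-∧ a u (b ^ d) (Φ w) e)

    -- From P ∧ Φ(w) = 0 and P ∧ w ≠ 0 the cofactor is zero at w, while at P its size is at least
    -- |ρ|.
    preimage-separated : ∀ {P w λ₀} → NonZero P → NonZero w → Multiplier f g n P λ₀ → 1# ≼ λ₀ →
      P ∧ Φ w ≈ 0# → P ∧ w ≉ 0# → Separated P w
    preimage-separated {P} {w} {λ₀} P≉0 w≉0 m 1≼λ PΦw≈0 Pw≉0 =
        separated-unit P w P₀ w₀ (decidable-stable em contra)
      where
      P₀ = unitMultiple P P≉0
      w₀ = unitMultiple w w≉0
      module P₀ = UnitMultiple P₀
      module w₀ = UnitMultiple w₀
      P′ = P₀.scalar ⊙ P
      w′ = w₀.scalar ⊙ w
      m′ : Multiplier f g n P′ λ₀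
      m′ = scale-multiplier nf P₀.scalar m
      open Multiplier m′ using (factor; cofactor)

      K[w]≈0 : formⱽ cofactor n w′ ≈ 0#
      K[w]≈0 = *-cancel-≈0 {P′ ∧ w′}
          (λ e → Pw≉0 (cancel-∧ P₀.scalar P w₀.scalar w P₀.scalar≉0 w₀.scalar≉0 e))
        (trans (sym (factor w′)) (Φ-scaled P₀.scalar P w₀.scalar w PΦw≈0))

      contra : ¬ Small (P′ ∧ w′)
      contra small = ρ≉0 (≼0⇒≈0 (≼-trans
        (reducible-residue (cofactor-reducible m′ P₀.unitary) w′ P′ w₀.unitary P₀.unitary
          (λ 1≼ → small (≼-trans 1≼ (≼-trans (≼-reflexive (∧-anti w′ P′)) (≼-neg (P′ ∧ w′)))))
          (proj₁ (1≼multiplier⇔ m′ P₀.unitary) 1≼λ))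
        (≼-reflexive K[w]≈0)))

    -- If Φ(w) = ν w, then P ∧ Φ(w) = ν (P ∧ w), so the cofactor at w is ν. Its size is |ρ|, whereas
    -- at P the cofactor is smaller because λ₀ is.
    fixedPoint-separated : ∀ {P w λ₀} → NonZero P → NonZero w → Multiplier f g n P λ₀ → Small λ₀ →
      w ∧ Φ w ≈ 0# → P ∧ w ≉ 0# → Separated P w
    fixedPoint-separated {P} {w} {λ₀} P≉0 w≉0 m small-λ wΦw≈0 Pw≉0 =
        separated-unit P w P₀ w₀ (decidable-stable em contra)
      where
      P₀ = unitMultiple P P≉0
      w₀ = unitMultiple w w≉0
      module P₀ = UnitMultiple P₀
      module w₀ = UnitMultiple w₀
      P′ = P₀.scalar ⊙ P
      w′ = w₀.scalar ⊙ w
      m′ : Multiplier f g n P′ λ₀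
      m′ = scale-multiplier nf P₀.scalar m
      open Multiplier m′ using (factor; cofactor)

      P′w′≉0 : P′ ∧ w′ ≉ 0#
      P′w′≉0 e = Pw≉0 (cancel-∧ P₀.scalar P w₀.scalar w P₀.scalar≉0 w₀.scalar≉0 e)

      eigenvalue : ∃ λ ν → Φ w′ ≈ⱽ ν ⊙ w′
      eigenvalue = ∧≈0⇒multiple w′ (Φ w′) (λ (s≈0 , t≈0) →
          w≉0 (*-cancel-≈0 w₀.scalar≉0 s≈0 , *-cancel-≈0 w₀.scalar≉0 t≈0))
        (Φ-scaled w₀.scalar w w₀.scalar w wΦw≈0)

      ν = proj₁ eigenvalue

      K[w]≈ν : formⱽ cofactor n w′ ≈ ν
      K[w]≈ν = *-cancelˡ-≈ P′w′≉0 (trans (sym (factor w′))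
        (trans (∧-cong {P′} {P′} {Φ w′} {ν ⊙ w′} (refl , refl) (proj₂ eigenvalue))
            (trans (∧-⊙ʳ P′ ν w′) (*-comm ν _))))

      contra : ¬ Small (P′ ∧ w′)
      contra small = small-λ (proj₂ (1≼multiplier⇔ m′ P₀.unitary)
        (reducible-residue (cofactor-reducible m′ P₀.unitary) P′ w′ P₀.unitary w₀.unitary small
          (≼-resp refl (sym K[w]≈ν) (proj₂ (ρ-eigenvalue w′ ν w₀.unitary (proj₂ eigenvalue))))))

-- Norms in two coordinate systems

module Comparison (em : ∀ {a} → ExcludedMiddle a) {r ℓr₁ ℓr₂ l ℓl} (ℝ : CompleteOrderedField r ℓr₁ ℓr₂)
  (L : Field l ℓl) (closed : FieldProperties.IsAlgebraicallyClosed em L) (v : NonArchimedeanAbsoluteValue ℝ L) where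
  open Field L hiding (zero)
  open IntegerRingSolver commutativeRing
  open RationalFunctions rawRing
  open PolynomialProperties commutativeRing
  open FieldProperties em L
  open Plane em L
  open NormalForms em L closed
  open LinearChange em L closed
  open Valuation em ℝ L v
  open Norms em ℝ L v
  open GoodReductions em ℝ L closed v
  open Separation em ℝ L closed v

  norm-cancel-⊙ : ∀ k v {m} → k ≉ 0# → Norm (k ⊙ v) (k * m) → Norm v m
  norm-cancel-⊙ k v k≉0 (s≼ , t≼ , inj₁ ≼s) = ≼-cancelˡ k≉0 s≼ , ≼-cancelˡ k≉0 t≼ , inj₁ (≼-cancelˡ k≉0 ≼s)
  norm-cancel-⊙ k v k≉0 (s≼ , t≼ , inj₂ ≼t) = ≼-cancelˡ k≉0 s≼ , ≼-cancelˡ k≉0 t≼ , inj₂ (≼-cancelˡ k≉0 ≼t)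

  private
    divide : ∀ {x} (x≉0 : x ≉ 0#) y → x * (proj₁ (invertible x≉0) * y) ≈ y
    divide {x} x≉0 y = trans (sym (*-assoc x _ y))
        (trans (*-congʳ (proj₂ (invertible x≉0))) (*-identityˡ y))

    inverse≉0 : ∀ {x} (x≉0 : x ≉ 0#) → proj₁ (invertible x≉0) ≉ 0#
    inverse≉0 {x} x≉0 e = 1≉0 (trans (sym (proj₂ (invertible x≉0))) (trans (*-congˡ e) (zeroʳ x)))

  module _ {φ f g n} (nf : NormalForm φ f g n) where
    open NormalForm nf
    private
      Φ : V → V
      Φ = value f g n

    -- ‖hΦ(w)‖ = |r| ‖hw‖ⁿ for all w.
    GoodAt : PGL₂ → Set _
    GoodAt h = ∃ λ r → r ≉ 0# × (∀ w m → Norm (apply h w) m → Norm (apply h (Φ w)) (r * m ^ n))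

    module _ (h : PGL₂) where
      open PGL₂ h using (det≉0)
      open Conjugate h nf using (value-conjugate)
      private
        Ψ : V → V
        Ψ = value (conjugate-num h f g n) (conjugate-den h f g n) n

        δⁿ≉0 : δ h ^ n ≉ 0#
        δⁿ≉0 = ^-≉0 n det≉0

      -- The adjugate in place of the inverse of h costs the factor δⁿ.
      conjugate-apply : ∀ w → Ψ (apply h w) ≈ⱽ δ h ^ n ⊙ apply h (Φ w)
      conjugate-apply w = trans (proj₁ (value-conjugate (apply h w)))
          (trans (proj₁ (apply-cong h Φ≈)) (proj₁ (apply-⊙ h (δ h ^ n) (Φ w))))
                        , trans (proj₂ (value-conjugate (apply h w)))
                            (trans (proj₂ (apply-cong h Φ≈)) (proj₂ (apply-⊙ h (δ h ^ n) (Φ w))))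
        where
        Φ≈ : Φ (adjugate h (apply h w)) ≈ⱽ δ h ^ n ⊙ Φ w
        Φ≈ = trans (proj₁ (value-cong (adjugate-apply h w))) (proj₁ (value-⊙ (δ h) w))
           , trans (proj₂ (value-cong (adjugate-apply h w))) (proj₂ (value-⊙ (δ h) w))

      conjugate-∧ : ∀ u w → u ∧ Φ w ≈ 0# → apply h u ∧ Ψ (apply h w) ≈ 0#
      conjugate-∧ u w e = trans (∧-cong {apply h u} {apply h u} {Ψ (apply h w)} {δ h ^ n ⊙ apply h (Φ w)}
          (refl , refl) (conjugate-apply w))
        (trans (∧-⊙ʳ (apply h u) (δ h ^ n) (apply h (Φ w)))
          (trans (*-congˡ (trans (apply-∧ h u (Φ w)) (trans (*-congˡ e) (zeroʳ _)))) (zeroʳ _)))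

      goodNorm⇒goodAt : GoodNorm (conjugate-num h f g n) (conjugate-den h f g n) n → GoodAt h
      goodNorm⇒goodAt (r , r≉0 , norm) = s * r , *-≉0 (inverse≉0 δⁿ≉0) r≉0 , λ w m wm →
        norm-cancel-⊙ (δ h ^ n) (apply h (Φ w)) δⁿ≉0
            (norm-respⱽ (conjugate-apply w) (norm-resp (Ψ (apply h w))
          (sym (trans (*-congˡ (*-assoc s r (m ^ n))) (divide δⁿ≉0 (r * m ^ n)))) (norm (apply h w) m wm)))
        where
        s : Carrier
        s = proj₁ (invertible δⁿ≉0)

      goodAt⇒goodNorm : GoodAt h → GoodNorm (conjugate-num h f g n) (conjugate-den h f g n) n
      goodAt⇒goodNorm (r , r≉0 , norm) = r * δ h ^ n , *-≉0 r≉0 δⁿ≉0 , λ w m wm →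
        norm-respⱽ (sym (proj₁ (value-conjugate w)) , sym (proj₂ (value-conjugate w)))
          (norm-resp (apply h (Φ (adjugate h w)))
            (trans (*-congˡ (^-distrib-* (δ h) m n)) (sym (*-assoc r (δ h ^ n) (m ^ n))))
            (norm (adjugate h w) (δ h * m)
              (norm-respⱽ (sym (proj₁ (apply-adjugate h w)) , sym (proj₂ (apply-adjugate h w)))
                  (norm-⊙ (δ h) w wm))))

    -- Writing ‖w‖ₕ for ‖hw‖ and ‖w‖ₖ for ‖kw‖, ‖Φ(w)‖ₕ = |σ| ‖Φ(w)‖ₖ = |σ r| ‖w‖ₖⁿ = |σ r / σⁿ|
    -- ‖w‖ₕⁿ, which gives the new constant.
    proportional-goodAt : ∀ k h σ → σ ≉ 0# → (∀ w m → Norm (apply k w) m → Norm (apply h w) (σ * m)) →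
        GoodAt k → GoodAt h
    proportional-goodAt k h σ σ≉0 compare (r , r≉0 , norm) =
        (σ * r) * s , *-≉0 (*-≉0 σ≉0 r≉0) (inverse≉0 σⁿ≉0) , λ w m′ wm′ →
      let m , wm = norm-exists (apply k w)
          m′∼ = norm-cong (norm-≼ (apply h w) wm′ (compare w m wm))
              (norm-≼ (apply h w) (compare w m wm) wm′)
      in norm-equiv (apply h (Φ w)) (≼-resp (rewrite-scalar m) refl (≼-*ˡ ((σ * r) * s) (proj₂ m′∼)))
          (≼-resp refl (rewrite-scalar m) (≼-*ˡ ((σ * r) * s) (proj₁ m′∼)))
           (compare (Φ w) (r * m ^ n) (norm w m wm))
      where
      σⁿ≉0 : σ ^ n ≉ 0#
      σⁿ≉0 = ^-≉0 n σ≉0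

      s : Carrier
      s = proj₁ (invertible σⁿ≉0)

      ^-mono : ∀ k {x y} → x ≼ y → x ^ k ≼ y ^ k
      ^-mono zero    x≼y = ≼-refl
      ^-mono (suc k) x≼y = ≼-* x≼y (^-mono k x≼y)

      norm-cong : ∀ {x y} → x ≼ y → y ≼ x → x ^ n ≼ y ^ n × y ^ n ≼ x ^ n
      norm-cong x≼y y≼x = ^-mono n x≼y , ^-mono n y≼x

      rewrite-scalar : ∀ m → ((σ * r) * s) * (σ * m) ^ n ≈ σ * (r * m ^ n)
      rewrite-scalar m = trans (*-congˡ (^-distrib-* σ m n))
        (trans (solve 5 (λ σ r s σⁿ mⁿ → ((σ :* r) :* s) :* (σⁿ :* mⁿ) := σⁿ :* (s :* (σ :* (r :* mⁿ))))
            refl σ r s (σ ^ n) (m ^ n))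
          (divide σⁿ≉0 (σ * (r * m ^ n))))

  -- Cramer's rule for the expansion of x in the basis u, w, with the denominator cleared.
  cramer-identity : ∀ u w x →
      (u ∧ w) ⊙ x ≈ⱽ ((u ∧ x) * proj₁ w - (w ∧ x) * proj₁ u , (u ∧ x) * proj₂ w - (w ∧ x) * proj₂ u)
  cramer-identity (a , b) (c , d) (s , t) =
    solve 6 (λ a b c d s t → (a :* d :- b :* c) :* s := (a :* t :- b :* s) :* c :- (c :* t :- d :* s) :* a)
        refl a b c d s t ,
    solve 6 (λ a b c d s t → (a :* d :- b :* c) :* t := (a :* t :- b :* s) :* d :- (c :* t :- d :* s) :* b)
        refl a b c d s t

  module _ (k h : PGL₂) (X₀ X₁ X₂ : V) (X₀≉0 : NonZero X₀) (X₁≉0 : NonZero X₁) (X₂≉0 : NonZero X₂)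
    (sep₀₁ : Separated (apply k X₀) (apply k X₁))
    (sep₀₂ : Separated (apply k X₀) (apply k X₂))
    (sep₁₂ : Separated (apply k X₁) (apply k X₂))
    (h₀ : proj₁ (apply h X₀) ≈ 0#) (h₁ : proj₁ (apply h X₁) ≈ proj₂ (apply h X₁))
        (h₂ : proj₂ (apply h X₂) ≈ 0#)
    where
    private
      open PGL₂ k using () renaming (det≉0 to δ≉0)

      U₀ U₁ U₂ : V
      U₀ = apply k X₀
      U₁ = apply k X₁
      U₂ = apply k X₂

      row₁ : ∃ λ α → ∀ w → proj₁ (apply h w) ≈ α * (X₀ ∧ w)
      row₁ = row (PGL₂.a h) (PGL₂.b h) X₀ X₀≉0 h₀

      row₂ : ∃ λ β → ∀ w → proj₂ (apply h w) ≈ β * (X₂ ∧ w)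
      row₂ = row (PGL₂.c h) (PGL₂.d h) X₂ X₂≉0 h₂

      α β : Carrier
      α = proj₁ row₁
      β = proj₁ row₂

      α≉0 : α ≉ 0#
      α≉0 α≈0 = apply-nonZero h X₂ X₂≉0 (trans (proj₂ row₁ X₂) (trans (*-congʳ α≈0) (zeroˡ _)) , h₂)

      δ-row₁ : ∀ w → δ k * proj₁ (apply h w) ≈ α * (U₀ ∧ apply k w)
      δ-row₁ w = trans (*-congˡ (proj₂ row₁ w))
          (trans (solve 3 (λ d a x → d :* (a :* x) := a :* (d :* x)) refl (δ k) α (X₀ ∧ w))
          (*-congˡ (sym (apply-∧ k X₀ w))))

      δ-row₂ : ∀ w → δ k * proj₂ (apply h w) ≈ β * (U₂ ∧ apply k w)
      δ-row₂ w = trans (*-congˡ (proj₂ row₂ w))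
          (trans (solve 3 (λ d a x → d :* (a :* x) := a :* (d :* x)) refl (δ k) β (X₂ ∧ w))
          (*-congˡ (sym (apply-∧ k X₂ w))))

      m₀ m₁ m₂ : Carrier
      m₀ = proj₁ (norm-exists U₀)
      m₁ = proj₁ (norm-exists U₁)
      m₂ = proj₁ (norm-exists U₂)

      N₀ : Norm U₀ m₀
      N₀ = proj₂ (norm-exists U₀)
      N₁ : Norm U₁ m₁
      N₁ = proj₂ (norm-exists U₁)
      N₂ : Norm U₂ m₂
      N₂ = proj₂ (norm-exists U₂)

      m₀≉0 : m₀ ≉ 0#
      m₀≉0 = norm-≉0 U₀ (apply-nonZero k X₀ X₀≉0) N₀
      m₁≉0 : m₁ ≉ 0#
      m₁≉0 = norm-≉0 U₁ (apply-nonZero k X₁ X₁≉0) N₁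
      m₂≉0 : m₂ ≉ 0#
      m₂≉0 = norm-≉0 U₂ (apply-nonZero k X₂ X₂≉0) N₂

      rows-agree : α * (U₀ ∧ U₁) ≈ β * (U₂ ∧ U₁)
      rows-agree = trans (sym (δ-row₁ X₁)) (trans (*-congˡ h₁) (δ-row₂ X₁))

      -- Separation bounds u ∧ U₁ below by U m₁, and v ∧ U₁ is always at most V m₁. Applied in both
      -- directions to the equality of the rows of h at X₁, this yields |α| m₀ = |β| m₂.
      sandwich : ∀ {a b u v U V} → a * (u ∧ U₁) ≈ b * (v ∧ U₁) → Separated u U₁ → Norm u U → Norm v V →
          a * U ≼ b * V
      sandwich {a} {b} {u} {v} {U} {V} agree sep uU vV = ≼-cancelˡ m₁≉0 (≼-resp (shuffle a U) (shuffle b V)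
        (≼-trans (≼-*ˡ a (sep U m₁ uU N₁)) (≼-trans (≼-reflexive agree) (≼-*ˡ b (∧-≼ v U₁ vV N₁)))))
        where
        shuffle : ∀ a U → a * (U * m₁) ≈ m₁ * (a * U)
        shuffle a U = solve 3 (λ a U m → a :* (U :* m) := m :* (a :* U)) refl a U m₁

      αm₀≼βm₂ : α * m₀ ≼ β * m₂
      αm₀≼βm₂ = sandwich {α} {β} {U₀} {U₂} rows-agree sep₀₁ N₀ N₂

      βm₂≼αm₀ : β * m₂ ≼ α * m₀
      βm₂≼αm₀ = sandwich {β} {α} {U₂} {U₀} (sym rows-agree) (separated-sym U₁ U₂ sep₁₂) N₂ N₀

      δ⁻¹ : Carrier
      δ⁻¹ = proj₁ (invertible δ≉0)

      -- Its size is the common value of |α| m₀ and |β| m₂ divided by |det k|; the determinant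
      -- enters on passing from X ∧ w to kX ∧ kw.
      σ : Carrier
      σ = δ⁻¹ * (α * m₀)

      δσ : ∀ m → δ k * (σ * m) ≈ α * (m₀ * m)
      δσ m = trans (solve 5 (λ d i a u m → d :* ((i :* (a :* u)) :* m) := d :* (i :* (a :* (u :* m)))) refl
          (δ k) δ⁻¹ α m₀ m) (divide δ≉0 (α * (m₀ * m)))

      upper₁ : ∀ w m → Norm (apply k w) m → proj₁ (apply h w) ≼ σ * m
      upper₁ w m wm = ≼-cancelˡ δ≉0
          (≼-resp (sym (δ-row₁ w)) (sym (δσ m)) (≼-*ˡ α (∧-≼ U₀ (apply k w) N₀ wm)))

      upper₂ : ∀ w m → Norm (apply k w) m → proj₂ (apply h w) ≼ σ * m
      upper₂ w m wm = ≼-cancelˡ δ≉0 (≼-resp (sym (δ-row₂ w)) (sym (δσ m))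
        (≼-trans (≼-*ˡ β (∧-≼ U₂ (apply k w) N₂ wm))
            (≼-resp (*-assoc β m₂ m) (*-assoc α m₀ m) (≼-* {β * m₂} {α * m₀} {m} {m} βm₂≼αm₀ ≼-refl))))

      -- Here y is a coordinate in which x attains its norm. By separation the left side of Cramer's
      -- identity has size at least m₀ m₂ m, so one term on the right does too, and the coordinates
      -- of U₀ and U₂ are at most m₀ and m₂.
      lower-coordinate : ∀ (x : V) m y₀ y₂ y → (U₀ ∧ U₂) * y ≈ (U₀ ∧ x) * y₂ - (U₂ ∧ x) * y₀ → y₀ ≼ m₀ →
          y₂ ≼ m₂ → m ≼ y →
                         m₀ * m ≼ U₀ ∧ x ⊎ m₂ * m ≼ U₂ ∧ x
      lower-coordinate x m y₀ y₂ y identity y₀≼ y₂≼ m≼y =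
        [ (λ ≼₁ → inj₁ (≼-cancelˡ m₂≉0
            (≼-resp (solve 3 (λ a b m → (a :* b) :* m := b :* (a :* m)) refl m₀ m₂ m) (*-comm (U₀ ∧ x) m₂)
            (≼-trans ≼₁ (≼-*ˡ (U₀ ∧ x) y₂≼)))))
        , (λ ≼₂ → inj₂ (≼-cancelˡ m₀≉0
            (≼-resp (*-assoc m₀ m₂ m) (*-comm (U₂ ∧ x) m₀)
            (≼-trans ≼₂ (≼-trans (≼-neg ((U₂ ∧ x) * y₀)) (≼-*ˡ (U₂ ∧ x) y₀≼))))))
        ]′ (≼-+-split (≼-trans (≼-* (sep₀₂ m₀ m₂ N₀ N₂) m≼y) (≼-reflexive identity)))

      lower-bound : ∀ x m → Norm x m → m₀ * m ≼ U₀ ∧ x ⊎ m₂ * m ≼ U₂ ∧ x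
      lower-bound x m (_ , _ , inj₁ m≼s) = lower-coordinate x m (proj₁ U₀) (proj₁ U₂) (proj₁ x)
          (proj₁ (cramer-identity U₀ U₂ x)) (proj₁ N₀) (proj₁ N₂) m≼s
      lower-bound x m (_ , _ , inj₂ m≼t) = lower-coordinate x m (proj₂ U₀) (proj₂ U₂) (proj₂ x)
          (proj₂ (cramer-identity U₀ U₂ x)) (proj₁ (proj₂ N₀)) (proj₁ (proj₂ N₂)) m≼t

      lower₁₂ : ∀ w m → m₀ * m ≼ U₀ ∧ apply k w ⊎ m₂ * m ≼ U₂ ∧ apply k w →
          σ * m ≼ proj₁ (apply h w) ⊎ σ * m ≼ proj₂ (apply h w)
      lower₁₂ w m (inj₁ m₀m≼) = inj₁ (≼-cancelˡ δ≉0 (≼-resp (sym (δσ m)) (sym (δ-row₁ w)) (≼-*ˡ α m₀m≼)))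
      lower₁₂ w m (inj₂ m₂m≼) = inj₂ (≼-cancelˡ δ≉0 (≼-resp (sym (δσ m)) (sym (δ-row₂ w))
        (≼-trans (≼-resp (*-assoc α m₀ m) (*-assoc β m₂ m) (≼-* {α * m₀} {β * m₂} {m} {m} αm₀≼βm₂ ≼-refl))
            (≼-*ˡ β m₂m≼))))

    -- The coordinates of hw are multiples of X₀ ∧ w and X₂ ∧ w, and any two of
    -- the Xᵢ form an orthogonal basis for the norm ‖k_‖.
    norms-proportional : ∃ λ σ → σ ≉ 0# × (∀ w m → Norm (apply k w) m → Norm (apply h w) (σ * m))
    norms-proportional = σ , *-≉0 (inverse≉0 δ≉0) (*-≉0 α≉0 m₀≉0) ,
      λ w m wm → upper₁ w m wm , upper₂ w m wm , lower₁₂ w m (lower-bound (apply k w) m wm)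

-- Removing i and then j lowers the cardinality twice.
∣p∣≡1⇒unique : ∀ {n} {p : Subset n} {i j} → ∣ p ∣ ≡ 1 → i ∈ p → j ∈ p → ¬ (i ≡ j) → ⊥
∣p∣≡1⇒unique {p = p} {i} {j} ∣p∣≡1 i∈p j∈p i≢j = ℕ.<⇒≱
  (ℕ.≤-<-trans (ℕ.≤-trans (s≤s z≤n)
      (x∈p⇒∣p-x∣<∣p∣ {p = p Subset.- i} (x∈p∧x≢y⇒x∈p-y j∈p (λ j≡i → i≢j (≡.sym j≡i))))) (x∈p⇒∣p-x∣<∣p∣ i∈p))
  (ℕ.≤-reflexive ∣p∣≡1)

-- From the base field to its algebraic closure

module BaseChange (em : ∀ {a} → ExcludedMiddle a) {k ℓk l ℓl} (K : Field k ℓk) (L : Field l ℓl)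
  (closed : FieldProperties.IsAlgebraicallyClosed em L)
  (ι : Field.Carrier K → Field.Carrier L)
  (isHom : RingMorphisms.IsRingHomomorphism (Field.rawRing K) (Field.rawRing L) ι)
  where
  private
    module K = Field K
    module L = Field L
    module K[z] = RationalFunctions K.rawRing
    module LA = AlgebraicallyClosed em L closed
    module LE = Evaluation L.commutativeRing
  open RationalFunctions L.rawRing
  open NormalForms em L closed using (NormalForm)
  open Bézout em K L closed ι isHom
  open RingMorphisms.IsRingHomomorphism isHom

  baseChange-normalForm : ∀ {φ₀ d} → K[z].HasDegree φ₀ d →
    ∃ λ f → ∃ λ g → NormalForm (baseChange {R = K.rawRing} {S = L.rawRing} ι φ₀) f g d
  baseChange-normalForm {φ₀} {d} (f , g , (det , det′ , cross) , coprime , (df , dg , top)) =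
      map ι f , map ι g , record
    { represents   = determinate (K[z].num φ₀) (K[z].den φ₀) det , determinate f g det′
                   , LA.eval-ext (map ι (K[z].num φ₀) *ₚ map ι g) (map ι f *ₚ map ι (K[z].den φ₀)) cross-ι
    ; degree-num   = degree f df
    ; degree-den   = degree g dg
    ; nonVanishing = LA.rootless⇒nonVanishing (map ι f) (map ι g) d
        (coprime⇒rootless {f} {g} det′ (λ {z} → coprime {z})) (degree f df , degree g dg , top-ι top)
    }
    where
    determinate : ∀ f g → ¬ (f K[z].≈ₚ K[z].0ₚ × g K[z].≈ₚ K[z].0ₚ) → Determinate (map ι f / map ι g)
    determinate f g det (ιf≈0 , ιg≈0) = det (zero-ι f ιf≈0 , zero-ι g ιg≈0)
      where
      zero-ι : ∀ p → map ι p ≈ₚ 0ₚ → p K[z].≈ₚ K[z].0ₚ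
      zero-ι p ιp≈0 = decidable-stable em (λ p≉0 → ι-≉ₚ0 p p≉0 ιp≈0)

    cross-ι : ∀ x → eval (map ι (K[z].num φ₀) *ₚ map ι g) x L.≈ eval (map ι f *ₚ map ι (K[z].den φ₀)) x
    cross-ι x = begin
      eval (map ι (K[z].num φ₀) *ₚ map ι g) x          ≈⟨ LE.eval-* (map ι (K[z].num φ₀)) (map ι g) x ⟩
      eval-ι (K[z].num φ₀) x L.* eval-ι g x            ≈⟨ eval-ι-* (K[z].num φ₀) g x ⟨
      eval-ι (K[z].num φ₀ K[z].*ₚ g) x
          ≈⟨ eval-ι-cong (K[z].num φ₀ K[z].*ₚ g) (f K[z].*ₚ K[z].den φ₀) cross x ⟩
      eval-ι (f K[z].*ₚ K[z].den φ₀) x                 ≈⟨ eval-ι-* f (K[z].den φ₀) x ⟩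
      eval-ι f x L.* eval-ι (K[z].den φ₀) x            ≈⟨ LE.eval-* (map ι f) (map ι (K[z].den φ₀)) x ⟨
      eval (map ι f *ₚ map ι (K[z].den φ₀)) x          ∎
      where open import Relation.Binary.Reasoning.Setoid L.setoid

    degree : ∀ p → K[z].DegreeAtMost p d → DegreeAtMost (map ι p) d
    degree p dp n d<n = L.trans (coeff-ι p n) (L.trans (⟦⟧-cong (dp n d<n)) 0#-homo)

    coeff-≉0 : ∀ p → K[z].coeff p d K.≉ K.0# → coeff (map ι p) d L.≉ L.0#
    coeff-≉0 p p≉0 ιp≈0 = ι-≉0 p≉0 (L.trans (L.sym (coeff-ι p d)) ιp≈0)

    top-ι : K[z].coeff f d K.≉ K.0# ⊎ K[z].coeff g d K.≉ K.0# → coeff (map ι f) d L.≉ L.0# ⊎ coeff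
        (map ι g) d L.≉ L.0#
    top-ι (inj₁ f≉0) = inj₁ (coeff-≉0 f f≉0)
    top-ι (inj₂ g≉0) = inj₂ (coeff-≉0 g g≉0)

-- Normalising three points to 0, 1 and ∞

module ThreePoints (em : ∀ {a} → ExcludedMiddle a) {ℓc ℓ} (F : Field ℓc ℓ)
  (closed : FieldProperties.IsAlgebraicallyClosed em F) where
  open Field F hiding (zero)
  open IntegerRingSolver commutativeRing
  open RationalFunctions rawRing
  open FieldProperties em F
  open Plane em F
  open LinearChange em F closed
  open import Relation.Binary.Reasoning.Setoid setoid

  private
    action-coordinates : ∀ h x y → h • x ≈ y → ∃ λ s → ∃ λ t →
        (s , t) ≈ⱽ apply h (coordinates x) × [ s ∶ t ]≈ y
    action-coordinates h (fin x) y e =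
        _ , _ , (+-congˡ (sym (*-identityʳ _)) , +-congˡ (sym (*-identityʳ _))) , e
    action-coordinates h ∞       y e =
        _ , _ , (column (PGL₂.a h) (PGL₂.b h) , column (PGL₂.c h) (PGL₂.d h)) , e
      where
      column : ∀ a b → a ≈ a * 1# + b * 0#
      column = solve 2 (λ a b → a := a :* con (+ 1) :+ b :* con (+ 0)) refl

    ratio-cong : ∀ {s t s′ t′} y → (s , t) ≈ⱽ (s′ , t′) → [ s ∶ t ]≈ y → [ s′ ∶ t′ ]≈ y
    ratio-cong (fin y) (s≈ , t≈) (t≉0 , s≈yt) = ≉-cong t≈ t≉0 , trans (sym s≈) (trans s≈yt (*-congˡ t≈))
    ratio-cong ∞       (s≈ , t≈) (s≉0 , t≈0)  = ≉-cong s≈ s≉0 , trans (sym t≈) t≈0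

  action⇒∧≈0 : ∀ h x y → h • x ≈ y → apply h (coordinates x) ∧ coordinates y ≈ 0#
  action⇒∧≈0 h x y e with action-coordinates h x y e
  ... | s , t , st≈ , r =
      trans (∧-congʳ {apply h (coordinates x)} {s , t} (coordinates y) (sym (proj₁ st≈) , sym (proj₂ st≈)))
      (ratio⇒∧≈0 y r)

  ∧≈0⇒action : ∀ h x y → apply h (coordinates x) ∧ coordinates y ≈ 0# → h • x ≈ y
  ∧≈0⇒action h (fin x) y e = ratio-cong y (+-congˡ (*-identityʳ _) , +-congˡ (*-identityʳ _))
    (∧≈0⇒ratio y (apply-nonZero h (coordinates (fin x)) (coordinates-nonZero (fin x))) e)
  ∧≈0⇒action h ∞ y e = ratio-cong y (column (PGL₂.a h) (PGL₂.b h) , column (PGL₂.c h) (PGL₂.d h))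
    (∧≈0⇒ratio y (apply-nonZero h (coordinates ∞) (coordinates-nonZero ∞)) e)
    where
    column : ∀ a b → a * 1# + b * 0# ≈ a
    column = solve 2 (λ a b → a :* con (+ 1) :+ b :* con (+ 0) := a) refl

  private
    ∧-0 : ∀ s t → (s , t) ∧ coordinates (fin 0#) ≈ s
    ∧-0 = solve 2 (λ s t → s :* con (+ 1) :- t :* con (+ 0) := s) refl

    ∧-1 : ∀ s t → (s , t) ∧ coordinates (fin 1#) ≈ s - t
    ∧-1 = solve 2 (λ s t → s :* con (+ 1) :- t :* con (+ 1) := s :- t) refl

    ∧-∞ : ∀ s t → (s , t) ∧ coordinates ∞ ≈ - t
    ∧-∞ = solve 2 (λ s t → s :* con (+ 0) :- t :* con (+ 1) := :- t) refl

  sends-to-0 : ∀ h x → h • x ≈ fin 0# → proj₁ (apply h (coordinates x)) ≈ 0#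
  sends-to-0 h x e = trans (sym (∧-0 _ _)) (action⇒∧≈0 h x (fin 0#) e)

  sends-to-1 : ∀ h x → h • x ≈ fin 1# → proj₁ (apply h (coordinates x)) ≈ proj₂ (apply h (coordinates x))
  sends-to-1 h x e = x-y≈0⇒x≈y (trans (sym (∧-1 _ _)) (action⇒∧≈0 h x (fin 1#) e))

  sends-to-∞ : ∀ h x → h • x ≈ ∞ → proj₂ (apply h (coordinates x)) ≈ 0#
  sends-to-∞ h x e = trans (solve 1 (λ t → t := :- (:- t)) refl (proj₂ (apply h (coordinates x))))
    (trans (-‿cong (trans (sym (∧-∞ _ _)) (action⇒∧≈0 h x ∞ e))) (solve 0 (:- con (+ 0) := con (+ 0)) refl))

  module _ (x y z : P¹) (distinct : Distinct₃ x y z) where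
    private
      x̂ ŷ ẑ : V
      x̂ = coordinates x
      ŷ = coordinates y
      ẑ = coordinates z

      α β : Carrier
      α = ẑ ∧ ŷ
      β = x̂ ∧ ŷ

      α≉0 : α ≉ 0#
      α≉0 e = proj₂ (proj₂ distinct) (∧≈0⇒≈ᴾ y z (∧-sym-≈0 ẑ ŷ e))

      β≉0 : β ≉ 0#
      β≉0 e = proj₁ distinct (∧≈0⇒≈ᴾ x y e)

      x̂∧ẑ≉0 : x̂ ∧ ẑ ≉ 0#
      x̂∧ẑ≉0 e = proj₁ (proj₂ distinct) (∧≈0⇒≈ᴾ x z e)

    -- The rows of h are (ẑ ∧ ŷ) (x̂ ∧ _) and (x̂ ∧ ŷ) (ẑ ∧ _).
    normaliser : PGL₂
    normaliser = record
      { a = - (α * proj₂ x̂) ; b = α * proj₁ x̂ ; c = - (β * proj₂ ẑ) ; d = β * proj₁ ẑ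
      ; det≉0 = λ e → *-≉0 (*-≉0 α≉0 β≉0) x̂∧ẑ≉0 (trans
          (solve 6 (λ α β p q s t → (α :* β) :* (p :* t :- q :* s) := (:- (α :* q)) :* (β :* s) :-
              (α :* p) :* (:- (β :* t)))
            refl α β (proj₁ x̂) (proj₂ x̂) (proj₁ ẑ) (proj₂ ẑ)) e)
      }

    private
      linear : ∀ α u w → (- (α * proj₂ u)) * proj₁ w + (α * proj₁ u) * proj₂ w ≈ α * (u ∧ w)
      linear α (p , q) (s , t) =
          solve 5 (λ α p q s t → (:- (α :* q)) :* s :+ (α :* p) :* t := α :* (p :* t :- q :* s))
          refl α p q s t

    normaliser-normalises : NormalisesTo01∞ x y z normaliser
    normaliser-normalises =
      ∧≈0⇒action normaliser x (fin 0#)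
          (trans (∧-0 _ _) (trans (linear α x̂ x̂) (trans (*-congˡ (∧-self x̂)) (zeroʳ α)))) ,
      ∧≈0⇒action normaliser y (fin 1#)
          (trans (∧-1 _ _) (x≈y⇒x-y≈0 (trans (linear α x̂ ŷ) (trans (*-comm α β) (sym (linear β ẑ ŷ)))))) ,
      ∧≈0⇒action normaliser z ∞
          (trans (∧-∞ _ _) (trans (-‿cong (trans (linear β ẑ ẑ) (trans (*-congˡ (∧-self ẑ)) (zeroʳ β))))
        (solve 0 (:- con (+ 0) := con (+ 0)) refl)))

    -- The points sent to 0 and ∞ fix each row of h up to a scalar, and the point sent to 1 fixes
    -- the ratio of the two scalars.
    normaliser-unique : ∀ {h} → NormalisesTo01∞ x y z h → normaliser ≈ᴳ h
    normaliser-unique {h} (h₀ , h₁ , h₂) = s , entry₁ a b row₁ (proj₁ (proj₂ scalar)) , entry₂ a b row₁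
        (proj₁ (proj₂ scalar))
                                             , entry₁ c d row₂ (proj₂ (proj₂ scalar)) , entry₂ c d row₂
                                                 (proj₂ (proj₂ scalar))
      where
      open PGL₂ h
      row₁ : ∃ λ α′ → ∀ w → a * proj₁ w + b * proj₂ w ≈ α′ * (x̂ ∧ w)
      row₁ = row a b x̂ (coordinates-nonZero x) (sends-to-0 h x h₀)

      row₂ : ∃ λ β′ → ∀ w → c * proj₁ w + d * proj₂ w ≈ β′ * (ẑ ∧ w)
      row₂ = row c d ẑ (coordinates-nonZero z) (sends-to-∞ h z h₂)

      scalar : ∃ λ s → proj₁ row₁ ≈ s * α × proj₁ row₂ ≈ s * β
      scalar = parallel (λ e → α≉0 (proj₁ e)) (begin
        α * proj₁ row₂                       ≈⟨ *-comm α _ ⟩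
        proj₁ row₂ * (ẑ ∧ ŷ)                 ≈⟨ proj₂ row₂ ŷ ⟨
        c * proj₁ ŷ + d * proj₂ ŷ            ≈⟨ sends-to-1 h y h₁ ⟨
        a * proj₁ ŷ + b * proj₂ ŷ            ≈⟨ proj₂ row₁ ŷ ⟩
        proj₁ row₁ * (x̂ ∧ ŷ)                 ≈⟨ *-comm _ β ⟩
        β * proj₁ row₁                       ∎)

      s : Carrier
      s = proj₁ scalar

      entry₁ : ∀ a b {u α} (r : ∃ λ α′ → ∀ w → a * proj₁ w + b * proj₂ w ≈ α′ * (u ∧ w)) → proj₁ r ≈ s * α →
          a ≈ s * (- (α * proj₂ u))
      entry₁ a b {u} {α} (α′ , r) α′≈ = begin
        a                              ≈⟨ solve 2 (λ a b → a := a :* con (+ 1) :+ b :* con (+ 0)) refl a b ⟩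
        a * 1# + b * 0#                ≈⟨ r (1# , 0#) ⟩
        α′ * (u ∧ (1# , 0#))           ≈⟨ *-congʳ α′≈ ⟩
        (s * α) * (u ∧ (1# , 0#))
            ≈⟨ solve 4 (λ s α p q → (s :* α) :* (p :* con (+ 0) :- q :* con (+ 1)) := s :* (:- (α :* q)))
            refl s α (proj₁ u) (proj₂ u) ⟩
        s * (- (α * proj₂ u))          ∎

      entry₂ : ∀ a b {u α} (r : ∃ λ α′ → ∀ w → a * proj₁ w + b * proj₂ w ≈ α′ * (u ∧ w)) → proj₁ r ≈ s * α →
          b ≈ s * (α * proj₁ u)
      entry₂ a b {u} {α} (α′ , r) α′≈ = begin
        b                              ≈⟨ solve 2 (λ a b → b := a :* con (+ 0) :+ b :* con (+ 1)) refl a b ⟩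
        a * 0# + b * 1#                ≈⟨ r (0# , 1#) ⟩
        α′ * (u ∧ (0# , 1#))           ≈⟨ *-congʳ α′≈ ⟩
        (s * α) * (u ∧ (0# , 1#))
            ≈⟨ solve 4 (λ s α p q → (s :* α) :* (p :* con (+ 1) :- q :* con (+ 0)) := s :* (α :* p)) refl s
            α (proj₁ u) (proj₂ u) ⟩
        s * (α * proj₁ u)              ∎

    normaliser-∃! : ∃! _≈ᴳ_ (NormalisesTo01∞ x y z)
    normaliser-∃! = normaliser , normaliser-normalises , λ {h} → normaliser-unique {h}

-- The repelling, indifferent and attracting cases

module Detection (em : ∀ {a} → ExcludedMiddle a) {r ℓr₁ ℓr₂ l ℓl} (ℝ : CompleteOrderedField r ℓr₁ ℓr₂)
  (L : Field l ℓl) (closed : FieldProperties.IsAlgebraicallyClosed em L) (v : NonArchimedeanAbsoluteValue ℝ L) where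
  private
    module ℝ = CompleteOrderedField ℝ
  open NonArchimedeanAbsoluteValue v
  open Field L hiding (zero)
  open RationalFunctions rawRing
  open Evaluation commutativeRing
  open FieldProperties em L
  open AlgebraicallyClosed em L closed
  open Plane em L
  open NormalForms em L closed
  open LinearChange em L closed
  open Multipliers em L closed
  open Dynamics ℝ L v
  open Valuation em ℝ L v
  open GoodReductions em ℝ L closed v
  open Separation em ℝ L closed v
  open Comparison em ℝ L closed v
  open ThreePoints em L closed

  ≉ᴾ-sym : ∀ x y → x ≉ᴾ y → y ≉ᴾ x
  ≉ᴾ-sym x y x≉y y≈x = x≉y (∧≈0⇒≈ᴾ x y (∧-sym-≈0 (coordinates y) (coordinates x) (≈ᴾ⇒∧≈0 y x y≈x)))

  module _ {φ f g e} (nf : NormalForm φ f g (suc (suc e))) where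
    open NormalForm nf
    open FixedPointTheory nf
    open NonConstant nf using (surjective)
    private
      n d : ℕ
      n = suc e
      d = suc n

      Φ : V → V
      Φ = value f g d

      coords-≉0 : ∀ x → NonZero (coordinates x)
      coords-≉0 = coordinates-nonZero

      module At (k : PGL₂) where
        Ψ₁ Ψ₂ : Poly
        Ψ₁ = conjugate-num k f g d
        Ψ₂ = conjugate-den k f g d

        Ψ : V → V
        Ψ = value Ψ₁ Ψ₂ d

        nfₖ : NormalForm (conjugate k φ) Ψ₁ Ψ₂ d
        nfₖ = Conjugate.normalForm k nf

        û : P¹ → V
        û x = apply k (coordinates x)

        û-≉0 : ∀ x → NonZero (û x)
        û-≉0 x = apply-nonZero k (coordinates x) (coords-≉0 x)

        û-∧ : ∀ x y → x ≉ᴾ y → û x ∧ û y ≉ 0#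
        û-∧ x y x≉y ûxûy≈0 = x≉y
            (∧≈0⇒≈ᴾ x y (*-cancel-≈0 (PGL₂.det≉0 k)
            (trans (sym (apply-∧ k (coordinates x) (coordinates y))) ûxûy≈0)))

        Ψ-image : ∀ x y → φ ⟨ x ⟩≈ y → û y ∧ Ψ (û x) ≈ 0#
        Ψ-image x y im = conjugate-∧ nf k (coordinates y) (coordinates x)
          (∧-sym-≈0 (Φ (coordinates x)) (coordinates y) (image⇒∧≈0 x y im))

        Ψ-multiplier : ∀ x λ₀ → FixedPoint φ x → FixedPointMultiplier φ x λ₀ → Multiplier Ψ₁ Ψ₂ n (û x) λ₀
        Ψ-multiplier x λ₀ fp m = conjugate-multiplier nf k (multiplier x λ₀ fp m)

      good : ∀ k → GoodReduction (conjugate k φ) → GoodNorm (At.Ψ₁ k) (At.Ψ₂ k) d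
      good k gr = integral⇒goodNorm (NormalForm.degree-num (At.nfₖ k)) (NormalForm.degree-den (At.nfₖ k))
        (goodReduction⇒integral (At.nfₖ k) gr)

    repelling⇒¬potentiallyGood : ∀ x → FixedPoint φ x → Repelling φ x → ¬ PotentiallyGoodReduction φ
    repelling⇒¬potentiallyGood x fp (λ₀ , m , 1≤λ , 1≉λ) (k , gr) = 1≉λ (ℝ.antisym 1≤λ (≼1⇒≤1
      (multiplier-≼1 (At.nfₖ k) (good k gr) (At.û-≉0 k x) (At.Ψ-multiplier k x λ₀ fp m))))

    -- Congruence of points depends on the coordinate system, so separation is asked in every system
    -- k in which φ has good reduction.
    SeparatedTriple : P¹ → P¹ → P¹ → Set _
    SeparatedTriple x y z = ∀ k → GoodReduction (conjugate k φ) →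
      Separated (At.û k x) (At.û k y) × Separated (At.û k x) (At.û k z) × Separated (At.û k y) (At.û k z)

    detects : ∀ x y z → SeparatedTriple x y z → ∀ h → NormalisesTo01∞ x y z h →
        DetectsPotentiallyGoodReduction φ h
    detects x y z separated h (h₀ , h₁ , h₂) = NonConstant.isRationalFunction (At.nfₖ h) , mk⇔ to
        (λ gr → h , gr)
      where
      to : PotentiallyGoodReduction φ → GoodReduction (conjugate h φ)
      to (k , gr) = integral⇒goodReduction (At.nfₖ h)
        (goodNorm⇒integral (NormalForm.degree-num (At.nfₖ h)) (NormalForm.degree-den (At.nfₖ h))
          (goodAt⇒goodNorm nf h (proportional-goodAt nf k h (proj₁ σ) (proj₁ (proj₂ σ)) (proj₂ (proj₂ σ))
            (goodNorm⇒goodAt nf k (good k gr)))))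
        where
        sep = separated k gr
        σ : ∃ λ σ → σ ≉ 0# × _
        σ = norms-proportional k h (coordinates x) (coordinates y) (coordinates z)
          (coords-≉0 x) (coords-≉0 y) (coords-≉0 z) (proj₁ sep) (proj₁ (proj₂ sep)) (proj₂ (proj₂ sep))
          (sends-to-0 h x h₀) (sends-to-1 h y h₁) (sends-to-∞ h z h₂)

    -- The pair x, y₁ is separated because y₁ is another preimage of x. Both x, y₂ and y₁, y₂ are
    -- mapped by φ to x, y₁, and separation pulls back along φ.
    indifferent-separated : ∀ x y₁ y₂ → FixedPoint φ x → Indifferent φ x → φ ⟨ y₁ ⟩≈ x → y₁ ≉ᴾ x →
        φ ⟨ y₂ ⟩≈ y₁ → SeparatedTriple x y₁ y₂
    indifferent-separated x y₁ y₂ fp (λ₀ , m , lift ∣λ∣≈1) im₁ y₁≉x im₂ k gr = sep₀₁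
      , lift-separated x y₂ x y₁ fp im₂ sep₀₁
      , lift-separated y₁ y₂ x y₁ im₁ im₂ sep₀₁
      where
      open At k
      gn : GoodNorm Ψ₁ Ψ₂ d
      gn = good k gr

      sep₀₁ : Separated (û x) (û y₁)
      sep₀₁ = preimage-separated nfₖ gn (û-≉0 x) (û-≉0 y₁) (Ψ-multiplier x λ₀ fp m) (≈1⇒1≼ ∣λ∣≈1)
        (Ψ-image y₁ x im₁) (û-∧ x y₁ (≉ᴾ-sym y₁ x y₁≉x))

      lift-separated : ∀ u w a b → φ ⟨ u ⟩≈ a → φ ⟨ w ⟩≈ b → Separated (û a) (û b) → Separated (û u) (û w)
      lift-separated u w a b u↦a w↦b sep = Φ-separated nfₖ gn (û u) (û w) (û-≉0 u) (û-≉0 w)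
        (separated-parallel {û a} {û b} {Ψ (û u)} {Ψ (û w)} (û-≉0 a) (û-≉0 b)
          (NormalForm.value-nonZero nfₖ (û u) (û-≉0 u)) (NormalForm.value-nonZero nfₖ (û w) (û-≉0 w))
          (∧-sym-≈0 (û a) (Ψ (û u)) (Ψ-image u a u↦a)) (∧-sym-≈0 (û b) (Ψ (û w)) (Ψ-image w b w↦b)) sep)

    attracting-separated : ∀ x y z → (∀ p → p ≡ x ⊎ p ≡ y ⊎ p ≡ z → FixedPoint φ p × Attracting φ p) →
        Distinct₃ x y z → SeparatedTriple x y z
    attracting-separated x y z attracting (x≉y , x≉z , y≉z) k gr =
      pair x y (attracting x (inj₁ ≡.refl)) (proj₁ (attracting y (inj₂ (inj₁ ≡.refl)))) x≉y ,
      pair x z (attracting x (inj₁ ≡.refl)) (proj₁ (attracting z (inj₂ (inj₂ ≡.refl)))) x≉z ,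
      pair y z (attracting y (inj₂ (inj₁ ≡.refl))) (proj₁ (attracting z (inj₂ (inj₂ ≡.refl)))) y≉z
      where
      open At k
      pair : ∀ x y → FixedPoint φ x × Attracting φ x → FixedPoint φ y → x ≉ᴾ y → Separated (û x) (û y)
      pair x y (fp , λ₀ , m , λ<1) fp′ x≉y = fixedPoint-separated nfₖ (good k gr) (û-≉0 x) (û-≉0 y)
        (Ψ-multiplier x λ₀ fp m) (<1⇒Small λ<1) (Ψ-image y y fp′) (û-∧ x y x≉y)

    private
      image-multiple : ∀ v y x → NonZero v → v ∧ coordinates y ≈ 0# → Φ v ∧ coordinates x ≈ 0# → φ ⟨ y ⟩≈ x
      image-multiple v y x v≉0 vy≈0 Φvx≈0 = ∧≈0⇒image y x (trans
        (∧-congʳ {Φ (coordinates y)} {c ^ᵈ ⊙ Φ v} (coordinates x)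
          ( trans (proj₁ (value-cong (proj₂ multiple))) (proj₁ (value-⊙ c v))
          , trans (proj₂ (value-cong (proj₂ multiple))) (proj₂ (value-⊙ c v))))
        (trans (∧-⊙ˡ (c ^ᵈ) (Φ v) (coordinates x)) (trans (*-congˡ Φvx≈0) (zeroʳ _))))
        where
        multiple : ∃ λ c → coordinates y ≈ⱽ c ⊙ v
        multiple = ∧≈0⇒multiple v (coordinates y) v≉0 vy≈0
        c : Carrier
        c = proj₁ multiple
        _^ᵈ : Carrier → Carrier
        x ^ᵈ = PolynomialProperties._^_ commutativeRing x d

      image-unique : ∀ u w a b → u ≈ᴾ w → φ ⟨ u ⟩≈ a → φ ⟨ w ⟩≈ b → a ≈ᴾ b
      image-unique u w a b u≈w u↦a w↦b =
          ∧≈0⇒≈ᴾ a b (∧-trans (coordinates a) (Φ (coordinates w)) (coordinates b)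
        (value-nonZero (coordinates w) (coords-≉0 w))
        (∧-sym-≈0 (Φ (coordinates w)) (coordinates a) (image⇒∧≈0 w a
          (image-multiple (coordinates u) w a (coords-≉0 u) (≈ᴾ⇒∧≈0 u w u≈w) (image⇒∧≈0 u a u↦a))))
        (image⇒∧≈0 w b w↦b))

    -- The image of y₂ is y₁, while x and y₁ both have the image x, which differs from y₁.
    preimages-distinct : ∀ x y₁ y₂ → FixedPoint φ x → φ ⟨ y₁ ⟩≈ x → y₁ ≉ᴾ x → φ ⟨ y₂ ⟩≈ y₁ →
        Distinct₃ x y₁ y₂
    preimages-distinct x y₁ y₂ fp im₁ y₁≉x im₂ = x≉y₁ ,
      (λ x≈y₂ → x≉y₁ (image-unique x y₂ x y₁ x≈y₂ fp im₂)) ,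
      (λ y₁≈y₂ → x≉y₁ (image-unique y₁ y₂ x y₁ y₁≈y₂ im₁ im₂))
      where
      x≉y₁ : x ≉ᴾ y₁
      x≉y₁ = ≉ᴾ-sym y₁ x y₁≉x

    preimage-exists : ∀ y → ∃ λ x → φ ⟨ x ⟩≈ y
    preimage-exists y = proj₁ x , image-multiple w (proj₁ x) y w≉0 (proj₂ x) (proj₂ (proj₂ w-data))
      where
      w-data : ∃ λ w → NonZero w × Φ w ∧ coordinates y ≈ 0#
      w-data = surjective (coordinates y) (coords-≉0 y)
      w = proj₁ w-data
      w≉0 = proj₁ (proj₂ w-data)
      x : ∃ λ x → w ∧ coordinates x ≈ 0#
      x = point w w≉0

    -- A zero of the cofactor is a preimage of x; it differs from x because the
    -- multiplier does not vanish.
    other-preimage : ∀ x λ₀ → FixedPoint φ x → FixedPointMultiplier φ x λ₀ → λ₀ ≉ 0# → ∃ λ y →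
        φ ⟨ y ⟩≈ x × y ≉ᴾ x
    other-preimage x λ₀ fp m λ≉0 = proj₁ y
      , image-multiple w (proj₁ y) x w≉0 (proj₂ y)
          (∧-sym-≈0 x̂ (Φ w) (trans (factor w) (trans (*-congˡ K[w]≈0) (zeroʳ (x̂ ∧ w)))))
      , λ y≈x → *-≉0 λ≉0 (eigenvalue≉0 nf x̂ μ (coords-≉0 x) eigen)
          (trans (sym cofactor-self) (K[x]≈0 (w∥x y≈x)))
      where
      open Multiplier (multiplier x λ₀ fp m)
      x̂ : V
      x̂ = coordinates x

      root : ∃ λ s → ∃ λ t → ¬ (s ≈ 0# × t ≈ 0#) × form cofactor n s t ≈ 0#
      -- The cofactor is a form of degree d - 1, which is positive because d is at least 2.
      root = form-root cofactor e degree-cofactor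

      w : V
      w = proj₁ root , proj₁ (proj₂ root)

      w≉0 : NonZero w
      w≉0 = proj₁ (proj₂ (proj₂ root))

      K[w]≈0 : formⱽ cofactor n w ≈ 0#
      K[w]≈0 = proj₂ (proj₂ (proj₂ root))

      y : ∃ λ y → w ∧ coordinates y ≈ 0#
      y = point w w≉0

      w∥x : proj₁ y ≈ᴾ x → ∃ λ c → x̂ ≈ⱽ c ⊙ w
      w∥x y≈x = ∧≈0⇒multiple w x̂ w≉0 (∧-trans w (coordinates (proj₁ y)) x̂ (coords-≉0 (proj₁ y)) (proj₂ y)
          (≈ᴾ⇒∧≈0 (proj₁ y) x y≈x))

      K[x]≈0 : (∃ λ c → x̂ ≈ⱽ c ⊙ w) → formⱽ cofactor n x̂ ≈ 0#
      K[x]≈0 (c , x̂≈) = trans (form-cong cofactor n (proj₁ x̂≈) (proj₂ x̂≈))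
        (trans (form-scale cofactor n c (proj₁ w) (proj₂ w) degree-cofactor)
            (trans (*-congˡ K[w]≈0) (zeroʳ _)))

    indifferent-preimages : ∀ x → FixedPoint φ x → Indifferent φ x → ∃ λ y₁ → ∃ λ y₂ →
        φ ⟨ y₁ ⟩≈ x × y₁ ≉ᴾ x × φ ⟨ y₂ ⟩≈ y₁
    indifferent-preimages x fp (λ₀ , m , lift ∣λ∣≈1) = proj₁ y₁ , proj₁ y₂ , proj₁ (proj₂ y₁) , proj₂
        (proj₂ y₁) , proj₂ y₂
      where
      y₁ : ∃ λ y → φ ⟨ y ⟩≈ x × y ≉ᴾ x
      y₁ = other-preimage x λ₀ fp m (≼⇒≉0 1≉0 (≈1⇒1≼ ∣λ∣≈1))
      y₂ : ∃ λ y₂ → φ ⟨ y₂ ⟩≈ proj₁ y₁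
      y₂ = preimage-exists (proj₁ y₁)

    trichotomy : ∀ x → FixedPoint φ x → ¬ Repelling φ x → ¬ Indifferent φ x → Attracting φ x
    trichotomy x fp ¬repelling ¬indifferent = proj₁ μ , proj₂ μ , λ<1
      where
      μ : ∃ λ λ₀ → FixedPointMultiplier φ x λ₀
      μ = multiplier-exists x fp

      ∣μ∣≉1 : ¬ (∣ proj₁ μ ∣ᵥ ℝ.≈ ℝ.1#)
      ∣μ∣≉1 ∣μ∣≈1 = ¬indifferent (proj₁ μ , proj₂ μ , lift ∣μ∣≈1)

      λ<1 : ∣ proj₁ μ ∣ᵥ ℝ.< ℝ.1#
      λ<1 = [ (λ ≤1 → ≤1 , ∣μ∣≉1)
            , (λ 1≤ → ⊥-elim (¬repelling (proj₁ μ , proj₂ μ , 1≤ , λ 1≈∣μ∣ → ∣μ∣≉1 (ℝ.sym 1≈∣μ∣)))) ]′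
            (ℝ.total ∣ proj₁ μ ∣ᵥ ℝ.1#)

    attracting-simple : ∀ x → FixedPoint φ x → Attracting φ x → FixedPointMultiplicity φ x 1
    attracting-simple x fp (λ₀ , m , λ<1) = multiplier≉1⇒simple x λ₀ fp m
      (λ λ≈1 → <1⇒Small λ<1 (≼-reflexive (sym λ≈1)))

    -- An attracting fixed point is simple, so the set of indices at which it is listed has one
    -- element.
    attracting-distinct : ∀ {N} (xs : Vector P¹ N) → FixedPoints φ xs → ∀ i j → ¬ (i ≡ j) →
        Attracting φ (xs i) → xs i ≉ᴾ xs j
    attracting-distinct xs fps i j i≢j attracting xᵢ≈xⱼ = ∣p∣≡1⇒unique (proj₁ (proj₂ S)) (member i xᵢ≈xᵢ)
        (member j xⱼ≈xᵢ) i≢j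
      where
      open FixedPoints fps
      S = occurrences (xs i) 1 (fixed i) (attracting-simple (xs i) (fixed i) attracting)
      member : ∀ j → xs j ≈ᴾ xs i → _
      member j = Equivalence.from (proj₂ (proj₂ S) j)
      xᵢ≈xᵢ : xs i ≈ᴾ xs i
      xᵢ≈xᵢ = ∧≈0⇒≈ᴾ (xs i) (xs i) (∧-self (coordinates (xs i)))
      xⱼ≈xᵢ : xs j ≈ᴾ xs i
      xⱼ≈xᵢ = ∧≈0⇒≈ᴾ (xs j) (xs i) (∧-sym-≈0 (coordinates (xs i)) (coordinates (xs j))
          (≈ᴾ⇒∧≈0 (xs i) (xs j) xᵢ≈xⱼ))

    module FixedPointsTheorem (xs : Vector P¹ (suc d)) (fps : FixedPoints φ xs) where
      open FixedPoints fps using (fixed)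

      x₁ x₂ x₃ : P¹
      x₁ = xs zero
      x₂ = xs (suc zero)
      x₃ = xs (suc (suc zero))

      repelling-case : (∃ λ i → Repelling φ (xs i)) → ¬ PotentiallyGoodReduction φ
      repelling-case (i , repelling) = repelling⇒¬potentiallyGood (xs i) (fixed i) repelling

      indifferent-case : ∀ i → Indifferent φ (xs i) → ∀ y₁ y₂ → φ ⟨ y₁ ⟩≈ xs i → y₁ ≉ᴾ xs i → φ ⟨ y₂ ⟩≈ y₁ →
        Distinct₃ (xs i) y₁ y₂ × ∃! _≈ᴳ_ (NormalisesTo01∞ (xs i) y₁ y₂) ×
        (∀ h → NormalisesTo01∞ (xs i) y₁ y₂ h → DetectsPotentiallyGoodReduction φ h)
      indifferent-case i indifferent y₁ y₂ im₁ y₁≉x im₂ = distinct , normaliser-∃! (xs i) y₁ y₂ distinct ,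
        detects (xs i) y₁ y₂ (indifferent-separated (xs i) y₁ y₂ (fixed i) indifferent im₁ y₁≉x im₂)
        where
        distinct : Distinct₃ (xs i) y₁ y₂
        distinct = preimages-distinct (xs i) y₁ y₂ (fixed i) im₁ y₁≉x im₂

      attracting-case : (∀ i → Attracting φ (xs i)) →
        Distinct₃ x₁ x₂ x₃ × ∃! _≈ᴳ_ (NormalisesTo01∞ x₁ x₂ x₃) ×
        (∀ h → NormalisesTo01∞ x₁ x₂ x₃ h → DetectsPotentiallyGoodReduction φ h)
      attracting-case attracting = distinct , normaliser-∃! x₁ x₂ x₃ distinct ,
        detects x₁ x₂ x₃ (attracting-separated x₁ x₂ x₃ all distinct)
        where
        distinct : Distinct₃ x₁ x₂ x₃
        distinct = attracting-distinct xs fps zero (suc zero) (λ ()) (attracting zero)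
                 , attracting-distinct xs fps zero (suc (suc zero)) (λ ()) (attracting zero)
                 , attracting-distinct xs fps (suc zero) (suc (suc zero)) (λ ()) (attracting (suc zero))

        all : ∀ p → p ≡ x₁ ⊎ p ≡ x₂ ⊎ p ≡ x₃ → FixedPoint φ p × Attracting φ p
        all p (inj₁ ≡.refl)        = fixed zero , attracting zero
        all p (inj₂ (inj₁ ≡.refl)) = fixed (suc zero) , attracting (suc zero)
        all p (inj₂ (inj₂ ≡.refl)) = fixed (suc (suc zero)) , attracting (suc (suc zero))

mainTheorem1 :
    (∀ {ℓ} → ExcludedMiddle ℓ) →
    ∀ {r ℓr₁ ℓr₂ k ℓk k̄ ℓk̄ : Level}
    (ℝ : CompleteOrderedField r ℓr₁ ℓr₂)
    (K : Field k ℓk) (K̄ : Field k̄ ℓk̄) (ι : Field.Carrier K → Field.Carrier K̄) →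
    IsAlgebraicClosure K K̄ ι →
    (v : NonArchimedeanAbsoluteValue ℝ K̄) →
    let module K[z] = RationalFunctions (Field.rawRing K)
        open RationalFunctions (Field.rawRing K̄)
        open Dynamics ℝ K̄ v
    in
    (φ₀ : K[z].Fraction) → K[z].IsRationalFunction φ₀ →
    (d : ℕ) (2≤d : 2 ≤ d) → K[z].HasDegree φ₀ d →
    let φ : Fraction
        φ = baseChange {R = Field.rawRing K} {S = Field.rawRing K̄} ι φ₀
    in
    (x : Vector P¹ (suc d)) → FixedPoints φ x →
    let x₁ = x (inject≤ {3} zero (s≤s 2≤d))
        x₂ = x (inject≤ {3} (suc zero) (s≤s 2≤d))
        x₃ = x (inject≤ {3} (suc (suc zero)) (s≤s 2≤d))
    in
    ((∃ λ i → Repelling φ (x i)) → ¬ PotentiallyGoodReduction φ)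
    ×
    ((∀ i → ¬ Repelling φ (x i)) →
      (∀ i → Indifferent φ (x i) →
        (∃ λ y₁ → ∃ λ y₂ → φ ⟨ y₁ ⟩≈ x i × y₁ ≉ᴾ x i × φ ⟨ y₂ ⟩≈ y₁)
        ×
        (∀ y₁ y₂ → φ ⟨ y₁ ⟩≈ x i → y₁ ≉ᴾ x i → φ ⟨ y₂ ⟩≈ y₁ →
          Distinct₃ (x i) y₁ y₂ ×
          ∃! _≈ᴳ_ (NormalisesTo01∞ (x i) y₁ y₂) ×
          (∀ h → NormalisesTo01∞ (x i) y₁ y₂ h → DetectsPotentiallyGoodReduction φ h)))
      ×
      ((∀ i → ¬ Indifferent φ (x i)) →
        (∀ i → Attracting φ (x i)) ×
        Distinct₃ x₁ x₂ x₃ ×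
        ∃! _≈ᴳ_ (NormalisesTo01∞ x₁ x₂ x₃) ×
        (∀ h → NormalisesTo01∞ x₁ x₂ x₃ h → DetectsPotentiallyGoodReduction φ h)))
mainTheorem1 em ℝ K K̄ ι closure v φ₀ _ (suc (suc e)) (s≤s (s≤s z≤n)) degree x fixedPoints =
  -- Matching on 2 ≤ d lets `inject≤` compute, so that the three points of the statement are the
  -- first three entries of x.
  repelling-case ,
  λ ¬repelling →
    (λ i indifferent → indifferent-preimages nf (x i) (fixed i) indifferent ,
        indifferent-case i indifferent) ,
    λ ¬indifferent →
      let attracting = λ i → trichotomy nf (x i) (fixed i) (¬repelling i) (¬indifferent i)
      in attracting , attracting-case attracting
  where
  open IsAlgebraicClosure closure
  open Detection em ℝ K̄ algebraicallyClosed v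
  open RationalFunctions.FixedPoints fixedPoints using (fixed)
  normal = BaseChange.baseChange-normalForm em K K̄ algebraicallyClosed ι isRingHomomorphism {φ₀}
      {suc (suc e)} degree
  nf = proj₂ (proj₂ normal)
  open FixedPointsTheorem nf x fixedPoints
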